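{- There is some constant $C>0$ such that, for all $n$ and $k$, every tournament with $n+Ck$ vertices contains a copy of every $n$-vertex oriented tree with $k$ leaves.
   Context: A tournament is a digraph in which, for any two distinct vertices $u,v$, exactly one of $uv$, $vu$ is an edge. An oriented tree is a digraph with at most one edge between any pair of vertices whose underlying undirected graph is a tree. A leaf is a vertex of degree 1 in the underlying tree. A tournament contains a copy of an oriented tree $T$ if it has a (not necessarily induced) sub-digraph isomorphic to $T$, with edge orientations respected. Rounding signs are omitted. -}

module Defs where

open import Data.Fin using (Fin; zero; suc; inject₁; fromℕ)
open import Data.List using (allFin; filter; length)
open import Data.Nat using (ℕ; _+_; NonZero; _≟_)
open import Data.Product using (Σ-syntax; _×_)
open import Data.Sum using (_⊎_)
open import Function.Definitions using (Injective)
open import Level using (0ℓ)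
open import Relation.Binary.Core using (Rel)
open import Relation.Binary.Definitions using (Asymmetric; Decidable; Irreflexive)
open import Relation.Binary.Construct.Closure.ReflexiveTransitive using (Star)
open import Relation.Binary.PropositionalEquality using (_≡_; _≢_)
open import Relation.Nullary using (¬_; Dec)
open import Relation.Nullary.Decidable using (_⊎-dec_)

-- Edges are decidable so that degrees and leaves can be counted; this is no
-- restriction for finite digraphs read classically.
record Digraph (n : ℕ) : Set₁ where
  field
    Edge   : Rel (Fin n) 0ℓ
    edge?  : Decidable Edge
    irrefl : Irreflexive _≡_ Edge

  -- Adjacency in the underlying undirected graph.
  Adj : Rel (Fin n) 0ℓ
  Adj u v = Edge u v ⊎ Edge v u

  adj? : Decidable Adj
  adj? u v = edge? u v ⊎-dec edge? v u

  degree : Fin n → ℕ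
  degree v = length (filter (adj? v) (allFin n))

  Leaf : Fin n → Set
  Leaf v = degree v ≡ 1

  leaf? : ∀ v → Dec (Leaf v)
  leaf? v = degree v ≟ 1

  numLeaves : ℕ
  numLeaves = length (filter leaf? (allFin n))

open Digraph

record IsTournament {n : ℕ} (G : Digraph n) : Set where
  field
    exactlyOne : ∀ u v → u ≢ v →
      (Edge G u v × ¬ Edge G v u) ⊎ (¬ Edge G u v × Edge G v u)

-- A cycle of the relation R, of length 3 + m: the vertices c 0, …, c (2 + m)
-- are distinct, consecutive ones are related, and the last is related to the
-- first.
record Cycle {n : ℕ} (R : Rel (Fin n) 0ℓ) : Set where
  field
    {m}      : ℕ
    c        : Fin (3 + m) → Fin n
    distinct : Injective _≡_ _≡_ c
    step     : ∀ i → R (c (inject₁ i)) (c (suc i))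
    close    : R (c (fromℕ (2 + m))) (c zero)

record IsTree {n : ℕ} (R : Rel (Fin n) 0ℓ) : Set where
  field
    nonEmpty  : NonZero n
    connected : ∀ u v → Star R u v
    acyclic   : ¬ Cycle R

record IsOrientedTree {n : ℕ} (T : Digraph n) : Set where
  field
    atMostOneEdge : Asymmetric (Edge T)
    isTree        : IsTree (Adj T)

-- A sub-digraph of G isomorphic to T is the image of an injective,
-- edge-preserving map; non-edges of T are unconstrained.
ContainsCopy : ∀ {N n} → Digraph N → Digraph n → Set
ContainsCopy {N} {n} G T =
  Σ[ f ∈ (Fin n → Fin N) ]
    Injective _≡_ _≡_ f × (∀ u v → Edge T u v → Edge G (f u) (f v))

{-# OPTIONS --safe #-}
module Submission where

-- Order the tournament so that every vertex precedes at least half of each interval after it and is preceded by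
-- at least half of each interval before it.  Then a directed path can run along the order and skip a set A of
-- forbidden vertices at the price of O(|A|) positions, and two vertices with A sparse between them are joined by a
-- directed path of three edges that avoids A.
--
-- Cut the tree into cores, with O(k) vertices in total, that are joined by O(k) long paths: directed ones, and
-- zigzags, whose sign word starts and ends with a turn.  A core is put into a window by adding leaves one at a time
-- and keeping the window half empty on both sides.  A directed path and the core behind it get an interval beside
-- the window, the out-paths after it and the in-paths before it; the farthest interval is filled first, and the
-- jump to it costs O(1) positions in the intervals which are still empty.  So O(k) positions are lost in total.
--
-- A zigzag can be placed anywhere: following Havet and Thomassé, one of two candidate starting vertices can always
-- be continued by a path that uses all but O(1) vertices of a given set, and at its final turn the path can move to
-- the next core, for whose root there are seven candidates, most of them on one side of the current vertex.

open import Defs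
open import Relation.Binary.Definitions using (DecidableEquality)
open import Data.Bool using (Bool; true; false; not; _∧_; _∨_; if_then_else_)
open import Data.Nat using (ℕ; zero; suc; _+_; _*_; _≤_; _<_; z≤n; s≤s)
open import Data.Nat.Properties hiding (_≟_)
open import Data.List using (List; []; _∷_; _++_; length; reverse; [_]; replicate; map)
open import Data.List.Properties using (unfold-reverse; ++-assoc; length-++; length-reverse; ++-identityʳ; reverse-++; reverse-involutive)
open import Data.Product using (Σ-syntax; _×_; _,_; proj₁; proj₂)
open import Data.Sum using (_⊎_; inj₁; inj₂)
open import Data.Empty using (⊥; ⊥-elim)
open import Data.Unit using (⊤; tt)
open import Relation.Nullary using (¬_; Dec; does; yes; no)
open import Relation.Binary.PropositionalEquality hiding ([_]; J)

-- The order of choices is the obstacle. A path into a core has to know its root, while its last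
-- vertices may fall among those intended for the core. So a root is offered together with a short
-- reserved list that the path must avoid, and the limbs of the core are laid only once the path is
-- known.
--
-- Losses must be additive. A limb spoils at most two positions outside its own interval, and each
-- is paid for with ten positions in both regions beside the window. Ten is the price of a jump: if
-- no arc leads from the free successors of its start to the free predecessors of its end, the
-- interval between them has at most `4 + 10 * f` vertices, `f` of them forbidden.
--
-- Seven roots put four on one side of any other vertex, and four vertices contain one with two
-- successors, which is enough for the last letters of a zigzag.
--
-- The constant is `2321 = 137 + 2 * 1092`. A core has a fixed price of `137`; a maximal path
-- between branch vertices and leaves costs at most `1090` beyond the number of its edges, two more
-- make up for edges counted at a branching, and a tree with `k` leaves has fewer than `2 * k` such
-- paths.

module Linear where
  open import Data.Bool using (T)
  open import Data.Nat using (_≤ᵇ_)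
  open import Data.Nat.Tactic.RingSolver using (solve-∀)

  -- Linear inequalities over the natural numbers, by reflection.

  infixl 6 _⊕_
  infixl 7 _⊛_
  data Ex : Set where
    var : ℕ → Ex
    con : ℕ → Ex
    _⊕_ : Ex → Ex → Ex
    _⊛_ : ℕ → Ex → Ex

  x₀ x₁ x₂ x₃ x₄ x₅ x₆ x₇ x₈ x₉ x₁₀ x₁₁ x₁₂ x₁₃ x₁₄ : Ex
  x₀ = var 0
  x₁ = var 1
  x₂ = var 2
  x₃ = var 3
  x₄ = var 4
  x₅ = var 5
  x₆ = var 6
  x₇ = var 7
  x₈ = var 8
  x₉ = var 9
  x₁₀ = var 10
  x₁₁ = var 11
  x₁₂ = var 12
  x₁₃ = var 13
  x₁₄ = var 14

  at : List ℕ → ℕ → ℕ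
  at [] _ = 0
  at (x ∷ _) zero = x
  at (_ ∷ xs) (suc i) = at xs i

  eval : List ℕ → Ex → ℕ
  eval ρ (var i) = at ρ i
  eval ρ (con k) = k
  eval ρ (a ⊕ b) = eval ρ a + eval ρ b
  eval ρ (k ⊛ a) = k * eval ρ a

  dot : List ℕ → List ℕ → ℕ
  dot [] _ = 0
  dot (c ∷ cs) [] = 0
  dot (c ∷ cs) (x ∷ xs) = c * x + dot cs xs

  add : List ℕ → List ℕ → List ℕ
  add [] ds = ds
  add (c ∷ cs) [] = c ∷ cs
  add (c ∷ cs) (d ∷ ds) = c + d ∷ add cs ds

  unit : ℕ → List ℕ
  unit zero = 1 ∷ []
  unit (suc i) = 0 ∷ unit i

  -- The constant term comes first.
  nf : Ex → List ℕ
  nf (var i) = 0 ∷ unit i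
  nf (con k) = k ∷ []
  nf (a ⊕ b) = add (nf a) (nf b)
  nf (k ⊛ a) = map (k *_) (nf a)

  dot-add : ∀ cs ds xs → dot (add cs ds) xs ≡ dot cs xs + dot ds xs
  dot-add [] ds xs = refl
  dot-add (c ∷ cs) [] xs = sym (+-identityʳ _)
  dot-add (c ∷ cs) (d ∷ ds) [] = refl
  dot-add (c ∷ cs) (d ∷ ds) (x ∷ xs) rewrite dot-add cs ds xs = lemma c d x _ _
    where
    lemma : ∀ c d x p q → (c + d) * x + (p + q) ≡ c * x + p + (d * x + q)
    lemma = solve-∀

  dot-unit : ∀ i xs → dot (unit i) xs ≡ at xs i
  dot-unit zero [] = refl
  dot-unit zero (x ∷ xs) = trans (+-identityʳ _) (+-identityʳ x)
  dot-unit (suc i) [] = refl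
  dot-unit (suc i) (x ∷ xs) = dot-unit i xs

  dot-map : ∀ k cs xs → dot (map (k *_) cs) xs ≡ k * dot cs xs
  dot-map k [] xs = sym (*-zeroʳ k)
  dot-map k (c ∷ cs) [] = sym (*-zeroʳ k)
  dot-map k (c ∷ cs) (x ∷ xs) rewrite dot-map k cs xs = lemma k c x _
    where
    lemma : ∀ k c x p → k * c * x + k * p ≡ k * (c * x + p)
    lemma = solve-∀

  nf-correct : ∀ e ρ → dot (nf e) (1 ∷ ρ) ≡ eval ρ e
  nf-correct (var i) ρ = dot-unit i ρ
  nf-correct (con k) ρ = trans (+-identityʳ _) (*-identityʳ k)
  nf-correct (a ⊕ b) ρ = trans (dot-add (nf a) (nf b) (1 ∷ ρ)) (cong₂ _+_ (nf-correct a ρ) (nf-correct b ρ))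
  nf-correct (k ⊛ a) ρ = trans (dot-map k (nf a) (1 ∷ ρ)) (cong (k *_) (nf-correct a ρ))

  _≦_ : List ℕ → List ℕ → Bool
  [] ≦ _ = true
  (c ∷ cs) ≦ [] = (c ≤ᵇ 0) ∧ (cs ≦ [])
  (c ∷ cs) ≦ (d ∷ ds) = (c ≤ᵇ d) ∧ (cs ≦ ds)

  ∧-split : ∀ a b → (a ∧ b) ≡ true → a ≡ true × b ≡ true
  ∧-split true b p = refl , p

  ≤ᵇ-sound : ∀ c d → (c ≤ᵇ d) ≡ true → c ≤ d
  ≤ᵇ-sound c d p = ≤ᵇ⇒≤ c d (subst T (sym p) tt)

  ≦-nil : ∀ cs xs → (cs ≦ []) ≡ true → dot cs xs ≤ 0
  ≦-nil [] xs p = z≤n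
  ≦-nil (c ∷ cs) [] p = z≤n
  ≦-nil (c ∷ cs) (x ∷ xs) p with ∧-split (c ≤ᵇ 0) (cs ≦ []) p
  ... | p₁ , p₂ = +-mono-≤ (*-monoˡ-≤ x (≤ᵇ-sound c 0 p₁)) (≦-nil cs xs p₂)

  ≦-sound : ∀ cs ds xs → (cs ≦ ds) ≡ true → dot cs xs ≤ dot ds xs
  ≦-sound [] ds xs p = z≤n
  ≦-sound (c ∷ cs) [] xs p = ≦-nil (c ∷ cs) xs p
  ≦-sound (c ∷ cs) (d ∷ ds) [] p = z≤n
  ≦-sound (c ∷ cs) (d ∷ ds) (x ∷ xs) p with ∧-split (c ≤ᵇ d) (cs ≦ ds) p
  ... | p₁ , p₂ = +-mono-≤ (*-monoˡ-≤ x (≤ᵇ-sound c d p₁)) (≦-sound cs ds xs p₂)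

  infix 5 _⊑_
  infixr 3 _⊢_
  infix 3 ⊩_
  data Ineq : Set where
    _⊑_ : Ex → Ex → Ineq

  data Entails : Set where
    ⊩_ : Ineq → Entails
    _⊢_ : Ineq → Entails → Entails

  ⟦_⟧ : Ineq → List ℕ → Set
  ⟦ a ⊑ b ⟧ ρ = eval ρ a ≤ eval ρ b

  ⟦_⟧ᴱ : Entails → List ℕ → Set
  ⟦ ⊩ f ⟧ᴱ ρ = ⟦ f ⟧ ρ
  ⟦ f ⊢ g ⟧ᴱ ρ = ⟦ f ⟧ ρ → ⟦ g ⟧ᴱ ρ

  -- l and r collect the two sides of the hypotheses.
  check : (l r : List ℕ) → Entails → Bool
  check l r (⊩ (a ⊑ b)) = add (nf a) r ≦ add (nf b) l
  check l r (a ⊑ b ⊢ g) = check (add (nf a) l) (add (nf b) r) g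

  sound : ∀ ρ l r g → check l r g ≡ true → dot l (1 ∷ ρ) ≤ dot r (1 ∷ ρ) → ⟦ g ⟧ᴱ ρ
  sound ρ l r (⊩ (a ⊑ b)) ok l≤r = +-cancelʳ-≤ (dot r ρ′) _ _ (begin
    eval ρ a + dot r ρ′        ≡⟨ cong (_+ dot r ρ′) (nf-correct a ρ) ⟨
    dot (nf a) ρ′ + dot r ρ′   ≡⟨ dot-add (nf a) r ρ′ ⟨
    dot (add (nf a) r) ρ′      ≤⟨ ≦-sound (add (nf a) r) (add (nf b) l) ρ′ ok ⟩
    dot (add (nf b) l) ρ′      ≡⟨ dot-add (nf b) l ρ′ ⟩
    dot (nf b) ρ′ + dot l ρ′   ≡⟨ cong (_+ dot l ρ′) (nf-correct b ρ) ⟩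
    eval ρ b + dot l ρ′        ≤⟨ +-monoʳ-≤ (eval ρ b) l≤r ⟩
    eval ρ b + dot r ρ′        ∎)
    where
    open ≤-Reasoning
    ρ′ = 1 ∷ ρ
  sound ρ l r (a ⊑ b ⊢ g) ok l≤r h = sound ρ _ _ g ok (begin
    dot (add (nf a) l) ρ′      ≡⟨ dot-add (nf a) l ρ′ ⟩
    dot (nf a) ρ′ + dot l ρ′   ≡⟨ cong (_+ dot l ρ′) (nf-correct a ρ) ⟩
    eval ρ a + dot l ρ′        ≤⟨ +-mono-≤ h l≤r ⟩
    eval ρ b + dot r ρ′        ≡⟨ cong (_+ dot r ρ′) (nf-correct b ρ) ⟨
    dot (nf b) ρ′ + dot r ρ′   ≡⟨ dot-add (nf b) r ρ′ ⟨
    dot (add (nf b) r) ρ′      ∎)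
    where
    open ≤-Reasoning
    ρ′ = 1 ∷ ρ

  -- The hypotheses are added up, each once, and compared with the goal coefficient by coefficient;
  -- nothing is searched for. A hypothesis that enters with a multiplicity is therefore passed
  -- several times or already multiplied, as in many calls below.
  lin : ∀ ρ g → check [] [] g ≡ true → ⟦ g ⟧ᴱ ρ
  lin ρ g ok = sound ρ [] [] g ok z≤n

  ≥-reflexive : ∀ {a b} → a ≡ b → b ≤ a
  ≥-reflexive e = ≤-reflexive (sym e)

open Linear using (Ex; con; _⊕_; _⊛_; _⊑_; _⊢_; ⊩_; lin; ≥-reflexive; x₀; x₁; x₂; x₃; x₄; x₅; x₆; x₇; x₈; x₉; x₁₀;
    x₁₁; x₁₂; x₁₃; x₁₄)

-- Trees cut into cores and long paths, and the positions that they need.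

module Trees where

  -- A zigzag enters the zone of the next core near its last turn: of the two directions of a turn,
  -- one always points to most of the candidate roots.
  data EndsTurn : List Bool → Set where
    turn : ∀ s → EndsTurn (s ∷ not s ∷ [])
    _∷_  : ∀ s {w} → EndsTurn w → EndsTurn (s ∷ w)

  same? : ∀ s t → (t ≡ s) ⊎ (t ≡ not s)
  same? true true = inj₁ refl
  same? true false = inj₂ refl
  same? false true = inj₂ refl
  same? false false = inj₁ refl

  data Tree : Set where
    node : List (Bool × Tree) → Tree

  mutual
    data Core : Set where
      core : List Child → Core

    -- A child of a core vertex: attached by an edge, by a directed path of 6 + m edges, or by a
    -- path that follows d and then a word which starts and ends with a turn.
    data Child : Set where
      sub : Bool → Core → Child
      dir : Bool → ℕ → Core → Child
      zig : (d s : Bool) (w : List Bool) → EndsTurn (s ∷ not s ∷ w) → Core → Child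

  graft : Bool → List Bool → Tree → Bool × Tree
  graft s [] t = s , t
  graft s (s′ ∷ w) t = s , node (graft s′ w t ∷ [])

  mutual
    flat : Core → Tree
    flat (core cs) = node (flats cs)

    flats : List Child → List (Bool × Tree)
    flats [] = []
    flats (c ∷ cs) = flatC c ∷ flats cs

    flatC : Child → Bool × Tree
    flatC (sub s c) = s , flat c
    flatC (dir s m c) = graft s (replicate (5 + m) s) (flat c)
    flatC (zig d s w _ c) = graft d (s ∷ not s ∷ w) (flat c)

  -- Vertices besides the root that go into the window of the root; a zigzag reserves two neighbours of its
  -- anchor there, since routing starts from a pair.
  skel : List Child → ℕ
  skel [] = 0
  skel (sub s (core cs′) ∷ cs) = suc (skel cs′ + skel cs)
  skel (dir s m c ∷ cs) = skel cs
  skel (zig d s w et c ∷ cs) = suc (suc (skel cs))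

  -- 137 + 68 * skel: seven windows of 1 + 4 * skel vertices, and the margins of the two sides.
  mutual
    need : Core → ℕ
    need (core cs) = 137 + 68 * skel cs + stemN cs

    stemN : List Child → ℕ
    stemN [] = 0
    stemN (sub s (core cs′) ∷ cs) = stemN cs′ + stemN cs
    stemN (dir s m c ∷ cs) = 80 + (1 + (m + need c)) + stemN cs
    stemN (zig d s w et c ∷ cs) = 80 + (3 + length w + need c) + stemN cs

  charge : Bool → Bool → ℕ → ℕ
  charge true true n = n
  charge false false n = n
  charge true false n = 0
  charge false true n = 0

  charge-same : ∀ s n → charge s s n ≡ n
  charge-same true n = refl
  charge-same false n = refl

  charge-split : ∀ s n → charge s true n + charge s false n ≡ n
  charge-split true n = +-identityʳ n
  charge-split false n = refl

  -- The interval of a directed path must lie on the side that its sign points to; a zigzag fits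
  -- anywhere and is always booked on the side `true`. The `40` is booked on both sides: `20` for
  -- forbidding two more vertices once the limb is laid, and `20` for the reserve that keeps later
  -- jumps possible.
  sideN : Bool → List Child → ℕ
  sideN σ [] = 0
  sideN σ (sub s (core cs′) ∷ cs) = sideN σ cs′ + sideN σ cs
  sideN σ (dir s m c ∷ cs) = 40 + charge s σ (1 + (m + need c)) + sideN σ cs
  sideN σ (zig d s w et c ∷ cs) = 40 + charge true σ (3 + length w + need c) + sideN σ cs

  side-split : ∀ cs → sideN true cs + sideN false cs ≡ stemN cs
  side-split [] = refl
  side-split (sub s (core cs′) ∷ cs) = ≤-antisym
      (lin (sideN true cs′ ∷ sideN true cs ∷ sideN false cs′ ∷ sideN false cs ∷ stemN cs′ ∷ stemN cs ∷ [])
      (x₀ ⊕ x₂ ⊑ x₄ ⊢ x₁ ⊕ x₃ ⊑ x₅ ⊢ ⊩ x₀ ⊕ x₁ ⊕ (x₂ ⊕ x₃) ⊑ x₄ ⊕ x₅)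
      refl (≤-reflexive (side-split cs′)) (≤-reflexive (side-split cs)))
      (lin (stemN cs′ ∷ stemN cs ∷ sideN true cs′ ∷ sideN true cs ∷ sideN false cs′ ∷ sideN false cs ∷ [])
      (x₀ ⊑ x₂ ⊕ x₄ ⊢ x₁ ⊑ x₃ ⊕ x₅ ⊢ ⊩ x₀ ⊕ x₁ ⊑ x₂ ⊕ x₃ ⊕ (x₄ ⊕ x₅))
      refl (≥-reflexive (side-split cs′)) (≥-reflexive (side-split cs)))
  side-split (dir s m c ∷ cs) = ≤-antisym
      (lin (charge s true (1 + (m + need c)) ∷ sideN true cs ∷ charge s false (1 + (m + need c)) ∷ sideN false
      cs ∷ m ∷ need c ∷ stemN cs ∷ []) (x₁ ⊕ x₃ ⊑ x₆ ⊢ x₀ ⊕ x₂ ⊑ con 1 ⊕ (x₄ ⊕ x₅)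
      ⊢ ⊩ con 40 ⊕ (x₀ ⊕ x₁) ⊕ (con 40 ⊕ (x₂ ⊕ x₃)) ⊑ con 81 ⊕ (x₄ ⊕ x₅ ⊕ x₆))
      refl (≤-reflexive (side-split cs)) (≤-reflexive (charge-split s (1 + (m + need c)))))
      (lin (m ∷ need c ∷ stemN cs ∷ charge s true (1 + (m + need c)) ∷ sideN true cs ∷ charge s false
      (1 + (m + need c)) ∷ sideN false cs ∷ []) (x₂ ⊑ x₄ ⊕ x₆ ⊢ con 1 ⊕ (x₀ ⊕ x₁) ⊑ x₃ ⊕ x₅
      ⊢ ⊩ con 81 ⊕ (x₀ ⊕ x₁ ⊕ x₂) ⊑ con 40 ⊕ (x₃ ⊕ x₄) ⊕ (con 40 ⊕ (x₅ ⊕ x₆)))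
      refl (≥-reflexive (side-split cs)) (≥-reflexive (charge-split s (1 + (m + need c)))))
  side-split (zig d s w et c ∷ cs) = ≤-antisym
      (lin (length w ∷ need c ∷ sideN true cs ∷ sideN false cs ∷ stemN cs ∷ []) (x₂ ⊕ x₃ ⊑ x₄
      ⊢ ⊩ con 43 ⊕ (x₀ ⊕ x₁ ⊕ x₂) ⊕ (con 40 ⊕ x₃) ⊑ con 83 ⊕ (x₀ ⊕ x₁ ⊕ x₄)) refl (≤-reflexive (side-split cs)))
      (lin (length w ∷ need c ∷ stemN cs ∷ sideN true cs ∷ sideN false cs ∷ []) (x₂ ⊑ x₃ ⊕ x₄
      ⊢ ⊩ con 83 ⊕ (x₀ ⊕ x₁ ⊕ x₂) ⊑ con 43 ⊕ (x₀ ⊕ x₁ ⊕ x₃) ⊕ (con 40 ⊕ x₄)) refl (≥-reflexive (side-split cs)))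

-- Lists as multisets.

module Counting {V : Set} (_≟_ : DecidableEquality V) where

  1≰0 : ¬ 1 ≤ 0
  1≰0 ()

  b2n : Bool → ℕ
  b2n true = 1
  b2n false = 0

  cnt : (V → Bool) → List V → ℕ
  cnt p [] = 0
  cnt p (x ∷ xs) = b2n (p x) + cnt p xs

  infix 4 _==_
  _==_ : V → V → Bool
  u == v = does (u ≟ v)

  # : V → List V → ℕ
  # v xs = cnt (v ==_) xs

  infix 4 _∈_
  _∈_ : V → List V → Set
  v ∈ xs = 1 ≤ # v xs

  Uniq : List V → Set
  Uniq xs = ∀ v → # v xs ≤ 1

  infix 4 _≈_
  -- Equality of multisets, stated for all predicates so that a permutation transports the count of
  -- neighbours or of forbidden vertices, and not just multiplicities.
  _≈_ : List V → List V → Set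
  xs ≈ ys = ∀ p → cnt p xs ≡ cnt p ys

  ==-refl : ∀ v → (v == v) ≡ true
  ==-refl v with v ≟ v
  ... | yes _ = refl
  ... | no v≢v = ⊥-elim (v≢v refl)

  ==-sound : ∀ {u v} → (u == v) ≡ true → u ≡ v
  ==-sound {u} {v} p with u ≟ v
  ... | yes q = q

  ==-≢ : ∀ {u v} → u ≢ v → (u == v) ≡ false
  ==-≢ {u} {v} ne with u ≟ v
  ... | yes p = ⊥-elim (ne p)
  ... | no _ = refl

  true≢false : ∀ {b} → b ≡ true → b ≡ false → ⊥
  true≢false refl ()

  ≢true : ∀ {b} → ¬ b ≡ true → b ≡ false
  ≢true {true} n = ⊥-elim (n refl)
  ≢true {false} n = refl

  dich : ∀ b → b ≡ true ⊎ b ≡ false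
  dich true = inj₁ refl
  dich false = inj₂ refl

  b2n≤1 : ∀ b → b2n b ≤ 1
  b2n≤1 true = ≤-refl
  b2n≤1 false = z≤n

  b2n-∨ : ∀ a b → b2n (a ∨ b) ≤ b2n a + b2n b
  b2n-∨ true b = s≤s z≤n
  b2n-∨ false b = ≤-refl

  b2n-not : ∀ b → b2n b + b2n (not b) ≡ 1
  b2n-not true = refl
  b2n-not false = refl

  cnt-++ : ∀ p xs ys → cnt p (xs ++ ys) ≡ cnt p xs + cnt p ys
  cnt-++ p [] ys = refl
  cnt-++ p (x ∷ xs) ys = trans (cong (b2n (p x) +_) (cnt-++ p xs ys)) (sym (+-assoc (b2n (p x)) _ _))

  cnt-reverse : ∀ p xs → cnt p (reverse xs) ≡ cnt p xs
  cnt-reverse p [] = refl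
  cnt-reverse p (x ∷ xs) = begin
    cnt p (reverse (x ∷ xs))        ≡⟨ cong (cnt p) (unfold-reverse x xs) ⟩
    cnt p (reverse xs ++ [ x ])     ≡⟨ cnt-++ p (reverse xs) [ x ] ⟩
    cnt p (reverse xs) + (b2n (p x) + 0) ≡⟨ cong₂ _+_ (cnt-reverse p xs) (+-identityʳ _) ⟩
    cnt p xs + b2n (p x)            ≡⟨ +-comm (cnt p xs) _ ⟩
    b2n (p x) + cnt p xs            ∎
    where open ≡-Reasoning

  cnt≤length : ∀ p xs → cnt p xs ≤ length xs
  cnt≤length p [] = z≤n
  cnt≤length p (x ∷ xs) = +-mono-≤ (b2n≤1 (p x)) (cnt≤length p xs)

  cnt-not : ∀ p xs → cnt p xs + cnt (λ x → not (p x)) xs ≡ length xs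
  cnt-not p [] = refl
  cnt-not p (x ∷ xs) = ≤-antisym
    (lin (b2n (p x) ∷ cnt p xs ∷ b2n (not (p x)) ∷ cnt (λ x₁ → not (p x₁)) xs ∷ length xs ∷ []) (x₀ ⊕ x₂ ⊑ con 1
        ⊢ x₁ ⊕ x₃ ⊑ x₄ ⊢ ⊩ x₀ ⊕ x₁ ⊕ (x₂ ⊕ x₃) ⊑ con 1 ⊕ x₄)
        refl (≤-reflexive (b2n-not (p x))) (≤-reflexive (cnt-not p xs)))
    (lin (length xs ∷ b2n (p x) ∷ cnt p xs ∷ b2n (not (p x)) ∷ cnt (λ x₁ → not (p x₁)) xs ∷ []) (con 1 ⊑ x₁ ⊕ x₃
        ⊢ x₀ ⊑ x₂ ⊕ x₄ ⊢ ⊩ con 1 ⊕ x₀ ⊑ x₁ ⊕ x₂ ⊕ (x₃ ⊕ x₄))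
        refl (≥-reflexive (b2n-not (p x))) (≥-reflexive (cnt-not p xs)))

  ∈-here : ∀ x xs → x ∈ (x ∷ xs)
  ∈-here x xs rewrite ==-refl x = s≤s z≤n

  ∈-there : ∀ {v} x xs → v ∈ xs → v ∈ (x ∷ xs)
  ∈-there x xs p = ≤-trans p (m≤n+m _ _)

  ∈-uncons : ∀ {v} x xs → v ∈ (x ∷ xs) → (v ≡ x) ⊎ (v ∈ xs)
  ∈-uncons {v} x xs p with v ≟ x
  ... | yes q = inj₁ q
  ... | no q = inj₂ p

  cnt-le : ∀ p q r xs → (∀ x → x ∈ xs → b2n (p x) ≤ b2n (q x) + b2n (r x)) → cnt p xs ≤ cnt q xs + cnt r xs
  cnt-le p q r [] h = z≤n
  cnt-le p q r (x ∷ xs) h =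
    lin (b2n (p x) ∷ cnt p xs ∷ b2n (q x) ∷ cnt q xs ∷ b2n (r x) ∷ cnt r xs ∷ []) (x₀ ⊑ x₂ ⊕ x₄ ⊢ x₁ ⊑ x₃ ⊕ x₅
        ⊢ ⊩ x₀ ⊕ x₁ ⊑ x₂ ⊕ x₃ ⊕ (x₄ ⊕ x₅)) refl (h x (∈-here x xs)) (cnt-le p q r xs (λ y m → h y (∈-there x xs m)))

  cnt-mono : ∀ p q xs → (∀ x → x ∈ xs → p x ≡ true → q x ≡ true) → cnt p xs ≤ cnt q xs
  cnt-mono p q [] h = z≤n
  cnt-mono p q (x ∷ xs) h = +-mono-≤ (f (h x (∈-here x xs))) (cnt-mono p q xs (λ y m → h y (∈-there x xs m)))
    where
    f : (p x ≡ true → q x ≡ true) → b2n (p x) ≤ b2n (q x)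
    f g with p x
    ... | false = z≤n
    ... | true rewrite g refl = ≤-refl

  cnt-∨ : ∀ p q xs → cnt (λ x → p x ∨ q x) xs ≤ cnt p xs + cnt q xs
  cnt-∨ p q xs = cnt-le _ p q xs (λ x _ → b2n-∨ (p x) (q x))

  cnt-zero : ∀ p xs → (∀ x → x ∈ xs → p x ≡ false) → cnt p xs ≡ 0
  cnt-zero p [] h = refl
  cnt-zero p (x ∷ xs) h rewrite h x (∈-here x xs) = cnt-zero p xs (λ y m → h y (∈-there x xs m))

  search? : ∀ (p : V → Bool) xs → (Σ[ v ∈ V ] (v ∈ xs) × (p v ≡ true)) ⊎ (∀ v → v ∈ xs → p v ≡ false)
  search? p [] = inj₂ λ v ()
  search? p (x ∷ xs) with dich (p x) | search? p xs
  ... | inj₁ t | _ = inj₁ (x , ∈-here x xs , t)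
  ... | inj₂ _ | inj₁ (v , m , t) = inj₁ (v , ∈-there x xs m , t)
  ... | inj₂ f | inj₂ g = inj₂ λ v m → h v (∈-uncons x xs m)
    where
    h : ∀ v → (v ≡ x) ⊎ (v ∈ xs) → p v ≡ false
    h v (inj₁ refl) = f
    h v (inj₂ m) = g v m

  cnt-exists : ∀ p q xs → cnt q xs < cnt p xs → Σ[ v ∈ V ] (v ∈ xs) × (p v ≡ true) × (q v ≡ false)
  cnt-exists p q xs lt with search? (λ x → p x ∧ not (q x)) xs
  ... | inj₁ (v , m , t) = v , m , l (p v) (q v) t
    where
    l : ∀ a b → (a ∧ not b) ≡ true → a ≡ true × b ≡ false
    l true false _ = refl , refl
  ... | inj₂ h = ⊥-elim (<⇒≱ lt (cnt-mono p q xs λ x m t → l (p x) (q x) (h x m) t))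
    where
    l : ∀ a b → (a ∧ not b) ≡ false → a ≡ true → b ≡ true
    l true true _ _ = refl

  ∈-split : ∀ {v} xs → v ∈ xs → Σ[ ys ∈ List V ] Σ[ zs ∈ List V ] (xs ≡ ys ++ v ∷ zs)
  ∈-split (x ∷ xs) m with ∈-uncons x xs m
  ... | inj₁ refl = [] , xs , refl
  ... | inj₂ m′ with ∈-split xs m′
  ...   | ys , zs , refl = x ∷ ys , zs , refl

  ∈-++ : ∀ {v} xs ys → v ∈ (xs ++ ys) → (v ∈ xs) ⊎ (v ∈ ys)
  ∈-++ [] ys m = inj₂ m
  ∈-++ (x ∷ xs) ys m with ∈-uncons x (xs ++ ys) m
  ... | inj₁ refl = inj₁ (∈-here x xs)
  ... | inj₂ m′ with ∈-++ xs ys m′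
  ...   | inj₁ k = inj₁ (∈-there x xs k)
  ...   | inj₂ k = inj₂ k

  ∈-++ˡ : ∀ {v} xs ys → v ∈ xs → v ∈ (xs ++ ys)
  ∈-++ˡ {v} xs ys m = lin (# v (xs ++ ys) ∷ # v xs ∷ # v ys ∷ []) (con 1 ⊑ x₁ ⊢ x₁ ⊕ x₂ ⊑ x₀ ⊢ ⊩ con 1 ⊑ x₀)
      refl m (≥-reflexive (cnt-++ (v ==_) xs ys))

  ∈-++ʳ : ∀ {v} xs ys → v ∈ ys → v ∈ (xs ++ ys)
  ∈-++ʳ {v} xs ys m = lin (# v (xs ++ ys) ∷ # v ys ∷ # v xs ∷ []) (con 1 ⊑ x₁ ⊢ x₂ ⊕ x₁ ⊑ x₀ ⊢ ⊩ con 1 ⊑ x₀)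
      refl m (≥-reflexive (cnt-++ (v ==_) xs ys))

  ∈-pred : ∀ (p : V → Bool) {v} → p v ≡ true → ∀ xs → v ∈ xs → 1 ≤ cnt p xs
  ∈-pred p t (x ∷ xs) m with ∈-uncons x xs m
  ... | inj₁ refl rewrite t = s≤s z≤n
  ... | inj₂ m′ = ≤-trans (∈-pred p t xs m′) (m≤n+m _ _)

  member : List V → V → Bool
  member [] v = false
  member (x ∷ xs) v = (v == x) ∨ member xs v

  member-sound : ∀ xs v → member xs v ≡ true → v ∈ xs
  member-sound (x ∷ xs) v t with v == x
  ... | true = s≤s z≤n
  ... | false = member-sound xs v t

  member-complete : ∀ xs v → v ∈ xs → member xs v ≡ true
  member-complete (x ∷ xs) v m with v == x
  ... | true = refl
  ... | false = member-complete xs v m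

  nonmember : ∀ xs v → member xs v ≡ false → # v xs ≡ 0
  nonmember xs v f with # v xs in eq
  ... | zero = refl
  ... | suc n = ⊥-elim (true≢false (member-complete xs v (≤-trans (s≤s z≤n) (≤-reflexive (sym eq)))) f)

  #-nonmember : ∀ xs v → # v xs ≡ 0 → member xs v ≡ false
  #-nonmember xs v eq = ≢true λ t → <⇒≱ (member-sound xs v t) (≤-reflexive eq)

  cnt-member : ∀ us xs → Uniq xs → cnt (member us) xs ≤ length us
  cnt-member [] xs uq = ≤-reflexive (cnt-zero _ xs λ x _ → #-nonmember [] x refl)
  cnt-member (u ∷ us) xs uq = lin (cnt (member (u ∷ us)) xs ∷ length us ∷ # u xs ∷ cnt (member us) xs ∷ [])
      (x₀ ⊑ x₂ ⊕ x₃ ⊢ x₂ ⊑ con 1 ⊢ x₃ ⊑ x₁ ⊢ ⊩ x₀ ⊑ con 1 ⊕ x₁)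
      refl (cnt-le (member (u ∷ us)) (u ==_) (member us) xs (λ x _ → l x)) (uq u) (cnt-member us xs uq)
    where
    l : ∀ x → b2n (member (u ∷ us) x) ≤ b2n (u == x) + b2n (member us x)
    l x with dich (member (u ∷ us) x)
    ... | inj₂ f rewrite f = z≤n
    ... | inj₁ t with ∈-uncons u us (member-sound (u ∷ us) x t)
    ...   | inj₁ refl rewrite t | ==-refl u = s≤s z≤n
    ...   | inj₂ m rewrite t | member-complete us x m = m≤n+m 1 (b2n (u == x))

  ≈-refl : ∀ xs → xs ≈ xs
  ≈-refl xs p = refl

  ≈-sym : ∀ xs ys → xs ≈ ys → ys ≈ xs
  ≈-sym xs ys h p = sym (h p)

  ≈-trans : ∀ xs ys zs → xs ≈ ys → ys ≈ zs → xs ≈ zs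
  ≈-trans xs ys zs h k p = trans (h p) (k p)

  length≡cnt : ∀ xs → length xs ≡ cnt (λ _ → true) xs
  length≡cnt [] = refl
  length≡cnt (x ∷ xs) = cong suc (length≡cnt xs)

  ≈-length : ∀ xs ys → xs ≈ ys → length xs ≡ length ys
  ≈-length xs ys h = trans (length≡cnt xs) (trans (h _) (sym (length≡cnt ys)))

  ≈-∷ : ∀ x xs ys → xs ≈ ys → (x ∷ xs) ≈ (x ∷ ys)
  ≈-∷ x xs ys h p = cong (b2n (p x) +_) (h p)

  ≈-shift : ∀ x ys zs → (ys ++ x ∷ zs) ≈ (x ∷ ys ++ zs)
  ≈-shift x ys zs p = ≤-antisym
    (lin (cnt p (ys ++ x ∷ zs) ∷ b2n (p x) ∷ cnt p (ys ++ zs) ∷ cnt p ys ∷ cnt p zs ∷ []) (x₀ ⊑ x₃ ⊕ (x₁ ⊕ x₄)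
        ⊢ x₃ ⊕ x₄ ⊑ x₂ ⊢ ⊩ x₀ ⊑ x₁ ⊕ x₂) refl (≤-reflexive (cnt-++ p ys (x ∷ zs))) (≥-reflexive (cnt-++ p ys zs)))
    (lin (b2n (p x) ∷ cnt p (ys ++ zs) ∷ cnt p (ys ++ x ∷ zs) ∷ cnt p ys ∷ cnt p zs ∷ []) (x₃ ⊕ (x₀ ⊕ x₄) ⊑ x₂
        ⊢ x₁ ⊑ x₃ ⊕ x₄ ⊢ ⊩ x₀ ⊕ x₁ ⊑ x₂) refl (≥-reflexive (cnt-++ p ys (x ∷ zs))) (≤-reflexive (cnt-++ p ys zs)))

  ≈-reverse : ∀ xs → reverse xs ≈ xs
  ≈-reverse xs p = cnt-reverse p xs

  ≈-∈ : ∀ {v} xs ys → xs ≈ ys → v ∈ xs → v ∈ ys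
  ≈-∈ xs ys h m = ≤-trans m (≤-reflexive (h _))

  Uniq-tail : ∀ x xs → Uniq (x ∷ xs) → Uniq xs
  Uniq-tail x xs u v = ≤-trans (m≤n+m _ _) (u v)

  Uniq-head : ∀ x xs → Uniq (x ∷ xs) → # x xs ≡ 0
  Uniq-head x xs u = n≤0⇒n≡0 (≤-pred (subst (λ b → b2n b + # x xs ≤ 1) (==-refl x) (u x)))

  Uniq-++ˡ : ∀ xs ys → Uniq (xs ++ ys) → Uniq xs
  Uniq-++ˡ xs ys u v = lin (# v xs ∷ # v (xs ++ ys) ∷ # v ys ∷ []) (x₁ ⊑ con 1 ⊢ x₀ ⊕ x₂ ⊑ x₁ ⊢ ⊩ x₀ ⊑ con 1)
      refl (u v) (≥-reflexive (cnt-++ (v ==_) xs ys))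

  Uniq-++ʳ : ∀ xs ys → Uniq (xs ++ ys) → Uniq ys
  Uniq-++ʳ xs ys u v = lin (# v ys ∷ # v (xs ++ ys) ∷ # v xs ∷ []) (x₁ ⊑ con 1 ⊢ x₂ ⊕ x₀ ⊑ x₁ ⊢ ⊩ x₀ ⊑ con 1)
      refl (u v) (≥-reflexive (cnt-++ (v ==_) xs ys))

  ∉-≢ : ∀ {u v} xs → # u xs ≡ 0 → v ∈ xs → u ≢ v
  ∉-≢ xs z m refl = <⇒≱ m (≤-reflexive z)

  ≢-∈-∷ : ∀ {u} x xs → u ≢ x → u ∈ (x ∷ xs) → u ∈ xs
  ≢-∈-∷ x xs ne m with ∈-uncons x xs m
  ... | inj₁ e = ⊥-elim (ne e)
  ... | inj₂ k = k

  infix 4 _⊆_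
  -- Multiplicities are respected, so a list contained in one without repetitions has none either.
  -- Injectivity and disjointness of the pieces of a copy are carried in this form.
  _⊆_ : List V → List V → Set
  xs ⊆ ys = ∀ v → # v xs ≤ # v ys

  filt : (V → Bool) → List V → List V
  filt p [] = []
  filt p (x ∷ xs) = if p x then x ∷ filt p xs else filt p xs

  #-filt : ∀ p xs v → p v ≡ true → # v (filt p xs) ≡ # v xs
  #-filt p [] v t = refl
  #-filt p (x ∷ xs) v t with dich (p x)
  ... | inj₁ s rewrite s = cong (b2n (v == x) +_) (#-filt p xs v t)
  ... | inj₂ s rewrite s | ==-≢ {v} {x} (λ { refl → true≢false t s }) = #-filt p xs v t

  #-filt-false : ∀ p xs v → p v ≡ false → # v (filt p xs) ≡ 0
  #-filt-false p [] v t = refl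
  #-filt-false p (x ∷ xs) v t with dich (p x)
  ... | inj₂ s rewrite s = #-filt-false p xs v t
  ... | inj₁ s rewrite s | ==-≢ {v} {x} (λ { refl → true≢false s t }) = #-filt-false p xs v t

  filt-⊆ : ∀ p xs → filt p xs ⊆ xs
  filt-⊆ p xs v with dich (p v)
  ... | inj₁ t = ≤-reflexive (#-filt p xs v t)
  ... | inj₂ f = ≤-trans (≤-reflexive (#-filt-false p xs v f)) z≤n

  ∈-filt : ∀ p xs {v} → v ∈ filt p xs → p v ≡ true
  ∈-filt p xs {v} m with dich (p v)
  ... | inj₁ t = t
  ... | inj₂ f = ⊥-elim (<⇒≱ m (≤-reflexive (#-filt-false p xs v f)))

  length-filt : ∀ p xs → length (filt p xs) ≡ cnt p xs
  length-filt p [] = refl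
  length-filt p (x ∷ xs) with p x
  ... | true = cong suc (length-filt p xs)
  ... | false = length-filt p xs

  remove : ∀ {v} xs → v ∈ xs → Σ[ ys ∈ List V ] (xs ≈ (v ∷ ys))
  remove {v} xs m with ∈-split xs m
  ... | ys , zs , refl = ys ++ zs , ≈-shift v ys zs

  ≢⇒∉ : ∀ {u v} → u ≢ v → b2n (u == v) ≡ 0
  ≢⇒∉ ne = cong b2n (==-≢ ne)

  ≢⇒∉₁ : ∀ {u v} → u ≢ v → # u (v ∷ []) ≡ 0
  ≢⇒∉₁ ne = trans (+-identityʳ _) (≢⇒∉ ne)

  single : ∀ y us → y ∈ us → (y ∷ []) ⊆ us
  single y us my v = go (v ≟ y)
    where
    go : Dec (v ≡ y) → # v (y ∷ []) ≤ # v us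
    go (yes refl) = lin (b2n (y == y) ∷ # y us ∷ []) (con 1 ⊑ x₁ ⊢ x₀ ⊑ con 1 ⊢ ⊩ x₀ ⊕ con 0 ⊑ x₁)
        refl my (b2n≤1 (y == y))
    go (no n) = lin (b2n (v == y) ∷ # v us ∷ []) (x₀ ⊑ con 0 ⊢ ⊩ x₀ ⊕ con 0 ⊑ x₁) refl (≤-reflexive (≢⇒∉ n))

  cons-⊆ : ∀ x vs us → # x vs ≡ 0 → x ∈ us → vs ⊆ us → (x ∷ vs) ⊆ us
  cons-⊆ x vs us x∉ mx sb v = go (v ≟ x)
    where
    go : Dec (v ≡ x) → # v (x ∷ vs) ≤ # v us
    go (yes refl) = lin (b2n (x == x) ∷ # x vs ∷ # x us ∷ []) (con 1 ⊑ x₂ ⊢ x₁ ⊑ con 0 ⊢ x₀ ⊑ con 1 ⊢ ⊩ x₀ ⊕ x₁ ⊑ x₂)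
        refl mx (≤-reflexive x∉) (b2n≤1 (x == x))
    go (no n) = lin (b2n (v == x) ∷ # v vs ∷ # v us ∷ []) (x₀ ⊑ con 0 ⊢ x₁ ⊑ x₂ ⊢ ⊩ x₀ ⊕ x₁ ⊑ x₂)
        refl (≤-reflexive (≢⇒∉ n)) (sb v)

-- Median orders of a tournament.

module MedianOrder {V : Set} (_≟_ : DecidableEquality V) (e : V → V → Bool)
    (tot : ∀ u v → u ≢ v → e u v ≡ not (e v u)) where
  open Counting _≟_

  E : Bool → V → V → Bool
  E true u v = e u v
  E false u v = e v u

  E-not : ∀ s u v → E (not s) u v ≡ E s v u
  E-not true u v = refl
  E-not false u v = refl

  E-tot : ∀ s u v → u ≢ v → E s u v ≡ not (E s v u)
  E-tot true u v ne = tot u v ne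
  E-tot false u v ne = tot v u (λ p → ne (sym p))

  E-or : ∀ s u v → u ≢ v → E s u v ≡ true ⊎ E (not s) u v ≡ true
  E-or s u v ne with E s u v | E-tot s u v ne
  ... | true | _ = inj₁ refl
  ... | false | p with E s v u | E-not s u v
  ...   | true | q = inj₂ q

  -- The feedback property of median orders for the intervals that start right after `x`. As it
  -- speaks of intervals only, it passes to prefixes and suffixes.
  Half : Bool → List V → Set
  Half s [] = ⊤
  Half s (x ∷ xs) = (∀ ys zs → xs ≡ ys ++ zs → length ys ≤ 2 * cnt (E s x) ys) × Half s xs

  Half-drop : ∀ s xs ys → Half s (xs ++ ys) → Half s ys
  Half-drop s [] ys h = h
  Half-drop s (x ∷ xs) ys (_ , h) = Half-drop s xs ys h

  Half-take : ∀ s xs ys → Half s (xs ++ ys) → Half s xs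
  Half-take s [] ys h = tt
  Half-take s (x ∷ xs) ys (f , h) =
    (λ us vs eq → f us (vs ++ ys) (trans (cong (_++ ys) eq) (++-assoc us vs ys))) , Half-take s xs ys h

  -- The number of arcs against the order: the potential that bounds the recursion in `median`.
  back : Bool → List V → ℕ
  back s [] = 0
  back s (x ∷ xs) = cnt (λ y → E s y x) xs + back s xs

  back-insert : ∀ s ys x zs → back s (ys ++ x ∷ zs) ≡ back s (ys ++ zs) + cnt (E s x) ys + cnt (λ y → E s y x) zs
  back-insert s [] x zs = ≤-antisym
      (lin (cnt (λ y → E s y x) zs ∷ back s zs ∷ []) (⊩ x₀ ⊕ x₁ ⊑ x₁ ⊕ con 0 ⊕ x₀) refl)
      (lin (back s zs ∷ cnt (λ y → E s y x) zs ∷ []) (⊩ x₀ ⊕ con 0 ⊕ x₁ ⊑ x₁ ⊕ x₀) refl)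
  back-insert s (y ∷ ys) x zs = ≤-antisym
    (lin (cnt (λ y₁ → E s y₁ y) (ys ++ x ∷ zs) ∷ back s (ys ++ x ∷ zs) ∷ cnt (λ y₁ → E s y₁ y) (ys ++ zs) ∷ back s
        (ys ++ zs) ∷ b2n (E s x y) ∷ cnt (E s x) ys ∷ cnt (λ y₁ → E s y₁ x) zs ∷ []) (x₁ ⊑ x₃ ⊕ x₅ ⊕ x₆
        ⊢ x₀ ⊑ x₄ ⊕ x₂ ⊢ ⊩ x₀ ⊕ x₁ ⊑ x₂ ⊕ x₃ ⊕ (x₄ ⊕ x₅) ⊕ x₆)
        refl (≤-reflexive (back-insert s ys x zs)) (≤-reflexive (≈-shift x ys zs (λ z → E s z y))))
    (lin (cnt (λ y₁ → E s y₁ y) (ys ++ zs) ∷ back s (ys ++ zs) ∷ b2n (E s x y) ∷ cnt (E s x) ys ∷ cnt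
        (λ y₁ → E s y₁ x) zs ∷ cnt (λ y₁ → E s y₁ y) (ys ++ x ∷ zs) ∷ back s (ys ++ x ∷ zs) ∷ []) (x₁ ⊕ x₃ ⊕ x₄ ⊑ x₆
        ⊢ x₂ ⊕ x₀ ⊑ x₅ ⊢ ⊩ x₀ ⊕ x₁ ⊕ (x₂ ⊕ x₃) ⊕ x₄ ⊑ x₅ ⊕ x₆)
        refl (≥-reflexive (back-insert s ys x zs)) (≥-reflexive (≈-shift x ys zs (λ z → E s z y))))

  back-reverse : ∀ s xs → back (not s) (reverse xs) ≡ back s xs
  back-reverse s [] = refl
  back-reverse s (x ∷ xs) = begin
    back (not s) (reverse (x ∷ xs))    ≡⟨ cong (back (not s)) (unfold-reverse x xs) ⟩
    back (not s) (reverse xs ++ [ x ]) ≡⟨ back-insert (not s) (reverse xs) x [] ⟩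
    back (not s) (reverse xs ++ []) + cnt (E (not s) x) (reverse xs) + 0
      ≡⟨ cong₂ (λ l n → back (not s) l + n + 0) (++-identityʳ (reverse xs)) (cnt-reverse (E (not s) x) xs) ⟩
    back (not s) (reverse xs) + cnt (E (not s) x) xs + 0
      ≡⟨ cong₂ (λ m n → m + n + 0) (back-reverse s xs) (cnt-cong s x xs) ⟩
    back s xs + cnt (λ y → E s y x) xs + 0
      ≡⟨ trans (+-identityʳ _) (+-comm (back s xs) _) ⟩
    back s (x ∷ xs) ∎
    where
    open ≡-Reasoning
    cnt-cong : ∀ s x xs → cnt (E (not s) x) xs ≡ cnt (λ y → E s y x) xs
    cnt-cong true x xs = refl
    cnt-cong false x xs = refl

  -- The accumulators `a` and `b` carry the length and twice the count of the part already passed,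
  -- so that the first violation is met during the scan.
  window? : ∀ (p : V → Bool) a b xs → (∀ ys zs → xs ≡ ys ++ zs → a + length ys ≤ b + 2 * cnt p ys)
    ⊎ (Σ[ ys ∈ List V ] Σ[ zs ∈ List V ] (xs ≡ ys ++ zs) × (b + 2 * cnt p ys < a + length ys))
  window? p a b xs with a ≤? b
  ... | no a≰b = inj₂ ([] , xs , refl , lin (b ∷ a ∷ []) (con 1 ⊕ x₀ ⊑ x₁
      ⊢ ⊩ con 1 ⊕ (x₀ ⊕ (con 0 ⊕ con 0)) ⊑ x₁ ⊕ con 0) refl (≰⇒> a≰b))
  window? p a b [] | yes a≤b = inj₁ λ { [] zs eq → lin (a ∷ b ∷ []) (x₀ ⊑ x₁ ⊢ ⊩ x₀ ⊕ con 0 ⊑ x₁ ⊕ (con 0 ⊕ con 0))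
      refl a≤b }
  window? p a b (x ∷ xs) | yes a≤b with window? p (suc a) (b + 2 * b2n (p x)) xs
  ... | inj₂ (ys , zs , refl , lt) = inj₂ (x ∷ ys , zs , refl , lin (b ∷ b2n (p x) ∷ cnt p ys ∷ a ∷ length ys ∷ [])
      (con 1 ⊕ (x₀ ⊕ (x₁ ⊕ (x₁ ⊕ con 0)) ⊕ (x₂ ⊕ (x₂ ⊕ con 0))) ⊑ con 1 ⊕ (x₃ ⊕ x₄)
      ⊢ ⊩ con 1 ⊕ (x₀ ⊕ (x₁ ⊕ x₂ ⊕ (x₁ ⊕ x₂ ⊕ con 0))) ⊑ x₃ ⊕ (con 1 ⊕ x₄)) refl lt)
  ... | inj₁ h = inj₁ λ where
    [] zs eq → lin (a ∷ b ∷ []) (x₀ ⊑ x₁ ⊢ ⊩ x₀ ⊕ con 0 ⊑ x₁ ⊕ (con 0 ⊕ con 0)) refl a≤b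
    (y ∷ ys) zs refl → lin (a ∷ length ys ∷ b ∷ b2n (p x) ∷ cnt p ys ∷ [])
        (con 1 ⊕ (x₀ ⊕ x₁) ⊑ x₂ ⊕ (x₃ ⊕ (x₃ ⊕ con 0)) ⊕ (x₄ ⊕ (x₄ ⊕ con 0))
        ⊢ ⊩ x₀ ⊕ (con 1 ⊕ x₁) ⊑ x₂ ⊕ (x₃ ⊕ x₄ ⊕ (x₃ ⊕ x₄ ⊕ con 0))) refl (h ys zs refl)

  cnt-tot : ∀ s x xs → # x xs ≡ 0 → length xs ≤ cnt (E s x) xs + cnt (λ y → E s y x) xs
  cnt-tot s x xs z = lin (length xs ∷ cnt (E s x) xs ∷ cnt (λ y → E s y x) xs ∷ cnt (λ x₁ → not (E s x x₁)) xs ∷ [])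
      (x₀ ⊑ x₁ ⊕ x₃ ⊢ x₃ ⊑ x₂ ⊢ ⊩ x₀ ⊑ x₁ ⊕ x₂)
      refl (≥-reflexive (cnt-not (E s x) xs)) (cnt-mono (λ y → not (E s x y)) (λ y → E s y x) xs l)
    where
    l : ∀ y → y ∈ xs → not (E s x y) ≡ true → E s y x ≡ true
    l y m t = trans (E-tot s y x (λ p → ∉-≢ xs z m (sym p))) t

  -- A vertex that violates Half at a window is moved behind the window.
  improve : ∀ s xs → Uniq xs → Half s xs ⊎ (Σ[ ys ∈ List V ] (ys ≈ xs) × (back s ys < back s xs))
  improve s [] u = inj₁ tt
  improve s (x ∷ xs) u with improve s xs (Uniq-tail x xs u)
  ... | inj₂ (ys , ys≈xs , lt) = inj₂
      (x ∷ ys , ≈-∷ x ys xs ys≈xs , lin (cnt (λ y → E s y x) ys ∷ back s ys ∷ cnt (λ y → E s y x) xs ∷ back s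
      xs ∷ []) (con 1 ⊕ x₁ ⊑ x₃ ⊢ x₀ ⊑ x₂ ⊢ ⊩ con 1 ⊕ (x₀ ⊕ x₁) ⊑ x₂ ⊕ x₃)
      refl lt (≤-reflexive (ys≈xs (λ y → E s y x))))
  ... | inj₁ h with window? (E s x) 0 0 xs
  ...   | inj₁ w = inj₁ (w , h)
  ...   | inj₂ (ys , zs , refl , lt) = inj₂
      (ys ++ x ∷ zs , ≈-shift x ys zs , lin (back s (ys ++ x ∷ zs) ∷ cnt (λ y → E s y x) (ys ++ zs) ∷ back s
      (ys ++ zs) ∷ cnt (E s x) ys ∷ length ys ∷ cnt (λ y → E s y x) zs ∷ cnt (λ y → E s y x) ys ∷ [])
      (con 1 ⊕ (x₃ ⊕ (x₃ ⊕ con 0)) ⊑ x₄ ⊢ x₀ ⊑ x₂ ⊕ x₃ ⊕ x₅ ⊢ x₆ ⊕ x₅ ⊑ x₁ ⊢ x₄ ⊑ x₃ ⊕ x₆ ⊢ ⊩ con 1 ⊕ x₀ ⊑ x₁ ⊕ x₂)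
      refl lt (≤-reflexive (back-insert s ys x zs)) (≥-reflexive (cnt-++ (λ y → E s y x) ys zs)) c)
    where
    c : length ys ≤ cnt (E s x) ys + cnt (λ y → E s y x) ys
    c = cnt-tot s x ys (n≤0⇒n≡0 (lin (# x ys ∷ # x (ys ++ zs) ∷ # x zs ∷ []) (x₀ ⊕ x₂ ⊑ x₁ ⊢ x₁ ⊑ con 0
        ⊢ ⊩ x₀ ⊑ con 0) refl (≥-reflexive (cnt-++ (x ==_) ys zs)) (≤-reflexive (Uniq-head x (ys ++ zs) u))))

  -- Reversing the list and the direction together preserves `back`, so the improvements for both
  -- directions decrease one potential, and a list that admits neither has both properties. A local
  -- optimum is enough.
  median : ∀ xs → Uniq xs → Σ[ ys ∈ List V ] (ys ≈ xs) × Half true ys × Half false (reverse ys)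
  median xs u = go (suc (back true xs)) xs u ≤-refl
    where
    go : ∀ n xs → Uniq xs → back true xs < n → Σ[ ys ∈ List V ] (ys ≈ xs) × Half true ys × Half false (reverse ys)
    go (suc n) xs u lt with improve true xs u
    ... | inj₂ (ys , eq , lt′) with go n ys (λ v → ≤-trans (≤-reflexive (eq _)) (u v)) (≤-trans lt′ (≤-pred lt))
    ...   | zs , eq′ , h = zs , ≈-trans zs ys xs eq′ eq , h
    go (suc n) xs u lt | inj₁ h with improve false (reverse xs) (λ v → ≤-trans (≤-reflexive (≈-reverse xs _)) (u v))
    ... | inj₁ h′ = xs , ≈-refl xs , h , h′
    ... | inj₂ (ys , eq , lt′) with go n (reverse ys) (λ v → ≤-trans (≤-reflexive (eq₂ _)) (u v))
            (lin (back true (reverse ys) ∷ n ∷ back false ys ∷ back false (reverse xs) ∷ back true xs ∷ [])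
                (con 1 ⊕ x₂ ⊑ x₃ ⊢ x₀ ⊑ x₂ ⊢ x₃ ⊑ x₄ ⊢ con 1 ⊕ x₄ ⊑ con 1 ⊕ x₁ ⊢ ⊩ con 1 ⊕ x₀ ⊑ x₁)
                refl lt′ (≤-reflexive (back-reverse false ys)) (≤-reflexive (back-reverse true xs)) lt)
      where
      eq₂ : reverse ys ≈ xs
      eq₂ = ≈-trans (reverse ys) ys xs (≈-reverse ys) (≈-trans ys (reverse xs) xs eq (≈-reverse xs))
    ...   | zs , eq′ , h″ = zs , ≈-trans zs (reverse ys) xs eq′
              (≈-trans (reverse ys) ys xs (≈-reverse ys) (≈-trans ys (reverse xs) xs eq (≈-reverse xs))) , h″

-- Directed paths, and the bookkeeping of forbidden vertices.

module Paths {V : Set} (_≟_ : DecidableEquality V) (e : V → V → Bool) (tot : ∀ u v → u ≢ v → e u v ≡ not (e v u))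
    where
  open Counting _≟_
  open MedianOrder _≟_ e tot

  Path : Bool → V → List V → Set
  Path s x [] = ⊤
  Path s x (y ∷ ys) = (E s x y ≡ true) × Path s y ys

  Merged : Bool → V → List V → V → List V → Set
  Merged s a as b bs = Σ[ c ∈ V ] Σ[ cs ∈ List V ] Path s c cs × ((c ∷ cs) ≈ ((a ∷ as) ++ (b ∷ bs)))
      × ((c ≡ a) ⊎ (c ≡ b))

  either : ∀ s x {a b c} → E s x a ≡ true → E s x b ≡ true → (c ≡ a) ⊎ (c ≡ b) → E s x c ≡ true
  either s x p q (inj₁ refl) = p
  either s x p q (inj₂ refl) = q

  -- As in merge sort, the head that precedes the other head comes first. That the merged path
  -- starts with one of the two heads makes the induction work, and `reroute` relies on it as well.
  merge : ∀ s a as b bs → Path s a as → Path s b bs → Uniq ((a ∷ as) ++ (b ∷ bs)) → Merged s a as b bs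
  merge s a as b bs p q u with E-or s a b (∉-≢ (as ++ b ∷ bs) (Uniq-head a (as ++ b ∷ bs) u)
      (∈-++ʳ as (b ∷ bs) (∈-here b bs)))
  merge s a [] b bs p q u | inj₁ t = a , b ∷ bs , (t , q) , ≈-refl (a ∷ b ∷ bs) , inj₁ refl
  merge s a (a′ ∷ as) b bs (t′ , p) q u | inj₁ t =
    let c , cs , r , eq , o = merge s a′ as b bs p q (Uniq-tail a (a′ ∷ as ++ b ∷ bs) u)
    in a , c ∷ cs , (either s a t′ t o , r) , ≈-∷ a (c ∷ cs) (a′ ∷ as ++ b ∷ bs) eq , inj₁ refl
  merge s a as b [] p q u | inj₂ t = b , a ∷ as , (trans (sym (E-not s a b)) t , p) ,
    (λ f → sym (trans (≈-shift b (a ∷ as) [] f) (cong (λ l → cnt f (b ∷ l)) (++-identityʳ (a ∷ as))))) , inj₂ refl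
  merge s a as b (b′ ∷ bs) p (t′ , q) u | inj₂ t =
    let c , cs , r , eq , o = merge s a as b′ bs p q (λ v → lin (b2n (v == a) ∷ # v (as ++ b′ ∷ bs) ∷ # v (as ++ b ∷ b′ ∷ bs) ∷ b2n (v == b) ∷ []) (x₀ ⊕ x₂ ⊑ con 1 ⊢ x₃ ⊕ (x₀ ⊕ x₁) ⊑ x₀ ⊕ x₂ ⊢ ⊩ x₀ ⊕ x₁ ⊑ con 1) refl (u v) (≥-reflexive (≈-shift b (a ∷ as) (b′ ∷ bs) (v ==_))))
    in b , c ∷ cs , (either s b (trans (sym (E-not s a b)) t) t′ o , r) ,
      ≈-trans (b ∷ c ∷ cs) (b ∷ a ∷ as ++ b′ ∷ bs) (a ∷ as ++ b ∷ b′ ∷ bs)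
        (≈-∷ b (c ∷ cs) (a ∷ as ++ b′ ∷ bs) eq)
        (≈-sym (a ∷ as ++ b ∷ b′ ∷ bs) (b ∷ a ∷ as ++ b′ ∷ bs) (≈-shift b (a ∷ as) (b′ ∷ bs))) , inj₂ refl

  -- Rédei's theorem: the single vertex `x` is merged into a path through all the others.
  hamilton : ∀ s x xs → Uniq (x ∷ xs) → Σ[ y ∈ V ] Σ[ ys ∈ List V ] Path s y ys × ((y ∷ ys) ≈ (x ∷ xs))
  hamilton s x [] u = x , [] , tt , ≈-refl (x ∷ [])
  hamilton s x (x′ ∷ xs) u = go (hamilton s x′ xs (Uniq-tail x (x′ ∷ xs) u))
    where
    go : (Σ[ y ∈ V ] Σ[ ys ∈ List V ] Path s y ys × ((y ∷ ys) ≈ (x′ ∷ xs))) →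
      Σ[ y ∈ V ] Σ[ ys ∈ List V ] Path s y ys × ((y ∷ ys) ≈ (x ∷ x′ ∷ xs))
    go (y , ys , p , eq) = let c , cs , r , eq′ , _ = merge s x [] y ys tt p (λ v → lin (b2n (v == x) ∷ b2n (v == y) ∷ # v ys ∷ b2n (v == x′) ∷ # v xs ∷ []) (x₀ ⊕ (x₃ ⊕ x₄) ⊑ con 1 ⊢ x₁ ⊕ x₂ ⊑ x₃ ⊕ x₄ ⊢ ⊩ x₀ ⊕ (x₁ ⊕ x₂) ⊑ con 1) refl (u v) (≤-reflexive (eq (v ==_)))) in
      c , cs , r , ≈-trans (c ∷ cs) (x ∷ y ∷ ys) (x ∷ x′ ∷ xs) eq′ (≈-∷ x (y ∷ ys) (x′ ∷ xs) eq)

  Path-drop : ∀ s x as b bs → Path s x (as ++ b ∷ bs) → Path s b bs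
  Path-drop s x [] b bs (_ , p) = p
  Path-drop s x (a ∷ as) b bs (_ , p) = Path-drop s a as b bs p

  Path-take : ∀ s x as bs → Path s x (as ++ bs) → Path s x as
  Path-take s x [] bs p = tt
  Path-take s x (a ∷ as) bs (t , p) = t , Path-take s a as bs p

  data Walk : V → List V → List Bool → V → Set where
    end  : ∀ {x s z} → E s x z ≡ true → Walk x [] (s ∷ []) z
    step : ∀ {x y s ys w z} → E s x y ≡ true → Walk y ys w z → Walk x (y ∷ ys) (s ∷ w) z

  -- Ten positions are set aside for every vertex of A in a region: the factor is dictated by jump.
  record Room (n : ℕ) (A : V → Bool) (xs : List V) : Set where
    constructor room
    field fits : n + 10 * cnt A xs ≤ length xs
  open Room

  Split : ℕ → ℕ → (V → Bool) → List V → Set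
  Split n₁ n₂ A xs = Σ[ ys ∈ List V ] Σ[ zs ∈ List V ] (xs ≡ ys ++ zs) × Room n₁ A ys × Room n₂ A zs

  -- The list is read while positions are owed to the first part. A vertex of `A` raises the debt by
  -- nine, namely ten minus the position it occupies itself; any other vertex lowers it by one.
  room-split : ∀ A n₁ n₂ xs → Room (n₁ + n₂) A xs → Split n₁ n₂ A xs
  room-split A zero n₂ xs r = [] , xs , refl , room z≤n , r
  room-split A (suc n₁) n₂ [] (room ())
  room-split A (suc n₁) n₂ (x ∷ xs) r = go (dich (A x))
    where
    here : ∀ m → b2n (A x) * 10 + suc n₁ ≡ suc m → Split m n₂ A xs → Split (suc n₁) n₂ A (x ∷ xs)
    here m eq (ys , zs , refl , r₁ , r₂) = x ∷ ys , zs , refl , room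
        (lin (n₁ ∷ b2n (A x) ∷ cnt A ys ∷ length ys ∷ m ∷ b2n (A x) * 10 ∷ []) (x₄ ⊕ 10 ⊛ x₂ ⊑ x₃
        ⊢ x₅ ⊕ (con 1 ⊕ x₀) ⊑ con 1 ⊕ x₄ ⊢ 10 ⊛ x₁ ⊑ x₅ ⊢ ⊩ con 1 ⊕ x₀ ⊕ 10 ⊛ (x₁ ⊕ x₂) ⊑ con 1 ⊕ x₃)
        refl (fits r₁) (≤-reflexive eq) (≤-reflexive (*-comm 10 (b2n (A x))))) , r₂
    go : A x ≡ true ⊎ A x ≡ false → Split (suc n₁) n₂ A (x ∷ xs)
    go (inj₁ t) = here (10 + n₁) (cong (λ b → b2n b * 10 + suc n₁) t)
      (room-split A (10 + n₁) n₂ xs (room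
          (lin (n₁ ∷ n₂ ∷ cnt A xs ∷ length xs ∷ b2n (A x) ∷ []) (con 1 ⊕ x₀ ⊕ x₁ ⊕ 10 ⊛ (x₄ ⊕ x₂) ⊑ con 1 ⊕ x₃
          ⊢ 10 ⊛ (con 1) ⊑ 10 ⊛ x₄ ⊢ ⊩ con 10 ⊕ x₀ ⊕ x₁ ⊕ 10 ⊛ x₂ ⊑ x₃)
          refl (fits r) (≥-reflexive (cong (λ b → 10 * b2n b) t)))))
    go (inj₂ f) = here n₁ (cong (λ b → b2n b * 10 + suc n₁) f)
      (room-split A n₁ n₂ xs (room (lin (n₁ ∷ n₂ ∷ cnt A xs ∷ length xs ∷ b2n (A x) ∷ [])
          (con 1 ⊕ x₀ ⊕ x₁ ⊕ 10 ⊛ (x₄ ⊕ x₂) ⊑ con 1 ⊕ x₃ ⊢ ⊩ x₀ ⊕ x₁ ⊕ 10 ⊛ x₂ ⊑ x₃) refl (fits r))))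

  Pick : ℕ → ℕ → (V → Bool) → List V → Set
  Pick n₁ n₂ A xs = Σ[ ys ∈ List V ] Σ[ a ∈ V ] Σ[ zs ∈ List V ] (xs ≡ ys ++ a ∷ zs) × (A a ≡ false) × Room n₁ A ys
      × Room n₂ A zs

  -- The same accounting; it stops at the first vertex outside `A` that is met when nothing is owed.
  room-pick : ∀ A n₁ n₂ xs → Room (n₁ + suc n₂) A xs → Pick n₁ n₂ A xs
  room-pick A n₁ n₂ [] r = ⊥-elim (1≰0
      (lin (n₁ ∷ n₂ ∷ []) (x₀ ⊕ (con 1 ⊕ x₁) ⊕ 10 ⊛ (con 0) ⊑ con 0 ⊢ ⊩ con 1 ⊑ con 0) refl (fits r)))
  room-pick A n₁ n₂ (x ∷ xs) r = go n₁ r (dich (A x))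
    where
    here : ∀ n₁ m → b2n (A x) * 10 + n₁ ≡ suc m → Pick m n₂ A xs → Pick n₁ n₂ A (x ∷ xs)
    here n₁ m eq (ys , a , zs , refl , f , r₁ , r₂) =
      x ∷ ys , a , zs , refl , f , room
          (lin (n₁ ∷ b2n (A x) ∷ cnt A ys ∷ length ys ∷ m ∷ b2n (A x) * 10 ∷ []) (x₄ ⊕ 10 ⊛ x₂ ⊑ x₃
          ⊢ x₅ ⊕ x₀ ⊑ con 1 ⊕ x₄ ⊢ 10 ⊛ x₁ ⊑ x₅ ⊢ ⊩ x₀ ⊕ 10 ⊛ (x₁ ⊕ x₂) ⊑ con 1 ⊕ x₃)
          refl (fits r₁) (≤-reflexive eq) (≤-reflexive (*-comm 10 (b2n (A x))))) , r₂
    go : ∀ n₁ → Room (n₁ + suc n₂) A (x ∷ xs) → A x ≡ true ⊎ A x ≡ false → Pick n₁ n₂ A (x ∷ xs)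
    go n₁ r (inj₁ t) = here n₁ (9 + n₁) (cong (λ b → b2n b * 10 + n₁) t)
      (room-pick A (9 + n₁) n₂ xs (room
          (lin (n₁ ∷ n₂ ∷ cnt A xs ∷ length xs ∷ b2n (A x) ∷ []) (x₀ ⊕ (con 1 ⊕ x₁) ⊕ 10 ⊛ (x₄ ⊕ x₂) ⊑ con 1 ⊕ x₃
          ⊢ 10 ⊛ (con 1) ⊑ 10 ⊛ x₄ ⊢ ⊩ con 9 ⊕ x₀ ⊕ (con 1 ⊕ x₁) ⊕ 10 ⊛ x₂ ⊑ x₃)
          refl (fits r) (≥-reflexive (cong (λ b → 10 * b2n b) t)))))
    go zero r (inj₂ f) = [] , x , xs , refl , f , room z≤n , room
        (lin (n₂ ∷ cnt A xs ∷ length xs ∷ b2n (A x) ∷ []) (con 1 ⊕ x₀ ⊕ 10 ⊛ (x₃ ⊕ x₁) ⊑ con 1 ⊕ x₂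
        ⊢ ⊩ x₀ ⊕ 10 ⊛ x₁ ⊑ x₂) refl (fits r))
    go (suc n₁) r (inj₂ f) = here (suc n₁) n₁ (cong (λ b → b2n b * 10 + suc n₁) f)
        (room-pick A n₁ n₂ xs (room (lin (n₁ ∷ n₂ ∷ cnt A xs ∷ length xs ∷ b2n (A x) ∷ [])
        (con 1 ⊕ x₀ ⊕ (con 1 ⊕ x₁) ⊕ 10 ⊛ (x₄ ⊕ x₂) ⊑ con 1 ⊕ x₃ ⊢ ⊩ x₀ ⊕ (con 1 ⊕ x₁) ⊕ 10 ⊛ x₂ ⊑ x₃)
        refl (fits r))))

  -- Sparse in `A` on both sides, so that jumps can start from `a` in either direction across the
  -- rest of `xs`.
  Cut : (V → Bool) → List V → V → Set
  Cut A xs a = (A a ≡ false) × (Σ[ ys ∈ List V ] Σ[ zs ∈ List V ] (xs ≡ ys ++ a ∷ zs) × Room 0 A ys × Room 0 A zs)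

  Picks : ℕ → (V → Bool) → List V → Set
  Picks w A xs = Σ[ ps ∈ List V ] (length ps ≡ w) × (ps ⊆ xs) × (∀ a → a ∈ ps → Cut A xs a)

  room-picks : ∀ A w xs → Room w A xs → Picks w A xs
  room-picks A zero xs r = [] , refl , (λ v → z≤n) , λ a ()
  room-picks A (suc w) xs r = go (room-pick A 0 w xs r)
    where
    go : Pick 0 w A xs → Picks (suc w) A xs
    go (ys , a , zs , refl , f , r₁ , r₂) = add (room-picks A w zs r₂)
      where
      shift : ∀ b → Cut A zs b → Cut A (ys ++ a ∷ zs) b
      shift b (f′ , us , vs , eq , r₃ , r₄) = f′ , ys ++ a ∷ us , vs ,
        trans (cong (λ l → ys ++ a ∷ l) eq) (sym (++-assoc ys (a ∷ us) (b ∷ vs))) ,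
        room (lin (cnt A (ys ++ a ∷ us) ∷ length (ys ++ a ∷ us) ∷ cnt A ys ∷ length ys ∷ cnt A us ∷ length us ∷ b2n
            (A a) ∷ []) (con 0 ⊕ 10 ⊛ x₂ ⊑ x₃ ⊢ con 0 ⊕ 10 ⊛ x₄ ⊑ x₅ ⊢ 10 ⊛ x₀ ⊑ 10 ⊛ (x₂ ⊕ (x₆ ⊕ x₄))
            ⊢ x₃ ⊕ (con 1 ⊕ x₅) ⊑ x₁ ⊢ 10 ⊛ x₆ ⊑ 10 ⊛ (con 0) ⊢ ⊩ con 0 ⊕ 10 ⊛ x₀ ⊑ x₁)
            refl (fits r₁) (fits r₃) (≤-reflexive (cong (10 *_) (cnt-++ A ys (a ∷ us))))
            (≥-reflexive (length-++ ys {a ∷ us})) (≤-reflexive (cong (λ b → 10 * b2n b) f))) , r₄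
      g : ∀ ps → (∀ b → b ∈ ps → Cut A zs b) → ∀ b → (b ≡ a) ⊎ (b ∈ ps) → Cut A (ys ++ a ∷ zs) b
      g ps h b (inj₁ refl) = f , ys , zs , refl , r₁ , room
          (lin (cnt A zs ∷ length zs ∷ w ∷ []) (x₂ ⊕ 10 ⊛ x₀ ⊑ x₁ ⊢ ⊩ con 0 ⊕ 10 ⊛ x₀ ⊑ x₁) refl (fits r₂))
      g ps h b (inj₂ m) = shift b (h b m)
      add : Picks w A zs → Picks (suc w) A (ys ++ a ∷ zs)
      add (ps , len , sub , h) = a ∷ ps , cong suc len ,
          (λ v → lin (b2n (v == a) ∷ # v ps ∷ # v (ys ++ a ∷ zs) ∷ # v zs ∷ # v ys ∷ []) (x₁ ⊑ x₃
          ⊢ x₄ ⊕ (x₀ ⊕ x₃) ⊑ x₂ ⊢ ⊩ x₀ ⊕ x₁ ⊑ x₂) refl (sub v) (≥-reflexive (cnt-++ (v ==_) ys (a ∷ zs)))) ,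
        λ b m → g ps h b (∈-uncons a ps m)

  first : ∀ (p : V → Bool) xs → (Σ[ ys ∈ List V ] Σ[ a ∈ V ] Σ[ zs ∈ List V ] (xs ≡ ys ++ a ∷ zs) × (p a ≡ true)
      × (∀ x → x ∈ ys → p x ≡ false))
    ⊎ (∀ x → x ∈ xs → p x ≡ false)
  first p [] = inj₂ λ x ()
  first p (x ∷ xs) with dich (p x)
  ... | inj₁ t = inj₁ ([] , x , xs , refl , t , λ _ ())
  ... | inj₂ f with first p xs
  ...   | inj₁ (ys , a , zs , refl , t , h) = inj₁ (x ∷ ys , a , zs , refl , t , λ y m → k y (∈-uncons x ys m))
    where
    k : ∀ y → (y ≡ x) ⊎ (y ∈ ys) → p y ≡ false
    k y (inj₁ refl) = f
    k y (inj₂ m) = h y m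
  ...   | inj₂ h = inj₂ λ y m → k y (∈-uncons x xs m)
    where
    k : ∀ y → (y ≡ x) ⊎ (y ∈ xs) → p y ≡ false
    k y (inj₁ refl) = f
    k y (inj₂ m) = h y m

  ∧-true : ∀ a b → (a ∧ b) ≡ true → a ≡ true × b ≡ true
  ∧-true true b t = refl , t

  First : (V → Bool) → List V → Set
  First p xs = Σ[ ys ∈ List V ] Σ[ a ∈ V ] Σ[ zs ∈ List V ] (xs ≡ ys ++ a ∷ zs) × (p a ≡ true)
      × (∀ x → x ∈ ys → p x ≡ false)

  Next : Bool → (V → Bool) → V → List V → Set
  Next s A a xs = Σ[ ys ∈ List V ] Σ[ b ∈ V ] Σ[ zs ∈ List V ] (xs ≡ ys ++ b ∷ zs) × (E s a b ≡ true) × (A b ≡ false)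
      × (length ys ≤ 2 * cnt A ys)

  -- The out-neighbours among the vertices before the first free one all lie in `A`, and they are at
  -- least half of those vertices. So a skipped stretch is at most twice as long as its part in `A`,
  -- which is then behind the path and is never charged again.
  next : ∀ s A a xs → Half s (a ∷ xs) → 2 * cnt A xs < length xs → Next s A a xs
  next s A a xs (h , _) lt = go (first (λ x → E s a x ∧ not (A x)) xs)
    where
    notf : ∀ {x} → not x ≡ true → x ≡ false
    notf {false} _ = refl
    k : ∀ x y → (x ∧ not y) ≡ false → x ≡ true → y ≡ true
    k true true _ _ = refl
    l : ∀ ys → (∀ x → x ∈ ys → (E s a x ∧ not (A x)) ≡ false) → 2 * cnt (E s a) ys ≤ 2 * cnt A ys
    l ys f = *-monoʳ-≤ 2 (cnt-mono (E s a) A ys λ x m → k (E s a x) (A x) (f x m))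
    go : First (λ x → E s a x ∧ not (A x)) xs ⊎ (∀ x → x ∈ xs → (E s a x ∧ not (A x)) ≡ false) → Next s A a xs
    go (inj₁ (ys , b , zs , refl , t , f)) = ys , b , zs , refl , proj₁ t′ , notf (proj₂ t′) ,
      ≤-trans (h ys (b ∷ zs) refl) (l ys f)
      where t′ = ∧-true (E s a b) (not (A b)) t
    go (inj₂ f) = ⊥-elim (<⇒≱ lt (≤-trans (h xs [] (sym (++-identityʳ xs))) (l xs f)))

  Reach : Bool → V → List V → V → Set
  Reach s a [] b = a ≡ b
  Reach s a (x ∷ xs) b = (E s a x ≡ true) × Reach s x xs b

  _⊙ʳ_ : ∀ {s a π b ys w z} → Reach s a π b → Walk b ys w z → Walk a (π ++ ys) (replicate (length π) s ++ w) z
  _⊙ʳ_ {π = []} refl q = q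
  _⊙ʳ_ {π = x ∷ π} (t , r) q = step t (r ⊙ʳ q)

  -- `ps` contains the path together with all that it skips. The last vertex `c` keeps its half
  -- property towards `zs`, which allows a jump from `c` into `zs`.
  record Bulk (s : Bool) (A : V → Bool) (n b : ℕ) (a : V) (xs : List V) : Set where
    field
      π ps zs : List V
      c : V
      cut : a ∷ xs ≡ ps ++ zs
      len : length π ≡ b
      reach : Reach s a π c
      inside : (a ∷ π) ⊆ ps
      avoids : ∀ x → x ∈ (a ∷ π) → A x ≡ false
      half : Half s (c ∷ zs)
      rest : Room n A zs

  bulk : ∀ s A n b a xs → Half s (a ∷ xs) → A a ≡ false → Room (b + n) A xs → Bulk s A n b a xs
  bulk s A n zero a xs h f r = record
    { π = [] ; ps = a ∷ [] ; zs = xs ; c = a ; cut = refl ; len = refl ; reach = refl ; inside = λ v → ≤-refl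
    ; avoids = λ x m → g x (∈-uncons a [] m) ; half = h ; rest = r }
    where
    g : ∀ x → (x ≡ a) ⊎ (x ∈ []) → A x ≡ false
    g x (inj₁ refl) = f
  bulk s A n (suc b) a xs h f r = go (next s A a xs h
      (lin (cnt A xs ∷ length xs ∷ b ∷ n ∷ []) (con 1 ⊕ x₂ ⊕ x₃ ⊕ 10 ⊛ x₀ ⊑ x₁ ⊢ ⊩ con 1 ⊕ 2 ⊛ x₀ ⊑ x₁)
      refl (fits r)))
    where
    go : Next s A a xs → Bulk s A n (suc b) a xs
    go (ys , c , zs , refl , t , f′ , l) = extend (bulk s A n b c zs (Half-drop s (a ∷ ys) (c ∷ zs) h) f′ r′)
      where
      r′ : Room (b + n) A zs
      r′ = room (lin (b ∷ n ∷ cnt A zs ∷ length zs ∷ cnt A (ys ++ c ∷ zs) ∷ length (ys ++ c ∷ zs) ∷ length ys ∷ cnt A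
          ys ∷ b2n (A c) ∷ []) (con 1 ⊕ x₀ ⊕ x₁ ⊕ 10 ⊛ x₄ ⊑ x₅ ⊢ x₆ ⊑ 2 ⊛ x₇ ⊢ 10 ⊛ (x₇ ⊕ (x₈ ⊕ x₂)) ⊑ 10 ⊛ x₄
          ⊢ x₅ ⊑ x₆ ⊕ (con 1 ⊕ x₃) ⊢ ⊩ x₀ ⊕ x₁ ⊕ 10 ⊛ x₂ ⊑ x₃)
          refl (fits r) l (≥-reflexive (cong (10 *_) (cnt-++ A ys (c ∷ zs)))) (≤-reflexive (length-++ ys {c ∷ zs})))
      extend : Bulk s A n b c zs → Bulk s A n (suc b) a (ys ++ c ∷ zs)
      extend record { π = π ; ps = ps ; zs = us ; c = d ; cut = cut ; len = len ; reach = reach ; inside = inside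
          ; avoids = avoids ; half = half ; rest = rest } =
        record { π = c ∷ π ; ps = a ∷ ys ++ ps ; zs = us ; c = d
          ; cut = cong (a ∷_) (trans (cong (ys ++_) cut) (sym (++-assoc ys ps us)))
          ; len = cong suc len ; reach = t , reach
          ; inside = λ v → lin (b2n (v == a) ∷ b2n (v == c) ∷ # v π ∷ # v (ys ++ ps) ∷ # v ps ∷ # v ys ∷ [])
              (x₁ ⊕ x₂ ⊑ x₄ ⊢ x₅ ⊕ x₄ ⊑ x₃ ⊢ ⊩ x₀ ⊕ (x₁ ⊕ x₂) ⊑ x₀ ⊕ x₃)
              refl (inside v) (≥-reflexive (cnt-++ (v ==_) ys ps))
          ; avoids = λ x m → g x (∈-uncons a (c ∷ π) m) ; half = half ; rest = rest }
        where
        g : ∀ x → (x ≡ a) ⊎ (x ∈ (c ∷ π)) → A x ≡ false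
        g x (inj₁ refl) = f
        g x (inj₂ m) = avoids x m

-- Directed paths of three edges through a sparse interval.

module Jumping {V : Set} (_≟_ : DecidableEquality V) (e : V → V → Bool) (tot : ∀ u v → u ≢ v → e u v ≡ not (e v u))
    where
  open Counting _≟_
  open MedianOrder _≟_ e tot
  open Paths _≟_ e tot

  Search₂ : (V → V → Bool) → List V → List V → Set
  Search₂ q xs ys = (Σ[ x ∈ V ] Σ[ y ∈ V ] (x ∈ xs) × (y ∈ ys) × (q x y ≡ true)) ⊎ (∀ x y → x ∈ xs → y ∈ ys
      → q x y ≡ false)

  search₂ : ∀ q xs ys → Search₂ q xs ys
  search₂ q [] ys = inj₂ λ x y ()
  search₂ q (z ∷ xs) ys = go (search? (q z) ys) (search₂ q xs ys)
    where
    go : (Σ[ v ∈ V ] (v ∈ ys) × (q z v ≡ true)) ⊎ (∀ v → v ∈ ys → q z v ≡ false) → Search₂ q xs ys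
        → Search₂ q (z ∷ xs) ys
    go (inj₁ (y , m , t)) _ = inj₁ (z , y , ∈-here z xs , m , t)
    go (inj₂ _) (inj₁ (x , y , m , m′ , t)) = inj₁ (x , y , ∈-there z xs m , m′ , t)
    go (inj₂ h) (inj₂ k) = inj₂ λ x y m m′ → l x y (∈-uncons z xs m) m′
      where
      l : ∀ x y → (x ≡ z) ⊎ (x ∈ xs) → y ∈ ys → q x y ≡ false
      l x y (inj₁ refl) m′ = h y m′
      l x y (inj₂ m) m′ = k x y m m′

  cnt-partition : ∀ p q r xs → (∀ x → b2n (p x) + b2n (q x) + b2n (r x) ≡ 1) → cnt p xs + cnt q xs + cnt r xs ≡
      length xs
  cnt-partition p q r [] h = refl
  cnt-partition p q r (x ∷ xs) h = ≤-antisym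
    (lin (b2n (p x) ∷ cnt p xs ∷ b2n (q x) ∷ cnt q xs ∷ b2n (r x) ∷ cnt r xs ∷ length xs ∷ []) (x₀ ⊕ x₂ ⊕ x₄ ⊑ con 1
        ⊢ x₁ ⊕ x₃ ⊕ x₅ ⊑ x₆ ⊢ ⊩ x₀ ⊕ x₁ ⊕ (x₂ ⊕ x₃) ⊕ (x₄ ⊕ x₅) ⊑ con 1 ⊕ x₆)
        refl (≤-reflexive (h x)) (≤-reflexive (cnt-partition p q r xs h)))
        (lin (length xs ∷ b2n (p x) ∷ cnt p xs ∷ b2n (q x) ∷ cnt q xs ∷ b2n (r x) ∷ cnt r xs ∷ [])
        (con 1 ⊑ x₁ ⊕ x₃ ⊕ x₅ ⊢ x₀ ⊑ x₂ ⊕ x₄ ⊕ x₆ ⊢ ⊩ con 1 ⊕ x₀ ⊑ x₁ ⊕ x₂ ⊕ (x₃ ⊕ x₄) ⊕ (x₅ ⊕ x₆))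
        refl (≥-reflexive (h x)) (≥-reflexive (cnt-partition p q r xs h)))

  cnt-pair : ∀ p xs → Uniq xs → (∀ x y → x ∈ xs → y ∈ xs → x ≢ y → p x ≡ true → p y ≡ true → ⊥) → cnt p xs ≤ 1
  cnt-pair p [] u h = z≤n
  cnt-pair p (x ∷ xs) u h = go (dich (p x))
    where
    go : p x ≡ true ⊎ p x ≡ false → cnt p (x ∷ xs) ≤ 1
    go (inj₂ f) = lin (b2n (p x) ∷ cnt p xs ∷ []) (x₀ ⊑ con 0 ⊢ x₁ ⊑ con 1 ⊢ ⊩ x₀ ⊕ x₁ ⊑ con 1)
        refl (≤-reflexive (cong b2n f))
        (cnt-pair p xs (Uniq-tail x xs u) (λ y z m m′ → h y z (∈-there x xs m) (∈-there x xs m′)))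
    go (inj₁ t) = lin (b2n (p x) ∷ cnt p xs ∷ []) (x₀ ⊑ con 1 ⊢ x₁ ⊑ con 0 ⊢ ⊩ x₀ ⊕ x₁ ⊑ con 1)
        refl (b2n≤1 (p x)) (≤-reflexive
        (cnt-zero p xs (λ y m → ≢true λ t′ → h x y (∈-here x xs) (∈-there x xs m) (∉-≢ xs (Uniq-head x xs u) m) t
        t′)))

  Jump : Bool → (V → Bool) → V → List V → V → Set
  Jump o F s ms a = Σ[ x ∈ V ] Σ[ y ∈ V ] (x ∈ ms) × (y ∈ ms) × (x ≢ y) × (F x ≡ false) × (F y ≡ false) ×
    (E o s x ≡ true) × (E o x y ≡ true) × (E o y a ≡ true)

  module _ (o : Bool) (F : V → Bool) (s a : V) (ms : List V)
    (uniq : Uniq (reverse ms)) (half₁ : Half o (s ∷ ms)) (half₂ : Half (not o) (a ∷ reverse ms)) where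

    private
      X Y X∖Y rest : V → Bool
      X v = E o s v ∧ not (F v)
      Y v = E o v a ∧ not (F v)
      X∖Y v = X v ∧ not (Y v)
      rest v = not (X v) ∧ not (Y v)

      L : List V
      L = reverse ms

      bad : V → V → Bool
      bad x y = X x ∧ (Y y ∧ (E o x y ∧ not (x == y)))

      bad-false : ∀ {x y} → bad x y ≡ false → X x ≡ true → Y y ≡ true → x ≢ y → E o x y ≡ false
      bad-false {x} {y} f p q ne with X x | Y y | E o x y | x == y in eq
      ... | true | true | false | _ = refl
      ... | true | true | true | true = ⊥-elim (ne (==-sound eq))

      rest-intro : ∀ x → Y x ≡ false → X x ≡ false → rest x ≡ true
      rest-intro x p q rewrite p | q = refl

      part : ∀ x → b2n (X∖Y x) + b2n (Y x) + b2n (rest x) ≡ 1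
      part x with X x | Y x
      ... | true | true = refl
      ... | true | false = refl
      ... | false | true = refl
      ... | false | false = refl

      X≤ : ∀ x → b2n (X x) ≤ b2n (X∖Y x) + b2n (X x ∧ Y x)
      X≤ x with X x | Y x
      ... | true | true = ≤-refl
      ... | true | false = ≤-refl
      ... | false | _ = z≤n

      Ea≤ : ∀ b f → b2n b ≤ b2n (b ∧ not f) + b2n f
      Ea≤ true true = ≤-refl
      Ea≤ true false = ≤-refl
      Ea≤ false f = z≤n

      module _ (none : ∀ x y → x ∈ L → y ∈ L → bad x y ≡ false) where

        -- An out-neighbour of y ∈ Y is not in X, and at least half of the vertices up to the next
        -- member of Y are out-neighbours of y, so in that window rest outnumbers X∖Y.
        scan : ∀ y J₁ J → Y y ≡ true → y ∈ L → (∀ x → x ∈ (J₁ ++ J) → x ∈ L) → Uniq (y ∷ J₁ ++ J)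
            → Half (not o) (y ∷ J₁ ++ J) →
          (∀ x → x ∈ J₁ → Y x ≡ false) → cnt X∖Y (J₁ ++ J) ≤ cnt rest (J₁ ++ J)
        scan y J₁ [] Yy y∈ J⊂ u (h , _) noY = lin (cnt X∖Y (J₁ ++ []) ∷ cnt rest (J₁ ++ []) ∷ length J₁ ∷ cnt
            (E (not o) y) J₁ ∷ cnt X∖Y J₁ ∷ cnt rest J₁ ∷ cnt Y J₁ ∷ []) (x₂ ⊑ 2 ⊛ x₃ ⊢ x₀ ⊑ x₄ ⊕ con 0
            ⊢ x₅ ⊕ con 0 ⊑ x₁ ⊢ x₄ ⊕ x₆ ⊕ x₅ ⊑ x₂ ⊢ x₃ ⊑ x₅ ⊢ x₃ ⊑ x₅ ⊢ ⊩ x₀ ⊑ x₁)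
            refl (h J₁ [] refl) (≤-reflexive (cnt-++ X∖Y J₁ [])) (≥-reflexive (cnt-++ rest J₁ []))
            (≤-reflexive (cnt-partition X∖Y Y rest J₁ part)) mono mono
          where
          mono : cnt (E (not o) y) J₁ ≤ cnt rest J₁
          mono = cnt-mono (E (not o) y) rest J₁ λ x m t →
            rest-intro x (noY x m) (≢true λ Xx → true≢false (trans (sym (E-not o y x)) t)
              (bad-false (none x y (J⊂ x (∈-++ˡ J₁ [] m)) y∈) Xx Yy
                λ p → ∉-≢ (J₁ ++ []) (Uniq-head y (J₁ ++ []) u) (∈-++ˡ J₁ [] m) (sym p)))
        scan y J₁ (z ∷ J) Yy y∈ J⊂ u h noY = go (dich (Y z))
          where
          eq : (J₁ ++ z ∷ []) ++ J ≡ J₁ ++ z ∷ J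
          eq = ++-assoc J₁ (z ∷ []) J
          noY′ : Y z ≡ false → ∀ x → (x ∈ J₁) ⊎ (x ∈ (z ∷ [])) → Y x ≡ false
          noY′ f x (inj₁ m) = noY x m
          noY′ f x (inj₂ m) with ∈-uncons z [] m
          ... | inj₁ refl = f
          z∉ : Y z ≡ true → b2n (X∖Y z) ≡ 0
          z∉ t with X z | Y z
          ... | true | true = refl
          ... | false | true = refl
          go : Y z ≡ true ⊎ Y z ≡ false → cnt X∖Y (J₁ ++ z ∷ J) ≤ cnt rest (J₁ ++ z ∷ J)
          go (inj₂ f) = subst (λ l → cnt X∖Y l ≤ cnt rest l) eq
            (scan y (J₁ ++ z ∷ []) J Yy y∈ (λ x m → J⊂ x (subst (x ∈_) eq m)) (subst (λ l → Uniq (y ∷ l)) (sym eq) u)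
              (subst (λ l → Half (not o) (y ∷ l)) (sym eq) h) (λ x m → noY′ f x (∈-++ J₁ (z ∷ []) m)))
          go (inj₁ t) = lin (cnt X∖Y (J₁ ++ z ∷ J) ∷ cnt rest (J₁ ++ z ∷ J) ∷ cnt X∖Y (J₁ ++ []) ∷ cnt rest
              (J₁ ++ []) ∷ cnt X∖Y J ∷ cnt rest J ∷ cnt X∖Y J₁ ∷ b2n ((E o s z ∧ not (F z)) ∧ not (Y z)) ∷ cnt rest
              J₁ ∷ b2n (not (E o s z ∧ not (F z)) ∧ not (Y z)) ∷ []) (x₂ ⊑ x₃ ⊢ x₄ ⊑ x₅ ⊢ x₀ ⊑ x₆ ⊕ (x₇ ⊕ x₄)
              ⊢ x₈ ⊕ (x₉ ⊕ x₅) ⊑ x₁ ⊢ x₆ ⊕ con 0 ⊑ x₂ ⊢ x₃ ⊑ x₈ ⊕ con 0 ⊢ x₇ ⊑ con 0 ⊢ ⊩ x₀ ⊑ x₁)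
              refl (scan y J₁ [] Yy y∈ (λ x m → J⊂ x (∈-++ˡ J₁ (z ∷ J) (subst (x ∈_) (++-identityʳ J₁) m)))
              (subst (λ l → Uniq (y ∷ l)) (sym (++-identityʳ J₁)) (Uniq-++ˡ (y ∷ J₁) (z ∷ J) u))
              (subst (λ l → Half (not o) (y ∷ l)) (sym (++-identityʳ J₁)) (Half-take (not o) (y ∷ J₁) (z ∷ J) h))
              noY) (scan z [] J t (J⊂ z (∈-++ʳ J₁ (z ∷ J) (∈-here z J)))
              (λ x m → J⊂ x (∈-++ʳ J₁ (z ∷ J) (∈-there z J m))) (Uniq-++ʳ (y ∷ J₁) (z ∷ J) u)
              (Half-drop (not o) (y ∷ J₁) (z ∷ J) h) (λ x ())) (≤-reflexive (cnt-++ X∖Y J₁ (z ∷ J)))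
              (≥-reflexive (cnt-++ rest J₁ (z ∷ J))) (≥-reflexive (cnt-++ X∖Y J₁ []))
              (≤-reflexive (cnt-++ rest J₁ [])) (≤-reflexive (z∉ t))

        -- Up to the first member of `Y`, every vertex with an arc to `a` is forbidden, and these
        -- are at least half of the stretch; this gives the term in `F`. From there on `scan`
        -- applies.
        start : ∀ J₁ J → (∀ x → x ∈ (J₁ ++ J) → x ∈ L) → Uniq (J₁ ++ J) → Half (not o) (a ∷ J₁ ++ J) →
          (∀ x → x ∈ J₁ → Y x ≡ false) → cnt X∖Y (J₁ ++ J) ≤ 2 * cnt F (J₁ ++ J) + cnt rest (J₁ ++ J)
        start J₁ [] J⊂ u (h , _) noY = lin (cnt X∖Y (J₁ ++ []) ∷ cnt F (J₁ ++ []) ∷ cnt rest (J₁ ++ []) ∷ length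
            J₁ ∷ cnt (E (not o) a) J₁ ∷ cnt X∖Y J₁ ∷ cnt F J₁ ∷ []) (x₃ ⊑ 2 ⊛ x₄ ⊢ x₀ ⊑ x₅ ⊕ con 0 ⊢ x₆ ⊕ con 0 ⊑ x₁
            ⊢ x₆ ⊕ con 0 ⊑ x₁ ⊢ x₅ ⊑ x₃ ⊢ x₄ ⊑ x₆ ⊢ x₄ ⊑ x₆ ⊢ ⊩ x₀ ⊑ 2 ⊛ x₁ ⊕ x₂)
            refl (h J₁ [] refl) (≤-reflexive (cnt-++ X∖Y J₁ [])) (≥-reflexive (cnt-++ F J₁ []))
            (≥-reflexive (cnt-++ F J₁ [])) (cnt≤length X∖Y J₁) mono mono
          where
          k : ∀ b f → (b ∧ not f) ≡ false → b ≡ true → f ≡ true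
          k true true _ _ = refl
          mono : cnt (E (not o) a) J₁ ≤ cnt F J₁
          mono = cnt-mono (E (not o) a) F J₁ λ x m t → k (E o x a) (F x) (noY x m) (trans (sym (E-not o a x)) t)
        start J₁ (z ∷ J) J⊂ u h noY = go (dich (Y z))
          where
          eq : (J₁ ++ z ∷ []) ++ J ≡ J₁ ++ z ∷ J
          eq = ++-assoc J₁ (z ∷ []) J
          noY′ : Y z ≡ false → ∀ x → (x ∈ J₁) ⊎ (x ∈ (z ∷ [])) → Y x ≡ false
          noY′ f x (inj₁ m) = noY x m
          noY′ f x (inj₂ m) with ∈-uncons z [] m
          ... | inj₁ refl = f
          z∉ : Y z ≡ true → b2n (X∖Y z) ≡ 0
          z∉ t with X z | Y z
          ... | true | true = refl
          ... | false | true = refl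
          go : Y z ≡ true ⊎ Y z ≡ false → cnt X∖Y (J₁ ++ z ∷ J) ≤ 2 * cnt F (J₁ ++ z ∷ J) + cnt rest (J₁ ++ z ∷ J)
          go (inj₂ f) = subst (λ l → cnt X∖Y l ≤ 2 * cnt F l + cnt rest l) eq
            (start (J₁ ++ z ∷ []) J (λ x m → J⊂ x (subst (x ∈_) eq m)) (subst Uniq (sym eq) u)
              (subst (λ l → Half (not o) (a ∷ l)) (sym eq) h) (λ x m → noY′ f x (∈-++ J₁ (z ∷ []) m)))
          go (inj₁ t) = lin (cnt X∖Y (J₁ ++ z ∷ J) ∷ cnt F (J₁ ++ z ∷ J) ∷ cnt rest (J₁ ++ z ∷ J) ∷ cnt X∖Y
              (J₁ ++ []) ∷ cnt F (J₁ ++ []) ∷ cnt rest (J₁ ++ []) ∷ cnt X∖Y J ∷ cnt rest J ∷ cnt X∖Y J₁ ∷ b2n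
              ((E o s z ∧ not (F z)) ∧ not (Y z)) ∷ cnt rest J₁ ∷ b2n (not (E o s z ∧ not (F z)) ∧ not (Y z)) ∷ cnt F
              J₁ ∷ b2n (F z) ∷ cnt F J ∷ []) (x₃ ⊑ 2 ⊛ x₄ ⊕ x₅ ⊢ x₆ ⊑ x₇ ⊢ x₀ ⊑ x₈ ⊕ (x₉ ⊕ x₆)
              ⊢ x₁₀ ⊕ (x₁₁ ⊕ x₇) ⊑ x₂ ⊢ x₁₂ ⊕ (x₁₃ ⊕ x₁₄) ⊕ 1 ⊛ (x₁₂ ⊕ (x₁₃ ⊕ x₁₄)) ⊑ x₁ ⊕ 1 ⊛ x₁ ⊢ x₈ ⊕ con 0 ⊑ x₃
              ⊢ x₅ ⊑ x₁₀ ⊕ con 0 ⊢ x₄ ⊕ 1 ⊛ x₄ ⊑ x₁₂ ⊕ con 0 ⊕ 1 ⊛ (x₁₂ ⊕ con 0) ⊢ x₉ ⊑ con 0 ⊢ ⊩ x₀ ⊑ 2 ⊛ x₁ ⊕ x₂)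
              refl (start J₁ [] (λ x m → J⊂ x (∈-++ˡ J₁ (z ∷ J) (subst (x ∈_) (++-identityʳ J₁) m)))
              (subst Uniq (sym (++-identityʳ J₁)) (Uniq-++ˡ J₁ (z ∷ J) u))
              (subst (λ l → Half (not o) (a ∷ l)) (sym (++-identityʳ J₁)) (Half-take (not o) (a ∷ J₁) (z ∷ J) h))
              noY) (scan z [] J t (J⊂ z (∈-++ʳ J₁ (z ∷ J) (∈-here z J)))
              (λ x m → J⊂ x (∈-++ʳ J₁ (z ∷ J) (∈-there z J m))) (Uniq-++ʳ J₁ (z ∷ J) u)
              (Half-drop (not o) (a ∷ J₁) (z ∷ J) h) (λ x ())) (≤-reflexive (cnt-++ X∖Y J₁ (z ∷ J)))
              (≥-reflexive (cnt-++ rest J₁ (z ∷ J))) (*-monoʳ-≤ 2 (≤-reflexive (sym (cnt-++ F J₁ (z ∷ J)))))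
              (≥-reflexive (cnt-++ X∖Y J₁ [])) (≤-reflexive (cnt-++ rest J₁ []))
              (*-monoʳ-≤ 2 (≤-reflexive (cnt-++ F J₁ []))) (≤-reflexive (z∉ t))

        -- Two common members would be joined by an arc, and in either direction it would lead from
        -- `X` to `Y`.
        pair : cnt (λ x → X x ∧ Y x) L ≤ 1
        pair = cnt-pair (λ x → X x ∧ Y x) L uniq clash
          where
          clash : ∀ x y → x ∈ L → y ∈ L → x ≢ y → (X x ∧ Y x) ≡ true → (X y ∧ Y y) ≡ true → ⊥
          clash x y mx my ne p q with ∧-true (X x) (Y x) p | ∧-true (X y) (Y y) q
          ... | Xx , Yx | Xy , Yy = go (E-or o x y ne)
            where
            go : E o x y ≡ true ⊎ E (not o) x y ≡ true → ⊥
            go (inj₁ t) = true≢false t (bad-false (none x y mx my) Xx Yy ne)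
            go (inj₂ t) = true≢false (trans (sym (E-not o x y)) t)
                (bad-false (none y x my mx) Xy Yx (λ r → ne (sym r)))

        -- For `n` vertices, `f` of them forbidden: `X∖Y` has at least `n/2 - 1 - f` members, `Y` at
        -- least `n/2 - f`, and `rest` at least those of `X∖Y` minus `2f`. The three sizes sum to
        -- `n`, whence `n/2` is at most `2 + 5f`.
        small : length ms ≤ 4 + 10 * cnt F ms
        small = lin (length ms ∷ cnt F ms ∷ cnt X∖Y L ∷ cnt Y L ∷ cnt F L ∷ cnt rest L ∷ [])
            (x₀ ⊑ 2 ⊛ x₂ ⊕ con 2 ⊕ 2 ⊛ x₁ ⊢ x₀ ⊑ 2 ⊛ x₂ ⊕ con 2 ⊕ 2 ⊛ x₁ ⊢ x₀ ⊑ 2 ⊛ x₃ ⊕ 2 ⊛ x₄ ⊢ x₂ ⊑ 2 ⊛ x₄ ⊕ x₅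
            ⊢ x₂ ⊑ 2 ⊛ x₄ ⊕ x₅ ⊢ x₂ ⊕ x₃ ⊕ x₅ ⊑ x₀ ⊢ x₂ ⊕ x₃ ⊕ x₅ ⊑ x₀ ⊢ x₄ ⊕ 5 ⊛ x₄ ⊑ x₁ ⊕ 5 ⊛ x₁
            ⊢ ⊩ x₀ ⊑ con 4 ⊕ 10 ⊛ x₁) refl t₁ t₁ t₂ t₃ t₃ (≤-reflexive t₄) (≤-reflexive t₄)
            (*-monoʳ-≤ 6 (≤-reflexive (cnt-reverse F ms)))
          where
          t₁ : length ms ≤ 2 * cnt X∖Y L + 2 + 2 * cnt F ms
          t₁ = lin (length ms ∷ cnt X∖Y L ∷ cnt F ms ∷ cnt (E o s) ms ∷ cnt X ms ∷ cnt X (reverse ms) ∷ cnt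
              (λ x → X x ∧ Y x) L ∷ []) (x₀ ⊑ 2 ⊛ x₃ ⊢ x₃ ⊕ 1 ⊛ x₃ ⊑ x₄ ⊕ x₂ ⊕ 1 ⊛ (x₄ ⊕ x₂)
              ⊢ x₅ ⊕ 1 ⊛ x₅ ⊑ x₁ ⊕ x₆ ⊕ 1 ⊛ (x₁ ⊕ x₆) ⊢ x₄ ⊕ 1 ⊛ x₄ ⊑ x₅ ⊕ 1 ⊛ x₅ ⊢ x₆ ⊕ 1 ⊛ x₆ ⊑ con 2
              ⊢ ⊩ x₀ ⊑ 2 ⊛ x₁ ⊕ con 2 ⊕ 2 ⊛ x₂)
              refl (proj₁ half₁ ms [] (sym (++-identityʳ ms)))
              (*-monoʳ-≤ 2 (cnt-le (E o s) X F ms λ x _ → Ea≤ (E o s x) (F x)))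
              (*-monoʳ-≤ 2 (cnt-le X X∖Y (λ x → X x ∧ Y x) L λ x _ → X≤ x))
              (*-monoʳ-≤ 2 (≤-reflexive (sym (cnt-reverse X ms)))) (*-monoʳ-≤ 2 pair)
          t₂ : length ms ≤ 2 * cnt Y L + 2 * cnt F L
          t₂ = lin (length ms ∷ cnt Y L ∷ cnt F L ∷ length L ∷ cnt (E (not o) a) L ∷ []) (x₃ ⊑ 2 ⊛ x₄ ⊢ x₀ ⊑ x₃
              ⊢ x₄ ⊕ 1 ⊛ x₄ ⊑ x₁ ⊕ x₂ ⊕ 1 ⊛ (x₁ ⊕ x₂) ⊢ ⊩ x₀ ⊑ 2 ⊛ x₁ ⊕ 2 ⊛ x₂)
              refl (proj₁ half₂ L [] (sym (++-identityʳ L))) (≥-reflexive (length-reverse ms))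
              (*-monoʳ-≤ 2 (cnt-le (E (not o) a) Y F L λ x _ → subst (λ b → b2n b ≤ b2n (Y x) + b2n (F x))
              (sym (E-not o a x)) (Ea≤ (E o x a) (F x))))
          t₃ : cnt X∖Y L ≤ 2 * cnt F L + cnt rest L
          t₃ = start [] L (λ x m → m) uniq half₂ (λ x ())
          t₄ : cnt X∖Y L + cnt Y L + cnt rest L ≡ length ms
          t₄ = trans (cnt-partition X∖Y Y rest L part) (length-reverse ms)

    -- The inner vertices form an arc from `X`, the free successors of `s`, to `Y`, the free
    -- predecessors of `a`. Without such an arc `rest` would be nearly as large as `X∖Y`, while `X`
    -- and `Y` each fill nearly half of the interval, and there is no space for all three.
    jump : 5 + 10 * cnt F ms ≤ length ms → Jump o F s ms a
    jump big = go (search₂ bad L L)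
      where
      unmix : ∀ x y → bad x y ≡ true → (X x ≡ true) × (Y y ≡ true) × (E o x y ≡ true) × ((x == y) ≡ false)
      unmix x y t with X x | Y y | E o x y | x == y
      ... | true | true | true | false = refl , refl , refl , refl
      notf : ∀ {b} → not b ≡ true → b ≡ false
      notf {false} _ = refl
      go : Search₂ bad L L → Jump o F s ms a
      go (inj₂ none) = ⊥-elim (<⇒≱ big (small none))
      go (inj₁ (x , y , mx , my , t)) with unmix x y t
      ... | p , q , r , ne with ∧-true (E o s x) (not (F x)) p | ∧-true (E o y a) (not (F y)) q
      ...   | sx , fx | ya , fy = x , y , ≈-∈ L ms (≈-reverse ms) mx , ≈-∈ L ms (≈-reverse ms) my ,
        (λ { refl → true≢false (==-refl x) ne }) , notf fx , notf fy , sx , r , ya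

-- Routing zigzags from one of two starts into a zone of candidate roots.

module Routing {V : Set} (_≟_ : DecidableEquality V) (e : V → V → Bool) (tot : ∀ u v → u ≢ v → e u v ≡ not (e v u))
    where
  open Counting _≟_
  open MedianOrder _≟_ e tot
  open Paths _≟_ e tot
  open Trees using (EndsTurn; turn; _∷_; same?)

  lead : Bool → List Bool → ℕ
  lead true (true ∷ w) = suc (lead true w)
  lead false (false ∷ w) = suc (lead false w)
  lead _ _ = 0

  lead-same : ∀ s w → lead s (s ∷ w) ≡ suc (lead s w)
  lead-same true w = refl
  lead-same false w = refl

  lead-diff : ∀ s w → lead s (not s ∷ w) ≡ 0
  lead-diff true w = refl
  lead-diff false w = refl

  lead≤length : ∀ s w → lead s w ≤ length w
  lead≤length true [] = z≤n
  lead≤length false [] = z≤n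
  lead≤length true (true ∷ w) = s≤s (lead≤length true w)
  lead≤length true (false ∷ w) = z≤n
  lead≤length false (true ∷ w) = z≤n
  lead≤length false (false ∷ w) = s≤s (lead≤length false w)

  E-flip : ∀ s u v → E (not s) u v ≡ true → E s v u ≡ true
  E-flip s u v t = trans (sym (E-not s u v)) t

  Fork : Bool → List V → Set
  Fork s zs = Σ[ q ∈ V ] Σ[ p ∈ V ] Σ[ z ∈ V ] (E s q p ≡ true) × (E s q z ≡ true) × ((z ∷ p ∷ q ∷ []) ⊆ zs)

  -- Six arcs among four vertices force some vertex to have two successors, in either reading of the
  -- direction; three vertices could form a cycle.
  fork : ∀ s a b c d rest → Uniq (a ∷ b ∷ c ∷ d ∷ rest) → Fork s (a ∷ b ∷ c ∷ d ∷ rest)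
  fork s a b c d rest u = go (E-or s a b a≢b) (E-or s a c a≢c) (E-or s a d a≢d) (E-or s b c b≢c) (E-or s b d b≢d)
      (E-or s c d c≢d)
    where
    u₁ = Uniq-tail a (b ∷ c ∷ d ∷ rest) u
    u₂ = Uniq-tail b (c ∷ d ∷ rest) u₁
    a≢b : a ≢ b
    a≢b = ∉-≢ (b ∷ c ∷ d ∷ rest) (Uniq-head a (b ∷ c ∷ d ∷ rest) u) (∈-here b (c ∷ d ∷ rest))
    a≢c : a ≢ c
    a≢c = ∉-≢ (b ∷ c ∷ d ∷ rest) (Uniq-head a (b ∷ c ∷ d ∷ rest) u) (∈-there b (c ∷ d ∷ rest) (∈-here c (d ∷ rest)))
    a≢d : a ≢ d
    a≢d = ∉-≢ (b ∷ c ∷ d ∷ rest) (Uniq-head a (b ∷ c ∷ d ∷ rest) u)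
        (∈-there b (c ∷ d ∷ rest) (∈-there c (d ∷ rest) (∈-here d rest)))
    b≢c : b ≢ c
    b≢c = ∉-≢ (c ∷ d ∷ rest) (Uniq-head b (c ∷ d ∷ rest) u₁) (∈-here c (d ∷ rest))
    b≢d : b ≢ d
    b≢d = ∉-≢ (c ∷ d ∷ rest) (Uniq-head b (c ∷ d ∷ rest) u₁) (∈-there c (d ∷ rest) (∈-here d rest))
    c≢d : c ≢ d
    c≢d = ∉-≢ (d ∷ rest) (Uniq-head c (d ∷ rest) u₂) (∈-here d rest)
    zs = a ∷ b ∷ c ∷ d ∷ rest
    f = E-flip s
    go : E s a b ≡ true ⊎ E (not s) a b ≡ true → E s a c ≡ true ⊎ E (not s) a c ≡ true → E s a d ≡ true ⊎ E (not s) a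
        d ≡ true →
      E s b c ≡ true ⊎ E (not s) b c ≡ true → E s b d ≡ true ⊎ E (not s) b d ≡ true → E s c d ≡ true ⊎ E (not s) c d
          ≡ true → Fork s zs
    go (inj₁ ab) (inj₁ ac) _ _ _ _ = a , b , c , ab , ac , λ v → lin
        (b2n (v == c) ∷ b2n (v == b) ∷ b2n (v == a) ∷ b2n (v == d) ∷ # v rest ∷ [])
        (⊩ x₀ ⊕ (x₁ ⊕ (x₂ ⊕ con 0)) ⊑ x₂ ⊕ (x₁ ⊕ (x₀ ⊕ (x₃ ⊕ x₄)))) refl
    go (inj₁ ab) (inj₂ ca) (inj₁ ad) _ _ _ = a , b , d , ab , ad , λ v → lin
        (b2n (v == d) ∷ b2n (v == b) ∷ b2n (v == a) ∷ b2n (v == c) ∷ # v rest ∷ [])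
        (⊩ x₀ ⊕ (x₁ ⊕ (x₂ ⊕ con 0)) ⊑ x₂ ⊕ (x₁ ⊕ (x₃ ⊕ (x₀ ⊕ x₄)))) refl
    go (inj₁ ab) (inj₂ ca) (inj₂ da) _ _ (inj₁ cd) = c , d , a , cd , f a c ca , λ v → lin
        (b2n (v == a) ∷ b2n (v == d) ∷ b2n (v == c) ∷ b2n (v == b) ∷ # v rest ∷ [])
        (⊩ x₀ ⊕ (x₁ ⊕ (x₂ ⊕ con 0)) ⊑ x₀ ⊕ (x₃ ⊕ (x₂ ⊕ (x₁ ⊕ x₄)))) refl
    go (inj₁ ab) (inj₂ ca) (inj₂ da) _ _ (inj₂ dc) = d , c , a , f c d dc , f a d da , λ v → lin
        (b2n (v == a) ∷ b2n (v == c) ∷ b2n (v == d) ∷ b2n (v == b) ∷ # v rest ∷ [])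
        (⊩ x₀ ⊕ (x₁ ⊕ (x₂ ⊕ con 0)) ⊑ x₀ ⊕ (x₃ ⊕ (x₁ ⊕ (x₂ ⊕ x₄)))) refl
    go (inj₂ ba) (inj₂ ca) _ (inj₁ bc) _ _ = b , c , a , bc , f a b ba , λ v → lin
        (b2n (v == a) ∷ b2n (v == c) ∷ b2n (v == b) ∷ b2n (v == d) ∷ # v rest ∷ [])
        (⊩ x₀ ⊕ (x₁ ⊕ (x₂ ⊕ con 0)) ⊑ x₀ ⊕ (x₂ ⊕ (x₁ ⊕ (x₃ ⊕ x₄)))) refl
    go (inj₂ ba) (inj₂ ca) _ (inj₂ cb) _ _ = c , b , a , f b c cb , f a c ca , λ v → lin
        (b2n (v == a) ∷ b2n (v == b) ∷ b2n (v == c) ∷ b2n (v == d) ∷ # v rest ∷ [])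
        (⊩ x₀ ⊕ (x₁ ⊕ (x₂ ⊕ con 0)) ⊑ x₀ ⊕ (x₁ ⊕ (x₂ ⊕ (x₃ ⊕ x₄)))) refl
    go (inj₂ ba) (inj₁ ac) (inj₁ ad) _ _ _ = a , c , d , ac , ad , λ v → lin
        (b2n (v == d) ∷ b2n (v == c) ∷ b2n (v == a) ∷ b2n (v == b) ∷ # v rest ∷ [])
        (⊩ x₀ ⊕ (x₁ ⊕ (x₂ ⊕ con 0)) ⊑ x₂ ⊕ (x₃ ⊕ (x₁ ⊕ (x₀ ⊕ x₄)))) refl
    go (inj₂ ba) (inj₁ ac) (inj₂ da) _ (inj₁ bd) _ = b , d , a , bd , f a b ba , λ v → lin
        (b2n (v == a) ∷ b2n (v == d) ∷ b2n (v == b) ∷ b2n (v == c) ∷ # v rest ∷ [])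
        (⊩ x₀ ⊕ (x₁ ⊕ (x₂ ⊕ con 0)) ⊑ x₀ ⊕ (x₂ ⊕ (x₃ ⊕ (x₁ ⊕ x₄)))) refl
    go (inj₂ ba) (inj₁ ac) (inj₂ da) _ (inj₂ db) _ = d , b , a , f b d db , f a d da , λ v → lin
        (b2n (v == a) ∷ b2n (v == b) ∷ b2n (v == d) ∷ b2n (v == c) ∷ # v rest ∷ [])
        (⊩ x₀ ⊕ (x₁ ⊕ (x₂ ⊕ con 0)) ⊑ x₀ ⊕ (x₁ ⊕ (x₃ ⊕ (x₂ ⊕ x₄)))) refl

  module Zone (zs : List V) (uniqᶻ : Uniq zs) (big : 7 ≤ length zs) where

    -- The route ends at a candidate root `z`, after at most two other vertices of the zone. `exit`
    -- says that it leaves `us` at once only if the word is a turn followed by at most one letter;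
    -- this settles the case of a candidate that has no other way out.
    record Route (us : List V) (w : List Bool) (x : V) : Set where
      constructor mkRoute
      field
        vs es : List V
        z : V
        walk : Walk x (vs ++ es) w z
        inside : (x ∷ vs) ⊆ us
        zone : (z ∷ es) ⊆ zs
        few : length es ≤ 2
        exit : vs ≡ [] → Σ[ s ∈ Bool ] Σ[ v ∈ List Bool ] (w ≡ s ∷ not s ∷ v) × (length v ≤ 1)

    prepend : ∀ us us′ {s w x u} → us ≈ (x ∷ us′) → E s x u ≡ true → Route us′ w u → Route us (s ∷ w) x
    prepend us us′ {x = x} {u = u} eq t (mkRoute vs es z walk inside zone few exit) =
      mkRoute (u ∷ vs) es z (step t walk) (λ v → lin (b2n (v == x) ∷ b2n (v == u) ∷ # v vs ∷ # v us ∷ # v us′ ∷ [])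
          (x₁ ⊕ x₂ ⊑ x₄ ⊢ x₀ ⊕ x₄ ⊑ x₃ ⊢ ⊩ x₀ ⊕ (x₁ ⊕ x₂) ⊑ x₃) refl (inside v) (≥-reflexive (eq (v ==_)))) zone few
          λ ()

    Out : Bool → V → Set
    Out s u = 4 ≤ cnt (E s u) zs

    -- Seven vertices cannot split into at most three on either side of `u`.
    out : ∀ s u → # u zs ≡ 0 → Out s u ⊎ Out (not s) u
    out s u u∉ = go (4 ≤? cnt (E s u) zs)
      where
      total : length zs ≤ cnt (E s u) zs + cnt (E (not s) u) zs
      total = lin (length zs ∷ cnt (E s u) zs ∷ cnt (E (not s) u) zs ∷ cnt (λ x → not (E s u x)) zs ∷ [])
          (x₀ ⊑ x₁ ⊕ x₃ ⊢ x₃ ⊑ x₂ ⊢ ⊩ x₀ ⊑ x₁ ⊕ x₂)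
          refl (≥-reflexive (cnt-not (E s u) zs)) (cnt-mono (λ x → not (E s u x)) (E (not s) u) zs λ x m t
          → trans (E-not s u x) (trans (E-tot s x u λ p → ∉-≢ zs u∉ m (sym p)) t))
      go : Dec (4 ≤ cnt (E s u) zs) → Out s u ⊎ Out (not s) u
      go (yes p) = inj₁ p
      go (no p) = inj₂ (lin (cnt (E (not s) u) zs ∷ cnt (E s u) zs ∷ length zs ∷ []) (con 1 ⊕ x₁ ⊑ con 4
          ⊢ x₂ ⊑ x₁ ⊕ x₀ ⊢ con 7 ⊑ x₂ ⊢ ⊩ con 4 ⊑ x₀) refl (≰⇒> p) total big)

    Tail : Bool → V → List Bool → Set
    Tail s u w = Σ[ es ∈ List V ] Σ[ z ∈ V ] Walk u es (s ∷ w) z × ((z ∷ es) ⊆ zs) × (length es ≤ 2)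

    -- Any two of the four neighbours are joined by an arc that can be read in the wanted direction,
    -- and `fork` provides the turn `t ∷ not t ∷ []`.
    tail : ∀ s u w → Out s u → (length w ≤ 1) ⊎ (Σ[ t ∈ Bool ] w ≡ t ∷ not t ∷ []) → Tail s u w
    tail s u w o h = go (filt (E s u) zs) refl (≤-trans o (≤-reflexive (sym (length-filt (E s u) zs)))) h
      where
      adj : ∀ {z ms} → filt (E s u) zs ≡ ms → z ∈ ms → E s u z ≡ true
      adj refl m = ∈-filt (E s u) zs m
      sub : ∀ {ms} → filt (E s u) zs ≡ ms → ms ⊆ zs
      sub refl = filt-⊆ (E s u) zs
      go : ∀ ms → filt (E s u) zs ≡ ms → 4 ≤ length ms → (length w ≤ 1) ⊎ (Σ[ t ∈ Bool ] w ≡ t ∷ not t ∷ [])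
          → Tail s u w
      go (_ ∷ []) _ (s≤s ())
      go (_ ∷ _ ∷ []) _ (s≤s (s≤s ()))
      go (_ ∷ _ ∷ _ ∷ []) _ (s≤s (s≤s (s≤s ())))
      go (a ∷ b ∷ c ∷ d ∷ ms) eq _ = pick
        where
        M = a ∷ b ∷ c ∷ d ∷ ms
        uq : Uniq M
        uq v = ≤-trans (sub eq v) (uniqᶻ v)
        adjᴹ : ∀ {z} → z ∈ M → E s u z ≡ true
        adjᴹ m = adj eq m
        short : ∀ w → length w ≤ 1 → Tail s u w
        short [] _ = [] , a , end (adjᴹ (∈-here a (b ∷ c ∷ d ∷ ms))) ,
            (λ v → lin (b2n (v == a) ∷ # v zs ∷ b2n (v == b) ∷ b2n (v == c) ∷ b2n (v == d) ∷ # v ms ∷ [])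
            (x₀ ⊕ (x₂ ⊕ (x₃ ⊕ (x₄ ⊕ x₅))) ⊑ x₁ ⊢ ⊩ x₀ ⊕ con 0 ⊑ x₁) refl (sub eq v)) , z≤n
        short (t ∷ []) _ = edge (E-or t a b (∉-≢ (b ∷ c ∷ d ∷ ms) (Uniq-head a (b ∷ c ∷ d ∷ ms) uq)
            (∈-here b (c ∷ d ∷ ms))))
          where
          edge : E t a b ≡ true ⊎ E (not t) a b ≡ true → Tail s u (t ∷ [])
          edge (inj₁ ab) = a ∷ [] , b , step (adjᴹ (∈-here a (b ∷ c ∷ d ∷ ms))) (end ab) ,
              (λ v → lin (b2n (v == b) ∷ b2n (v == a) ∷ # v zs ∷ b2n (v == c) ∷ b2n (v == d) ∷ # v ms ∷ [])
              (x₁ ⊕ (x₀ ⊕ (x₃ ⊕ (x₄ ⊕ x₅))) ⊑ x₂ ⊢ ⊩ x₀ ⊕ (x₁ ⊕ con 0) ⊑ x₂) refl (sub eq v)) , s≤s z≤n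
          edge (inj₂ ba) = b ∷ [] , a , step (adjᴹ (∈-there a (b ∷ c ∷ d ∷ ms) (∈-here b (c ∷ d ∷ ms))))
              (end (E-flip t a b ba)) ,
            (λ v → lin (b2n (v == a) ∷ b2n (v == b) ∷ # v zs ∷ b2n (v == c) ∷ b2n (v == d) ∷ # v ms ∷ [])
                (x₀ ⊕ (x₁ ⊕ (x₃ ⊕ (x₄ ⊕ x₅))) ⊑ x₂ ⊢ ⊩ x₀ ⊕ (x₁ ⊕ con 0) ⊑ x₂) refl (sub eq v)) , s≤s z≤n
        short (_ ∷ _ ∷ _) (s≤s ())
        forked : ∀ t → Fork (not t) M → Tail s u (t ∷ not t ∷ [])
        forked t (q , p , z , qp , qz , sb) = p ∷ q ∷ [] , z ,
          step (adjᴹ (≤-trans (∈-there z (p ∷ q ∷ []) (∈-here p (q ∷ []))) (sb p)))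
            (step (E-flip t q p qp) (end qz)) , (λ v → ≤-trans (sb v) (sub eq v)) , s≤s (s≤s z≤n)
        pick : (length w ≤ 1) ⊎ (Σ[ t ∈ Bool ] w ≡ t ∷ not t ∷ []) → Tail s u w
        pick (inj₁ l) = short w l
        pick (inj₂ (t , refl)) = forked t (fork (not t) a b c d ms uq)

    -- Most of the zone lies on one side of y, so one of the two steps of a turn at y leads there.
    leave : ∀ s v y → EndsTurn (s ∷ not s ∷ v) → length v ≤ 1 → # y zs ≡ 0 → Tail s y (not s ∷ v) ⊎ Tail (not s) y v
    leave s v y et l y∉ = go (out s y y∉)
      where
      word : ∀ v → length v ≤ 1 → EndsTurn (s ∷ not s ∷ v) → (length (not s ∷ v) ≤ 1) ⊎
          (Σ[ t ∈ Bool ] not s ∷ v ≡ t ∷ not t ∷ [])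
      word [] _ _ = inj₁ ≤-refl
      word (r ∷ []) _ (_ ∷ turn _) = inj₂ (not s , refl)
      word (r ∷ []) _ (_ ∷ (_ ∷ (_ ∷ ())))
      word (r ∷ r′ ∷ v) (s≤s ()) _
      go : Out s y ⊎ Out (not s) y → Tail s y (not s ∷ v) ⊎ Tail (not s) y v
      go (inj₁ o) = inj₁ (tail s y (not s ∷ v) o (word v l et))
      go (inj₂ o) = inj₂ (tail (not s) y v o (inj₁ l))

    -- If `y` sees enough of the zone along `s`, the route starts at `y` and leaves at once.
    -- Otherwise it sees enough along `not s`; then the route goes from `x` to `y` and makes the
    -- turn there.
    route-base : ∀ s v us x y → EndsTurn (s ∷ not s ∷ v) → length v ≤ 1 → # y zs ≡ 0 → x ∈ us → y ∈ us → x ≢ y →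
      E s x y ≡ true → Route us (s ∷ not s ∷ v) x ⊎ Route us (s ∷ not s ∷ v) y
    route-base s v us x y et l y∉ mx my ne xy = go (leave s v y et l y∉)
      where
      go : Tail s y (not s ∷ v) ⊎ Tail (not s) y v → Route us (s ∷ not s ∷ v) x ⊎ Route us (s ∷ not s ∷ v) y
      go (inj₁ (es , z , w , sb , few)) = inj₂ (mkRoute [] es z w (single y us my) sb few (λ _ → s , v , refl , l))
      go (inj₂ (es , z , w , sb , few)) = inj₁ (mkRoute (y ∷ []) es z (step xy w)
        (cons-⊆ x (y ∷ []) us (≢⇒∉₁ ne) mx (single y us my)) sb few λ ())

    LeadPath : List V → Bool → List Bool → V → Set
    LeadPath us s w x = Σ[ π ∈ List V ] Path s x π × ((x ∷ π) ⊆ us) × (lead s w ≤ length π)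

    -- Two candidates alone do not guarantee a long opening run, so one of them must come with a
    -- directed path of that length. For later runs the inductive steps find such a path themselves.
    Starts : List V → List Bool → V → V → Set
    Starts us [] x y = ⊥
    Starts us (s ∷ w) x y = LeadPath us s (s ∷ w) x ⊎ LeadPath us s (s ∷ w) y

    -- Three vertices more than letters. Every inductive step drops as many vertices as letters, so
    -- the excess is preserved.
    record Ready (us : List V) (n : ℕ) : Set where
      field
        uniq : Uniq us
        apart : ∀ u → u ∈ us → # u zs ≡ 0
        room′ : 3 + n ≤ length us
    open Ready

    Result : List V → List Bool → V → V → Set
    Result us w x y = Route us w x ⊎ Route us w y

    ready-⊆ : ∀ {us n} vs m → Ready us n → vs ⊆ us → 3 + m ≤ length vs → Ready vs m
    ready-⊆ vs m R sb l = record { uniq = λ v → ≤-trans (sb v) (uniq R v) ; apart = λ u k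
        → apart R u (≤-trans k (sb u)) ; room′ = l }

    swap : ∀ {A B : Set} → A ⊎ B → B ⊎ A
    swap (inj₁ a) = inj₂ a
    swap (inj₂ b) = inj₁ b

    RouteFor : List Bool → Set
    RouteFor w = ∀ us x y → Ready us (length w) → x ∈ us → y ∈ us → x ≢ y → Starts us w x y → Result us w x y

    Ham : Bool → List V → Set
    Ham t ds = Σ[ d₁ ∈ V ] Σ[ d₂ ∈ V ] Σ[ ds′ ∈ List V ] Path t d₁ (d₂ ∷ ds′) × ((d₁ ∷ d₂ ∷ ds′) ≈ ds)

    ham : ∀ t ds → Uniq ds → 2 ≤ length ds → Ham t ds
    ham t (_ ∷ []) u (s≤s ())
    ham t ds₀@(d ∷ d′ ∷ ds) u l = go (hamilton t d (d′ ∷ ds) u)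
      where
      go : (Σ[ y ∈ V ] Σ[ ys ∈ List V ] Path t y ys × ((y ∷ ys) ≈ ds₀)) → Ham t ds₀
      go (y , [] , p , eq) = ⊥-elim (1≰0 (≤-pred (≤-trans l (≤-reflexive (sym (≈-length (y ∷ []) ds₀ eq))))))
      go (y , y′ ∷ ys , p , eq) = y , y′ , ys , p , eq

    Pair : List V → V → V → Set
    Pair us x y = Σ[ V′ ∈ List V ] (us ≈ (x ∷ y ∷ V′))

    pair : ∀ us x y → x ∈ us → y ∈ us → x ≢ y → Pair us x y
    pair us x y mx my ne = go (remove us mx)
      where
      go : (Σ[ us′ ∈ List V ] (us ≈ (x ∷ us′))) → Pair us x y
      go (us′ , eq) = go′ (remove us′ (≢-∈-∷ x us′ (λ p → ne (sym p)) (≈-∈ us (x ∷ us′) eq my)))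
        where
        go′ : (Σ[ V′ ∈ List V ] (us′ ≈ (y ∷ V′))) → Pair us x y
        go′ (V′ , eq′) = V′ , ≈-trans us (x ∷ us′) (x ∷ y ∷ V′) eq (≈-∷ x us′ (y ∷ V′) eq′)

    -- Havet and Thomassé's induction: of two candidate starts x and y, one always survives. When the word turns at
    -- once and x precedes y, either y has two successors, or nearly all vertices precede y and the turn is made at y.
    module TurnStep (s r : Bool) (w₂ : List Bool) (IH₁ : RouteFor (not s ∷ r ∷ w₂)) (IH₂ : RouteFor (r ∷ w₂)) where
      W : List Bool
      W = s ∷ not s ∷ r ∷ w₂

      module Arc (us : List V) (x y : V) (R : Ready us (length W)) (xy : E s x y ≡ true) (V′ : List V)
          (eq : us ≈ (x ∷ y ∷ V′)) where

        len : 2 + length V′ ≡ length us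
        len = sym (≈-length us (x ∷ y ∷ V′) eq)

        enough : 4 + length w₂ ≤ length V′
        enough = lin (length w₂ ∷ length V′ ∷ length us ∷ []) (con 6 ⊕ x₀ ⊑ x₂ ⊢ x₂ ⊑ con 2 ⊕ x₁ ⊢ ⊩ con 4 ⊕ x₀ ⊑ x₁)
            refl (room′ R) (≥-reflexive len)

        uqV : Uniq V′
        uqV v = lin (# v V′ ∷ # v us ∷ b2n (v == x) ∷ b2n (v == y) ∷ []) (x₁ ⊑ con 1 ⊢ x₂ ⊕ (x₃ ⊕ x₀) ⊑ x₁
            ⊢ ⊩ x₀ ⊑ con 1) refl (uniq R v) (≥-reflexive (eq (v ==_)))

        uqYV : Uniq (y ∷ V′)
        uqYV v = lin (b2n (v == y) ∷ # v V′ ∷ # v us ∷ b2n (v == x) ∷ []) (x₂ ⊑ con 1 ⊢ x₃ ⊕ (x₀ ⊕ x₁) ⊑ x₂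
            ⊢ ⊩ x₀ ⊕ x₁ ⊑ con 1) refl (uniq R v) (≥-reflexive (eq (v ==_)))

        eqY : us ≈ (y ∷ x ∷ V′)
        eqY = ≈-trans us (x ∷ y ∷ V′) (y ∷ x ∷ V′) eq (λ p → ≤-antisym
            (lin (b2n (p x) ∷ b2n (p y) ∷ cnt p V′ ∷ []) (⊩ x₀ ⊕ (x₁ ⊕ x₂) ⊑ x₁ ⊕ (x₀ ⊕ x₂)) refl)
            (lin (b2n (p y) ∷ b2n (p x) ∷ cnt p V′ ∷ []) (⊩ x₀ ⊕ (x₁ ⊕ x₂) ⊑ x₁ ⊕ (x₀ ⊕ x₂)) refl))

        R₁ : Ready (x ∷ V′) (2 + length w₂)
        R₁ = ready-⊆ (x ∷ V′) _ R (λ v → lin (b2n (v == x) ∷ # v V′ ∷ # v us ∷ b2n (v == y) ∷ [])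
            (x₀ ⊕ (x₃ ⊕ x₁) ⊑ x₂ ⊢ ⊩ x₀ ⊕ x₁ ⊑ x₂) refl (≥-reflexive (eq (v ==_))))
            (lin (length w₂ ∷ length V′ ∷ []) (con 4 ⊕ x₀ ⊑ x₁ ⊢ ⊩ con 5 ⊕ x₀ ⊑ con 1 ⊕ x₁) refl enough)

        R₂ : Ready V′ (suc (length w₂))
        R₂ = ready-⊆ V′ _ R (λ v → lin (# v V′ ∷ # v us ∷ b2n (v == x) ∷ b2n (v == y) ∷ []) (x₂ ⊕ (x₃ ⊕ x₀) ⊑ x₁
            ⊢ ⊩ x₀ ⊑ x₁) refl (≥-reflexive (eq (v ==_))))
            (lin (length w₂ ∷ length V′ ∷ []) (con 4 ⊕ x₀ ⊑ x₁ ⊢ ⊩ con 4 ⊕ x₀ ⊑ x₁) refl enough)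

        viaY : ∀ z → E s y z ≡ true → Route (x ∷ V′) (not s ∷ r ∷ w₂) z → Result us W x y
        viaY z t ρ = inj₂ (prepend us (x ∷ V′) eqY t ρ)

        viaXY : ∀ d → E (not s) y d ≡ true → Route V′ (r ∷ w₂) d → Result us W x y
        viaXY d t ρ = inj₁ (prepend us (y ∷ V′) eq xy (prepend (y ∷ V′) V′ (≈-refl (y ∷ V′)) t ρ))

        ≢y : ∀ {u} → u ∈ V′ → y ≢ u
        ≢y = ∉-≢ V′ (Uniq-head y V′ uqYV)

        Other : V → Set
        Other g = Σ[ z ∈ V ] (z ∈ V′) × (E s y z ≡ true) × (g ≢ z)

        pairUp : ∀ g → g ∈ V′ → E s y g ≡ true → LeadPath (x ∷ V′) (not s) (not s ∷ r ∷ w₂) g → Other g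
            → Result us W x y
        pairUp g m t lp (z , mz , tz , ne) = go (IH₁ (x ∷ V′) g z R₁ (∈-there x V′ m) (∈-there x V′ mz) ne (inj₁ lp))
          where
          go : Result (x ∷ V′) (not s ∷ r ∷ w₂) g z → Result us W x y
          go (inj₁ ρ) = viaY g t ρ
          go (inj₂ ρ) = viaY z tz ρ

        other : ∀ z₁ z₂ N → filt (E s y) V′ ≡ z₁ ∷ z₂ ∷ N → ∀ g → Other g
        other z₁ z₂ N eqN g = go (g ≟ z₁)
          where
          mem : ∀ {z} → z ∈ (z₁ ∷ z₂ ∷ N) → z ∈ filt (E s y) V′
          mem m = subst (_ ∈_) (sym eqN) m
          ok : ∀ {z} → z ∈ (z₁ ∷ z₂ ∷ N) → (z ∈ V′) × (E s y z ≡ true)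
          ok m = ≤-trans (mem m) (filt-⊆ (E s y) V′ _) , ∈-filt (E s y) V′ (mem m)
          uq : Uniq (z₁ ∷ z₂ ∷ N)
          uq v = subst (λ l → # v l ≤ 1) eqN (≤-trans (filt-⊆ (E s y) V′ v) (uqV v))
          go : Dec (g ≡ z₁) → Other g
          go (yes refl) = let m , t = ok (∈-there z₁ (z₂ ∷ N) (∈-here z₂ N)) in
            z₂ , m , t , ∉-≢ (z₂ ∷ N) (Uniq-head z₁ (z₂ ∷ N) uq) (∈-here z₂ N)
          go (no n) = let m , t = ok (∈-here z₁ (z₂ ∷ N)) in z₁ , m , t , n

        -- If one of the first two vertices of a Hamiltonian path of `V′` along `not s` succeeds `y`
        -- along `s`, the path from there serves as the next run. Otherwise `y` reaches both along
        -- `not s` and the turn can be made at `y`, provided that the run of `not s` goes on; if it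
        -- has length one, an arc between two successors of `y` is long enough.
        many : (∀ g → Other g) → ∀ g₁ g₂ gs → Path (not s) g₁ (g₂ ∷ gs) → (g₁ ∷ g₂ ∷ gs) ≈ V′ → Result us W x y
        many oth g₁ g₂ gs (p , ps) eqg = go (E-or s y g₁ (≢y m₁)) (E-or s y g₂ (≢y m₂))
          where
          m₁ : g₁ ∈ V′
          m₁ = ≈-∈ (g₁ ∷ g₂ ∷ gs) V′ eqg (∈-here g₁ (g₂ ∷ gs))
          m₂ : g₂ ∈ V′
          m₂ = ≈-∈ (g₁ ∷ g₂ ∷ gs) V′ eqg (∈-there g₁ (g₂ ∷ gs) (∈-here g₂ gs))
          lenG : 2 + length gs ≡ length V′
          lenG = ≈-length (g₁ ∷ g₂ ∷ gs) V′ eqg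
          ne : g₁ ≢ g₂
          ne = ∉-≢ (g₂ ∷ gs) (Uniq-head g₁ (g₂ ∷ gs) λ v → ≤-trans (≤-reflexive (eqg (v ==_))) (uqV v)) (∈-here g₂ gs)
          both : (r ≡ not s) ⊎ (r ≡ s) → E (not s) y g₁ ≡ true → E (not s) y g₂ ≡ true → Result us W x y
          both (inj₁ refl) q₁ q₂ = go′ (IH₂ V′ g₁ g₂ R₂ m₁ m₂ ne
              (inj₁ (g₂ ∷ gs , (p , ps) , (λ v → ≤-reflexive (eqg (v ==_))) ,
              lin (lead (not s) (not s ∷ w₂) ∷ length gs ∷ length w₂ ∷ length V′ ∷ []) (x₀ ⊑ con 1 ⊕ x₂
                  ⊢ con 4 ⊕ x₂ ⊑ x₃ ⊢ x₃ ⊑ con 2 ⊕ x₁ ⊢ ⊩ x₀ ⊑ con 1 ⊕ x₁)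
                  refl (lead≤length (not s) (not s ∷ w₂)) enough (≥-reflexive lenG))))
            where
            go′ : Result V′ (r ∷ w₂) g₁ g₂ → Result us W x y
            go′ (inj₁ ρ) = viaXY g₁ q₁ ρ
            go′ (inj₂ ρ) = viaXY g₂ q₂ ρ
          both (inj₂ refl) q₁ q₂ = edge (oth g₁)
            where
            lead1 : lead (not s) (not s ∷ s ∷ w₂) ≡ 1
            lead1 = trans (lead-same (not s) (s ∷ w₂)) (cong suc (lead-diff′ s))
              where
              lead-diff′ : ∀ s → lead (not s) (s ∷ w₂) ≡ 0
              lead-diff′ true = refl
              lead-diff′ false = refl
            edge : Other g₁ → Result us W x y
            edge (a , ma , ta , _) = edge′ (oth a)
              where
              edge′ : Other a → Result us W x y
              edge′ (b , mb , tb , a≢b) = dir (E-or (not s) a b a≢b)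
                where
                sub : ∀ u v → u ∈ V′ → v ∈ V′ → u ≢ v → (u ∷ v ∷ []) ⊆ (x ∷ V′)
                sub u v mu mv n t = ≤-trans (cons-⊆ u (v ∷ []) V′ (≢⇒∉₁ n) mu (single v V′ mv) t)
                    (m≤n+m _ (b2n (t == x)))
                dir : E (not s) a b ≡ true ⊎ E (not (not s)) a b ≡ true → Result us W x y
                dir (inj₁ ab) = pairUp a ma ta (b ∷ [] , (ab , tt) , sub a b ma mb a≢b , ≤-reflexive lead1)
                    (b , mb , tb , a≢b)
                dir (inj₂ ba) = pairUp b mb tb (a ∷ [] , (E-flip (not s) a b ba , tt) , sub b a mb ma
                    (λ q → a≢b (sym q)) , ≤-reflexive lead1)
                  (a , ma , ta , λ q → a≢b (sym q))
          go : E s y g₁ ≡ true ⊎ E (not s) y g₁ ≡ true → E s y g₂ ≡ true ⊎ E (not s) y g₂ ≡ true → Result us W x y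
          go (inj₁ t) _ = pairUp g₁ m₁ t (g₂ ∷ gs , (p , ps) ,
              (λ v → lin (b2n (v == g₁) ∷ b2n (v == g₂) ∷ # v gs ∷ b2n (v == x) ∷ # v V′ ∷ []) (x₀ ⊕ (x₁ ⊕ x₂) ⊑ x₄
              ⊢ ⊩ x₀ ⊕ (x₁ ⊕ x₂) ⊑ x₃ ⊕ x₄) refl (≤-reflexive (eqg (v ==_)))) ,
            lin (lead (not s) (not s ∷ r ∷ w₂) ∷ length gs ∷ length w₂ ∷ length V′ ∷ []) (x₀ ⊑ con 2 ⊕ x₂
                ⊢ con 4 ⊕ x₂ ⊑ x₃ ⊢ x₃ ⊑ con 2 ⊕ x₁ ⊢ ⊩ x₀ ⊑ con 1 ⊕ x₁)
                refl (lead≤length (not s) (not s ∷ r ∷ w₂)) enough (≥-reflexive lenG)) (oth g₁)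
          go (inj₂ _) (inj₁ t) = pairUp g₂ m₂ t
              (gs , ps , (λ v → lin (b2n (v == g₂) ∷ # v gs ∷ b2n (v == x) ∷ # v V′ ∷ b2n (v == g₁) ∷ [])
              (x₄ ⊕ (x₀ ⊕ x₁) ⊑ x₃ ⊢ ⊩ x₀ ⊕ x₁ ⊑ x₂ ⊕ x₃) refl (≤-reflexive (eqg (v ==_)))) ,
            lin (lead (not s) (not s ∷ r ∷ w₂) ∷ length gs ∷ length w₂ ∷ length V′ ∷ []) (x₀ ⊑ con 2 ⊕ x₂
                ⊢ con 4 ⊕ x₂ ⊑ x₃ ⊢ x₃ ⊑ con 2 ⊕ x₁ ⊢ ⊩ x₀ ⊑ x₁) refl (lead≤length (not s) (not s ∷ r ∷ w₂)) enough
                (≥-reflexive lenG)) (oth g₂)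
          go (inj₂ q₁) (inj₂ q₂) = both (swap (same? s r)) q₁ q₂

        -- The vertices that `y` reaches along `not s` miss at most one vertex of `V′`, so a
        -- Hamiltonian path through them still covers the opening run of `r ∷ w₂`.
        few′ : ∀ d₁ d₂ ds → Path r d₁ (d₂ ∷ ds) → (d₁ ∷ d₂ ∷ ds) ≈ filt (E (not s) y) V′ → length V′ ≤ 3 + length ds
            → Result us W x y
        few′ d₁ d₂ ds ps eqd l = go (IH₂ V′ d₁ d₂ R₂ (proj₁ (ok m₁)) (proj₁ (ok m₂)) ne
            (inj₁ (d₂ ∷ ds , ps , (λ v → ≤-trans (≤-reflexive (eqd (v ==_))) (filt-⊆ (E (not s) y) V′ v)) ,
              lin (lead r (r ∷ w₂) ∷ length ds ∷ length w₂ ∷ length V′ ∷ []) (x₀ ⊑ con 1 ⊕ x₂ ⊢ con 4 ⊕ x₂ ⊑ x₃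
                  ⊢ x₃ ⊑ con 3 ⊕ x₁ ⊢ ⊩ x₀ ⊑ con 1 ⊕ x₁) refl (lead≤length r (r ∷ w₂)) enough l)))
          where
          ok : ∀ {z} → z ∈ (d₁ ∷ d₂ ∷ ds) → (z ∈ V′) × (E (not s) y z ≡ true)
          ok {z} m = let k = ≤-trans m (≤-reflexive (eqd (z ==_))) in
            ≤-trans k (filt-⊆ (E (not s) y) V′ _) , ∈-filt (E (not s) y) V′ k
          m₁ : d₁ ∈ (d₁ ∷ d₂ ∷ ds)
          m₁ = ∈-here d₁ (d₂ ∷ ds)
          m₂ : d₂ ∈ (d₁ ∷ d₂ ∷ ds)
          m₂ = ∈-there d₁ (d₂ ∷ ds) (∈-here d₂ ds)
          ne : d₁ ≢ d₂
          ne = ∉-≢ (d₂ ∷ ds) (Uniq-head d₁ (d₂ ∷ ds) λ v → ≤-trans (≤-reflexive (eqd (v ==_)))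
            (≤-trans (filt-⊆ (E (not s) y) V′ v) (uqV v))) (∈-here d₂ ds)
          go : Result V′ (r ∷ w₂) d₁ d₂ → Result us W x y
          go (inj₁ ρ) = viaXY d₁ (proj₂ (ok m₁)) ρ
          go (inj₂ ρ) = viaXY d₂ (proj₂ (ok m₂)) ρ

        result : Result us W x y
        result = go (filt (E s y) V′) refl
          where
          totalV : length V′ ≤ cnt (E s y) V′ + cnt (E (not s) y) V′
          totalV = lin (length V′ ∷ cnt (E s y) V′ ∷ cnt (E (not s) y) V′ ∷ cnt (λ x₁ → not (E s y x₁)) V′ ∷ [])
              (x₀ ⊑ x₁ ⊕ x₃ ⊢ x₃ ⊑ x₂ ⊢ ⊩ x₀ ⊑ x₁ ⊕ x₂)
              refl (≥-reflexive (cnt-not (E s y) V′)) (cnt-mono (λ u → not (E s y u)) (E (not s) y) V′ λ u m t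
              → trans (E-not s y u) (trans (E-tot s u y λ p → ≢y m (sym p)) t))
          D = filt (E (not s) y) V′
          manyV : (∀ g → Other g) → Ham (not s) V′ → Result us W x y
          manyV oth (g₁ , g₂ , gs , p , eqg) = many oth g₁ g₂ gs p eqg
          fewV : cnt (E s y) V′ ≤ 1 → Ham r D → Result us W x y
          fewV l (d₁ , d₂ , ds , p , eqd) = few′ d₁ d₂ ds p eqd
            (lin (length V′ ∷ length ds ∷ cnt (E s y) V′ ∷ cnt (E (not s) y) V′ ∷ length
                (filt (E (not s) y) V′) ∷ []) (x₀ ⊑ x₂ ⊕ x₃ ⊢ x₂ ⊑ con 1 ⊢ x₃ ⊑ x₄ ⊢ x₄ ⊑ con 2 ⊕ x₁
                ⊢ ⊩ x₀ ⊑ con 3 ⊕ x₁) refl totalV l (≥-reflexive (length-filt (E (not s) y) V′))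
                (≥-reflexive (≈-length (d₁ ∷ d₂ ∷ ds) D eqd)))
          uqD : Uniq D
          uqD v = ≤-trans (filt-⊆ (E (not s) y) V′ v) (uqV v)
          rest : cnt (E s y) V′ ≤ 1 → Result us W x y
          rest l = fewV l (ham r D uqD (lin (length D ∷ length V′ ∷ cnt (E s y) V′ ∷ cnt (E (not s) y) V′ ∷ length
              w₂ ∷ []) (x₁ ⊑ x₂ ⊕ x₃ ⊢ x₂ ⊑ con 1 ⊢ x₃ ⊑ x₀ ⊢ con 4 ⊕ x₄ ⊑ x₁ ⊢ ⊩ con 2 ⊑ x₀)
              refl totalV l (≥-reflexive (length-filt (E (not s) y) V′)) enough))
          go : ∀ N → filt (E s y) V′ ≡ N → Result us W x y
          go [] eqN = rest (lin (cnt (E s y) V′ ∷ length (filt (E s y) V′) ∷ []) (x₀ ⊑ x₁ ⊢ x₁ ⊑ con 0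
              ⊢ ⊩ x₀ ⊑ con 1) refl (≥-reflexive (length-filt (E s y) V′)) (≤-reflexive (cong length eqN)))
          go (z ∷ []) eqN = rest (lin (cnt (E s y) V′ ∷ length (filt (E s y) V′) ∷ []) (x₀ ⊑ x₁ ⊢ x₁ ⊑ con 1
              ⊢ ⊩ x₀ ⊑ con 1) refl (≥-reflexive (length-filt (E s y) V′)) (≤-reflexive (cong length eqN)))
          go (z₁ ∷ z₂ ∷ N) eqN = manyV (other z₁ z₂ N eqN) (ham (not s) V′ uqV
              (lin (length V′ ∷ length w₂ ∷ []) (con 4 ⊕ x₁ ⊑ x₀ ⊢ ⊩ con 2 ⊑ x₀) refl enough))

      step-turn : RouteFor W
      step-turn us x y R mx my ne _ = go (E-or s x y ne)
        where
        forward : E s x y ≡ true → Pair us x y → Result us W x y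
        forward t (V′ , eq) = Arc.result us x y R t V′ eq
        backward : E s y x ≡ true → Pair us y x → Result us W x y
        backward t (V′ , eq) = swap (Arc.result us y x R t V′ eq)
        go : E s x y ≡ true ⊎ E (not s) x y ≡ true → Result us W x y
        go (inj₁ t) = forward t (pair us x y mx my ne)
        go (inj₂ t) = backward (E-flip s x y t) (pair us y x my mx λ p → ne (sym p))

    PathIn : List V → Bool → ℕ → V → Set
    PathIn us s m x = Σ[ π ∈ List V ] Path s x π × ((x ∷ π) ⊆ us) × (m ≤ length π)

    -- If x has only one successor y in its list, every path can be closed up through x, and y takes over.
    module RunStep (s : Bool) (w : List Bool) (et : EndsTurn (s ∷ w)) (IH : RouteFor (s ∷ w)) where
      W : List Bool
      W = s ∷ s ∷ w

      -- If `x` lies inside the path of `y`, it is cut out: the head `y` and the vertex after `x`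
      -- both succeed `x`, so `x` can be put in front of the two pieces merged, and no vertex is
      -- lost. Hence `x` may be assumed to have the path.
      reroute : ∀ us x y m → Uniq us → x ∈ us → y ∈ us → x ≢ y → E s x y ≡ true → PathIn us s m y → PathIn us s m x
      reroute us x y m uq mx my ne xy (π , p , sb , l) = go (1 ≤? # x π)
        where
        go : Dec (1 ≤ # x π) → PathIn us s m x
        go (no n) = y ∷ π , (xy , p) , cons-⊆ x (y ∷ π) us
            (trans (cong (_+ # x π) (≢⇒∉ ne)) (n≤0⇒n≡0 (≤-pred (≰⇒> n)))) mx sb , ≤-trans l (n≤1+n _)
        go (yes k) = split (∈-split π k)
          where
          split : (Σ[ as ∈ List V ] Σ[ bs ∈ List V ] (π ≡ as ++ x ∷ bs)) → PathIn us s m x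
          split (as , [] , refl) = y ∷ as , (xy , Path-take s y as (x ∷ []) p) ,
            (λ v → lin (b2n (v == x) ∷ b2n (v == y) ∷ # v as ∷ # v us ∷ # v (as ++ x ∷ []) ∷ []) (x₁ ⊕ x₄ ⊑ x₃
                ⊢ x₂ ⊕ (x₀ ⊕ con 0) ⊑ x₄ ⊢ ⊩ x₀ ⊕ (x₁ ⊕ x₂) ⊑ x₃)
                refl (sb v) (≥-reflexive (cnt-++ (v ==_) as (x ∷ [])))) , lin
                (m ∷ length as ∷ length (as ++ x ∷ []) ∷ []) (x₀ ⊑ x₂ ⊢ x₂ ⊑ x₁ ⊕ con 1 ⊢ ⊩ x₀ ⊑ con 1 ⊕ x₁)
                refl l (≤-reflexive (length-++ as {x ∷ []}))
          split (as , b ∷ bs , refl) = join (merge s y as b bs (Path-take s y as (x ∷ b ∷ bs) p) pb uqm)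
            where
            pxb : Path s x (b ∷ bs)
            pxb = Path-drop s y as x (b ∷ bs) p
            pb = proj₂ pxb
            uqm : Uniq (y ∷ as ++ b ∷ bs)
            uqm v = lin (b2n (v == y) ∷ # v (as ++ b ∷ bs) ∷ # v (as ++ x ∷ b ∷ bs) ∷ # v us ∷ # v as ∷ b2n
                (v == x) ∷ b2n (v == b) ∷ # v bs ∷ []) (x₀ ⊕ x₂ ⊑ x₃ ⊢ x₃ ⊑ con 1 ⊢ x₄ ⊕ (x₅ ⊕ (x₆ ⊕ x₇)) ⊑ x₂
                ⊢ x₁ ⊑ x₄ ⊕ (x₆ ⊕ x₇) ⊢ ⊩ x₀ ⊕ x₁ ⊑ con 1)
                refl (sb v) (uq v) (≥-reflexive (cnt-++ (v ==_) as (x ∷ b ∷ bs)))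
                (≤-reflexive (cnt-++ (v ==_) as (b ∷ bs)))
            join : Merged s y as b bs → PathIn us s m x
            join (c , cs , pc , eqc , o) = c ∷ cs , (either s x xy (proj₁ pxb) o , pc) ,
              (λ v → lin (b2n (v == x) ∷ b2n (v == c) ∷ # v cs ∷ # v us ∷ b2n (v == y) ∷ # v (as ++ x ∷ b ∷ bs) ∷ # v
                  as ∷ b2n (v == b) ∷ # v bs ∷ # v (as ++ b ∷ bs) ∷ []) (x₄ ⊕ x₅ ⊑ x₃ ⊢ x₆ ⊕ (x₀ ⊕ (x₇ ⊕ x₈)) ⊑ x₅
                  ⊢ x₉ ⊑ x₆ ⊕ (x₇ ⊕ x₈) ⊢ x₁ ⊕ x₂ ⊑ x₄ ⊕ x₉ ⊢ ⊩ x₀ ⊕ (x₁ ⊕ x₂) ⊑ x₃)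
                  refl (sb v) (≥-reflexive (cnt-++ (v ==_) as (x ∷ b ∷ bs)))
                  (≤-reflexive (cnt-++ (v ==_) as (b ∷ bs))) (≤-reflexive (eqc (v ==_)))) ,
              lin (m ∷ length cs ∷ length (as ++ x ∷ b ∷ bs) ∷ length as ∷ length bs ∷ length (as ++ b ∷ bs) ∷ [])
                  (x₀ ⊑ x₂ ⊢ x₂ ⊑ x₃ ⊕ (con 2 ⊕ x₄) ⊢ x₃ ⊕ (con 1 ⊕ x₄) ⊑ x₅ ⊢ con 1 ⊕ x₅ ⊑ con 1 ⊕ x₁
                  ⊢ ⊩ x₀ ⊑ con 1 ⊕ x₁) refl l (≤-reflexive (length-++ as {x ∷ b ∷ bs}))
                  (≥-reflexive (length-++ as {b ∷ bs})) (≥-reflexive (≈-length (c ∷ cs) (y ∷ as ++ b ∷ bs) eqc))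

      path-snoc : ∀ x p π → Path s p π → (∀ u → u ∈ (p ∷ π) → E s u x ≡ true) → Path s p (π ++ x ∷ [])
      path-snoc x p [] _ h = h p (∈-here p []) , tt
      path-snoc x p (q ∷ π) (t , r) h = t , path-snoc x q π r λ u m → h u (∈-there p (q ∷ π) m)

      module Arc (us : List V) (x y : V) (R : Ready us (length W)) (xy : E s x y ≡ true) (V′ : List V)
          (eq : us ≈ (x ∷ y ∷ V′))
        (p₁ p₂ : V) (π : List V) (xp₁ : E s x p₁ ≡ true) (p₁p₂ : E s p₁ p₂ ≡ true) (path : Path s p₂ π)
        (sub : (x ∷ p₁ ∷ p₂ ∷ π) ⊆ us) (enough : lead s (s ∷ w) ≤ suc (length π)) where

        len : 2 + length V′ ≡ length us
        len = sym (≈-length us (x ∷ y ∷ V′) eq)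

        eqY : us ≈ (y ∷ x ∷ V′)
        eqY = ≈-trans us (x ∷ y ∷ V′) (y ∷ x ∷ V′) eq (λ p → ≤-antisym
            (lin (b2n (p x) ∷ b2n (p y) ∷ cnt p V′ ∷ []) (⊩ x₀ ⊕ (x₁ ⊕ x₂) ⊑ x₁ ⊕ (x₀ ⊕ x₂)) refl)
            (lin (b2n (p y) ∷ b2n (p x) ∷ cnt p V′ ∷ []) (⊩ x₀ ⊕ (x₁ ⊕ x₂) ⊑ x₁ ⊕ (x₀ ⊕ x₂)) refl))

        uqX : Uniq (x ∷ y ∷ V′)
        uqX v = ≤-trans (≤-reflexive (sym (eq (v ==_)))) (uniq R v)

        x∉V : # x V′ ≡ 0
        x∉V = n≤0⇒n≡0 (lin (# x V′ ∷ b2n (x == y) ∷ []) (x₁ ⊕ x₀ ⊑ con 0 ⊢ ⊩ x₀ ⊑ con 0)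
            refl (≤-reflexive (Uniq-head x (y ∷ V′) uqX)))

        R₁ : Ready (y ∷ V′) (suc (length w))
        R₁ = ready-⊆ (y ∷ V′) _ R (λ v → lin (b2n (v == y) ∷ # v V′ ∷ # v us ∷ b2n (v == x) ∷ [])
            (x₃ ⊕ (x₀ ⊕ x₁) ⊑ x₂ ⊢ ⊩ x₀ ⊕ x₁ ⊑ x₂) refl (≥-reflexive (eq (v ==_))))
            (lin (length w ∷ length V′ ∷ length us ∷ []) (con 5 ⊕ x₀ ⊑ x₂ ⊢ x₂ ⊑ con 2 ⊕ x₁
            ⊢ ⊩ con 4 ⊕ x₀ ⊑ con 1 ⊕ x₁) refl (room′ R) (≥-reflexive len))

        R₂ : Ready (x ∷ V′) (suc (length w))
        R₂ = ready-⊆ (x ∷ V′) _ R (λ v → lin (b2n (v == x) ∷ # v V′ ∷ # v us ∷ b2n (v == y) ∷ [])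
            (x₀ ⊕ (x₃ ⊕ x₁) ⊑ x₂ ⊢ ⊩ x₀ ⊕ x₁ ⊑ x₂) refl (≥-reflexive (eq (v ==_))))
            (lin (length w ∷ length V′ ∷ length us ∷ []) (con 5 ⊕ x₀ ⊑ x₂ ⊢ x₂ ⊑ con 2 ⊕ x₁
            ⊢ ⊩ con 4 ⊕ x₀ ⊑ con 1 ⊕ x₁) refl (room′ R) (≥-reflexive len))

        viaX : ∀ z → E s x z ≡ true → Route (y ∷ V′) (s ∷ w) z → Result us W x y
        viaX z t ρ = inj₁ (prepend us (y ∷ V′) eq t ρ)

        viaY : ∀ z → E s y z ≡ true → Route (x ∷ V′) (s ∷ w) z → Result us W x y
        viaY z t ρ = inj₂ (prepend us (x ∷ V′) eqY t ρ)

        sub₁ : (p₁ ∷ p₂ ∷ π) ⊆ (y ∷ V′)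
        sub₁ v = lin (b2n (v == p₁) ∷ b2n (v == p₂) ∷ # v π ∷ b2n (v == y) ∷ # v V′ ∷ b2n (v == x) ∷ # v us ∷ [])
            (x₅ ⊕ (x₀ ⊕ (x₁ ⊕ x₂)) ⊑ x₆ ⊢ x₆ ⊑ x₅ ⊕ (x₃ ⊕ x₄) ⊢ ⊩ x₀ ⊕ (x₁ ⊕ x₂) ⊑ x₃ ⊕ x₄)
            refl (sub v) (≤-reflexive (eq (v ==_)))

        pairX : ∀ u → u ∈ (y ∷ V′) → E s x u ≡ true → p₁ ≢ u → Result us W x y
        pairX u m t ne = go (IH (y ∷ V′) p₁ u R₁ (≤-trans (∈-here p₁ (p₂ ∷ π)) (sub₁ p₁)) m ne
            (inj₁ (p₂ ∷ π , (p₁p₂ , path) , sub₁ , enough)))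
          where
          go : Result (y ∷ V′) (s ∷ w) p₁ u → Result us W x y
          go (inj₁ ρ) = viaX p₁ xp₁ ρ
          go (inj₂ ρ) = viaX u t ρ

        module _ (p₁≡y : p₁ ≡ y) (none : ∀ u → u ∈ V′ → E s x u ≡ false) where

          yp₂ : E s y p₂ ≡ true
          yp₂ = subst (λ q → E s q p₂ ≡ true) p₁≡y p₁p₂

          sub₂ : (p₂ ∷ π) ⊆ V′
          sub₂ v = lin (b2n (v == p₂) ∷ # v π ∷ # v V′ ∷ b2n (v == p₁) ∷ b2n (v == y) ∷ []) (x₃ ⊕ (x₀ ⊕ x₁) ⊑ x₄ ⊕ x₂
              ⊢ x₄ ⊑ x₃ ⊢ ⊩ x₀ ⊕ x₁ ⊑ x₂) refl (sub₁ v) (≥-reflexive (cong (λ q → b2n (v == q)) p₁≡y))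

          to-x : ∀ u → u ∈ V′ → E s u x ≡ true
          to-x u m = trans (E-tot s u x λ p → ∉-≢ V′ x∉V m (sym p)) (cong not (none u m))

          -- Every vertex of `V′` precedes `x`, so `x` can be appended at the end. This makes up for
          -- the vertex lost at the front by starting at `p₂` instead of `p₁`.
          π′ : List V
          π′ = π ++ x ∷ []

          path′ : Path s p₂ π′
          path′ = path-snoc x p₂ π path λ u m → to-x u (≤-trans m (sub₂ u))

          sub′ : (p₂ ∷ π′) ⊆ (x ∷ V′)
          sub′ v = lin (b2n (v == p₂) ∷ # v π′ ∷ b2n (v == x) ∷ # v V′ ∷ # v π ∷ []) (x₀ ⊕ x₄ ⊑ x₃
              ⊢ x₁ ⊑ x₄ ⊕ (x₂ ⊕ con 0) ⊢ ⊩ x₀ ⊕ x₁ ⊑ x₂ ⊕ x₃) refl (sub₂ v) (≤-reflexive (cnt-++ (v ==_) π (x ∷ [])))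

          m₂ : p₂ ∈ V′
          m₂ = ≤-trans (∈-here p₂ π) (sub₂ p₂)

          lead′ : LeadPath (x ∷ V′) s (s ∷ w) p₂
          lead′ = π′ , path′ , sub′ , lin (lead s (s ∷ w) ∷ length π′ ∷ length π ∷ []) (x₀ ⊑ con 1 ⊕ x₂
              ⊢ x₂ ⊕ con 1 ⊑ x₁ ⊢ ⊩ x₀ ⊑ x₁) refl enough (≥-reflexive (length-++ π {x ∷ []}))

          pairY : ∀ u → u ∈ V′ → E s y u ≡ true → p₂ ≢ u → Result us W x y
          pairY u m t ne = go (IH (x ∷ V′) p₂ u R₂ (∈-there x V′ m₂) (∈-there x V′ m) ne (inj₁ lead′))
            where
            go : Result (x ∷ V′) (s ∷ w) p₂ u → Result us W x y
            go (inj₁ ρ) = viaY p₂ yp₂ ρ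
            go (inj₂ ρ) = viaY u t ρ

          -- x has no E s-neighbour in V′, so a route from x would have to leave for the zone at once.
          lastResort : Result us W x y
          lastResort = go (IH (x ∷ V′) p₂ x R₂ (∈-there x V′ m₂) (∈-here x V′) (λ p → ∉-≢ V′ x∉V m₂ (sym p))
              (inj₁ lead′))
            where
            base : ∀ v → w ≡ not s ∷ v → length v ≤ 1 → Tail s p₂ (not s ∷ v) ⊎ Tail (not s) p₂ v → Result us W x y
            base v refl l (inj₁ (es , z , wk , sb , few)) = viaY p₂ yp₂
              (mkRoute [] es z wk (single p₂ (x ∷ V′) (∈-there x V′ m₂)) sb few (λ _ → s , v , refl , l))
            base v refl l (inj₂ (es , z , wk , sb , few)) = viaX y xy
              (mkRoute (p₂ ∷ []) es z (step yp₂ wk) sub₁″ sb few λ ())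
              where
              sub₁″ : (y ∷ p₂ ∷ []) ⊆ (y ∷ V′)
              sub₁″ v = lin (b2n (v == y) ∷ b2n (v == p₂) ∷ # v V′ ∷ # v π ∷ []) (x₁ ⊕ x₃ ⊑ x₂
                  ⊢ ⊩ x₀ ⊕ (x₁ ⊕ con 0) ⊑ x₀ ⊕ x₂) refl (sub₂ v)
            go : Result (x ∷ V′) (s ∷ w) p₂ x → Result us W x y
            go (inj₁ ρ) = viaY p₂ yp₂ ρ
            go (inj₂ (mkRoute (v ∷ vs) es z (step t wk) inside zone few exit)) =
              ⊥-elim (true≢false t (none v (lin (# v V′ ∷ b2n (v == x) ∷ b2n (v == v) ∷ # v vs ∷ [])
                  (x₁ ⊕ (x₂ ⊕ x₃) ⊑ x₁ ⊕ x₀ ⊢ con 1 ⊑ x₂ ⊢ ⊩ con 1 ⊑ x₀)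
                  refl (inside v) (≥-reflexive (cong b2n (==-refl v))))))
            -- The remaining word is so short that the route can leave from `p₂` instead of `x`,
            -- preceded by `y` alone or by `x` and `y`.
            go (inj₂ (mkRoute [] es z wk inside zone few exit)) with exit refl
            ... | s′ , v , refl , l = base v
                refl l (leave s v p₂ et l (apart R p₂
                (≤-trans (∈-there x (p₁ ∷ p₂ ∷ π) (∈-there p₁ (p₂ ∷ π) (∈-here p₂ π))) (sub p₂))))

          onlyY : Result us W x y
          onlyY = go (search? (λ u → E s y u ∧ not (p₂ == u)) V′)
            where
            notf : ∀ {u} → not (p₂ == u) ≡ true → p₂ ≢ u
            notf t refl = true≢false (==-refl p₂) (k t)
              where
              k : ∀ {b} → not b ≡ true → b ≡ false
              k {false} _ = refl
            go : (Σ[ u ∈ V ] (u ∈ V′) × ((E s y u ∧ not (p₂ == u)) ≡ true)) ⊎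
                (∀ u → u ∈ V′ → (E s y u ∧ not (p₂ == u)) ≡ false) → Result us W x y
            go (inj₁ (u , m , t)) = let a , b = ∧-true (E s y u) (not (p₂ == u)) t in pairY u m a (notf b)
            go (inj₂ _) = lastResort

        result : Result us W x y
        result = go (p₁ ≟ y)
          where
          go : Dec (p₁ ≡ y) → Result us W x y
          go (no n) = pairX y (∈-here y V′) xy n
          go (yes q) = go′ (search? (E s x) V′)
            where
            go′ : (Σ[ u ∈ V ] (u ∈ V′) × (E s x u ≡ true)) ⊎ (∀ u → u ∈ V′ → E s x u ≡ false) → Result us W x y
            go′ (inj₁ (u , m , t)) = pairX u (∈-there y V′ m) t λ p →
              ∉-≢ V′ (Uniq-head y V′ (Uniq-tail x (y ∷ V′) uqX)) m (trans (sym q) p)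
            go′ (inj₂ none) = onlyY q none

      step-run : RouteFor W
      step-run us x y R mx my ne st = go (E-or s x y ne)
        where
        m : ℕ
        m = lead s W
        orient : ∀ x y → x ∈ us → y ∈ us → x ≢ y → E s x y ≡ true → PathIn us s m x ⊎ PathIn us s m y
            → PathIn us s m x
        orient x y mx my ne xy (inj₁ p) = p
        orient x y mx my ne xy (inj₂ p) = reroute us x y m (uniq R) mx my ne xy p
        lead2 : ∀ {n} → m ≤ n → 2 + lead s w ≤ n
        lead2 l = ≤-trans (≤-reflexive (sym (trans (lead-same s (s ∷ w)) (cong suc (lead-same s w))))) l
        from : ∀ x y → E s x y ≡ true → Pair us x y → PathIn us s m x → Result us W x y
        from x y t (V′ , eq) (p₁ ∷ p₂ ∷ π , (xp₁ , p₁p₂ , p) , sb , l) =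
          Arc.result us x y R t V′ eq p₁ p₂ π xp₁ p₁p₂ p sb (≤-trans (≤-reflexive (lead-same s w)) (≤-pred (lead2 l)))
        from x y t (V′ , eq) ([] , p , sb , l) = ⊥-elim (1≰0 (≤-trans (s≤s z≤n) (lead2 l)))
        from x y t (V′ , eq) (p₁ ∷ [] , p , sb , l) = ⊥-elim (1≰0 (≤-pred (≤-trans (s≤s (s≤s z≤n)) (lead2 l))))
        go : E s x y ≡ true ⊎ E (not s) x y ≡ true → Result us W x y
        go (inj₁ t) = from x y t (pair us x y mx my ne) (orient x y mx my ne t st)
        go (inj₂ t) = let t′ = E-flip s x y t
                          ne′ = λ p → ne (sym p) in
          swap (from y x t′ (pair us y x my mx ne′) (orient y x my mx ne′ t′ (swap st)))

    run-tail : ∀ s t w → t ≡ s → EndsTurn (s ∷ t ∷ w) → EndsTurn (t ∷ w)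
    run-tail true .false .[] () (turn .true)
    run-tail false .true .[] () (turn .false)
    run-tail s t w eq (.s ∷ et) = et

    -- A step drops one letter in a run and one or two at a turn, hence the recursion on a bound
    -- `n`. The base words open with a turn and have two or three letters; there the zone is
    -- entered.
    route : ∀ n w → length w ≤ n → EndsTurn w → RouteFor w
    route zero [] _ ()
    route (suc n) (s ∷ []) l (.s ∷ ())
    route (suc n) (s ∷ t ∷ w) (s≤s l) et with same? s t
    route (suc n) (s ∷ .s ∷ w) (s≤s l) et | inj₁ refl = RunStep.step-run s w et′ (route n (s ∷ w) l et′)
      where et′ = run-tail s s w refl et
    route (suc n) (s ∷ .(not s) ∷ []) (s≤s l) et | inj₂ refl = base
      where
      base : RouteFor (s ∷ not s ∷ [])
      base us x y R mx my ne _ = go (E-or s x y ne)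
        where
        go : E s x y ≡ true ⊎ E (not s) x y ≡ true → Result us (s ∷ not s ∷ []) x y
        go (inj₁ t) = route-base s [] us x y et z≤n (apart R y my) mx my ne t
        go (inj₂ t) = swap (route-base s [] us y x et z≤n (apart R x mx) my mx (λ p → ne (sym p)) (E-flip s x y t))
    route (suc n) (s ∷ .(not s) ∷ r ∷ []) (s≤s l) et | inj₂ refl = base
      where
      base : RouteFor (s ∷ not s ∷ r ∷ [])
      base us x y R mx my ne _ = go (E-or s x y ne)
        where
        go : E s x y ≡ true ⊎ E (not s) x y ≡ true → Result us (s ∷ not s ∷ r ∷ []) x y
        go (inj₁ t) = route-base s (r ∷ []) us x y et ≤-refl (apart R y my) mx my ne t
        go (inj₂ t) = swap (route-base s (r ∷ []) us y x et ≤-refl (apart R x mx) my mx (λ p → ne (sym p))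
            (E-flip s x y t))
    route (suc (suc n)) (s ∷ .(not s) ∷ r ∷ r′ ∷ w) (s≤s l) (_ ∷ et@(_ ∷ et′)) | inj₂ refl =
      TurnStep.step-turn s r (r′ ∷ w) (route (suc n) (not s ∷ r ∷ r′ ∷ w) l et) (route n (r ∷ r′ ∷ w) (≤-pred l) et′)

-- Placing a core leaf by leaf in a small window.

module Windows {V : Set} (_≟_ : DecidableEquality V) (e : V → V → Bool) (tot : ∀ u v → u ≢ v → e u v ≡ not (e v u))
    where
  open Counting _≟_
  open MedianOrder _≟_ e tot

  cut-suffix : ∀ k (xs : List V) → k ≤ length xs → Σ[ ys ∈ List V ] Σ[ zs ∈ List V ] (xs ≡ ys ++ zs) × (length zs ≡ k)
  cut-suffix k [] z≤n = [] , [] , refl , refl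
  cut-suffix k (x ∷ xs) l with m≤n⇒m<n∨m≡n l
  ... | inj₂ refl = [] , x ∷ xs , refl , refl
  ... | inj₁ l′ with cut-suffix k xs (≤-pred l′)
  ...   | ys , zs , refl , q = x ∷ ys , zs , refl , q

  placed : List V → List V → ℕ
  placed us xs = cnt (member us) xs

  -- The placed vertices fill at most half of every suffix they meet, even after r more placements.
  Inv : ℕ → List V → List V → Set
  Inv r us [] = ⊤
  Inv r us (x ∷ xs) = ((placed us (x ∷ xs) ≡ 0) ⊎ (2 * placed us (x ∷ xs) + 2 * r ≤ 1 + length (x ∷ xs)))
      × Inv r us xs

  inv-empty : ∀ r xs → Inv r [] xs
  inv-empty r [] = tt
  inv-empty r (x ∷ xs) = inj₁ (cnt-zero (member []) (x ∷ xs) λ _ _ → refl) , inv-empty r xs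

  inv-suffix : ∀ r us xs ys → Inv r us (xs ++ ys) → Inv r us ys
  inv-suffix r us [] ys h = h
  inv-suffix r us (x ∷ xs) ys (_ , h) = inv-suffix r us xs ys h

  member-∷ : ∀ v us x → b2n (member (v ∷ us) x) ≤ b2n (v == x) + b2n (member us x)
  member-∷ v us x with x ≟ v
  ... | no _ = m≤n+m _ _
  ... | yes refl rewrite ==-refl x = s≤s z≤n

  placed-∷ : ∀ v us xs → placed (v ∷ us) xs ≤ # v xs + placed us xs
  placed-∷ v us xs = cnt-le (member (v ∷ us)) (v ==_) (member us) xs λ x _ → member-∷ v us x

  inv-weaken : ∀ r us v xs → # v xs ≡ 0 → Inv (suc r) us xs → Inv r (v ∷ us) xs
  inv-weaken r us v [] z h = tt
  inv-weaken r us v (x ∷ xs) z (h , h′) = go h , inv-weaken r us v xs (n≤0⇒n≡0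
      (lin (# v xs ∷ b2n (v == x) ∷ []) (x₁ ⊕ x₀ ⊑ con 0 ⊢ ⊩ x₀ ⊑ con 0) refl (≤-reflexive z))) h′
    where
    go : (placed us (x ∷ xs) ≡ 0) ⊎ (2 * placed us (x ∷ xs) + 2 * suc r ≤ 1 + length (x ∷ xs)) →
      (placed (v ∷ us) (x ∷ xs) ≡ 0) ⊎ (2 * placed (v ∷ us) (x ∷ xs) + 2 * r ≤ 1 + length (x ∷ xs))
    go (inj₁ p) = inj₁ (n≤0⇒n≡0 (≤-trans (placed-∷ v us (x ∷ xs)) (≤-reflexive (cong₂ _+_ z p))))
    go (inj₂ p) = inj₂ (lin (b2n ((x == v) ∨ member us x) ∷ cnt (λ v₁ → (v₁ ==_) v ∨ member us v₁) xs ∷ r ∷ length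
        xs ∷ b2n (member us x) ∷ cnt (member us) xs ∷ []) (2 ⊛ (x₄ ⊕ x₅) ⊕ 2 ⊛ (con 1 ⊕ x₂) ⊑ con 2 ⊕ x₃
        ⊢ x₀ ⊕ x₁ ⊕ 1 ⊛ (x₀ ⊕ x₁) ⊑ x₄ ⊕ x₅ ⊕ 1 ⊛ (x₄ ⊕ x₅) ⊢ 2 ⊛ (con 1 ⊕ x₂) ⊑ con 2 ⊕ 2 ⊛ x₂
        ⊢ ⊩ 2 ⊛ (x₀ ⊕ x₁) ⊕ 2 ⊛ x₂ ⊑ con 2 ⊕ x₃)
        refl p (*-monoʳ-≤ 2 (≤-trans (placed-∷ v us (x ∷ xs)) (≤-reflexive (cong (_+ placed us (x ∷ xs)) z))))
        (≤-reflexive (*-suc 2 r)))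

  -- A suffix that already met a placed vertex gains one more, which the drop from `suc r` to `r`
  -- pays for. A suffix that met none needs `2 * r` vertices after `v`, unless a vertex placed
  -- behind `v` excludes this case.
  inv-add : ∀ r us v xs ys → Uniq (xs ++ v ∷ ys) → (2 * r ≤ length ys) ⊎ (1 ≤ placed us ys) →
    Inv (suc r) us (xs ++ v ∷ ys) → Inv r (v ∷ us) (xs ++ v ∷ ys)
  inv-add r us v [] ys u q (h , h′) = go q h , inv-weaken r us v ys (Uniq-head v ys u) h′
    where
    go : (2 * r ≤ length ys) ⊎ (1 ≤ placed us ys) → (placed us (v ∷ ys) ≡ 0) ⊎
        (2 * placed us (v ∷ ys) + 2 * suc r ≤ 1 + length (v ∷ ys)) →
      (placed (v ∷ us) (v ∷ ys) ≡ 0) ⊎ (2 * placed (v ∷ us) (v ∷ ys) + 2 * r ≤ 1 + length (v ∷ ys))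
    go (inj₁ l) (inj₁ p) = inj₂ (lin (b2n ((v == v) ∨ member us v) ∷ cnt (λ v₁ → (v₁ ==_) v ∨ member us v₁)
        ys ∷ r ∷ length ys ∷ []) (2 ⊛ x₂ ⊑ x₃ ⊢ x₀ ⊕ x₁ ⊕ 1 ⊛ (x₀ ⊕ x₁) ⊑ con 2
        ⊢ ⊩ 2 ⊛ (x₀ ⊕ x₁) ⊕ 2 ⊛ x₂ ⊑ con 2 ⊕ x₃)
        refl l (*-monoʳ-≤ 2 (≤-trans (placed-∷ v us (v ∷ ys)) (+-mono-≤ (u v) (≤-reflexive p)))))
    go (inj₂ l) (inj₁ p) = ⊥-elim (1≰0 (≤-trans l (≤-trans (m≤n+m _ (b2n (member us v))) (≤-reflexive p))))
    go _ (inj₂ p) = inj₂ (lin (b2n ((v == v) ∨ member us v) ∷ cnt (λ v₁ → (v₁ ==_) v ∨ member us v₁) ys ∷ r ∷ length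
        ys ∷ b2n (member us v) ∷ cnt (member us) ys ∷ []) (2 ⊛ (x₄ ⊕ x₅) ⊕ 2 ⊛ (con 1 ⊕ x₂) ⊑ con 2 ⊕ x₃
        ⊢ x₀ ⊕ x₁ ⊕ 1 ⊛ (x₀ ⊕ x₁) ⊑ con 1 ⊕ (x₄ ⊕ x₅ ⊕ 1 ⊛ (con 1 ⊕ (x₄ ⊕ x₅))) ⊢ 2 ⊛ (con 1 ⊕ x₂) ⊑ con 2 ⊕ 2 ⊛ x₂
        ⊢ ⊩ 2 ⊛ (x₀ ⊕ x₁) ⊕ 2 ⊛ x₂ ⊑ con 2 ⊕ x₃)
        refl p (*-monoʳ-≤ 2 (≤-trans (placed-∷ v us (v ∷ ys)) (+-monoˡ-≤ _ (u v)))) (≤-reflexive (*-suc 2 r)))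
  inv-add r us v (x ∷ xs) ys u q (h , h′) = go q h , inv-add r us v xs ys (Uniq-tail x (xs ++ v ∷ ys) u) q h′
    where
    X = x ∷ xs ++ v ∷ ys
    long : 2 + length ys ≤ length X
    long = s≤s (≤-trans (m≤n+m _ (length xs)) (≤-reflexive (sym (length-++ xs))))
    has : placed us ys ≤ placed us X
    has = ≤-trans (≤-trans (m≤n+m _ (b2n (member us v)))
        (≤-trans (m≤n+m _ (placed us xs)) (≤-reflexive (sym (cnt-++ (member us) xs (v ∷ ys))))))
      (m≤n+m _ (b2n (member us x)))
    go : (2 * r ≤ length ys) ⊎ (1 ≤ placed us ys) → (placed us X ≡ 0) ⊎ (2 * placed us X + 2 * suc r ≤ 1 + length X) →
      (placed (v ∷ us) X ≡ 0) ⊎ (2 * placed (v ∷ us) X + 2 * r ≤ 1 + length X)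
    go (inj₁ l) (inj₁ p) = inj₂ (≤-trans
        (+-mono-≤ (*-monoʳ-≤ 2 (≤-trans (placed-∷ v us X) (+-mono-≤ (u v) (≤-reflexive p)))) l)
      (≤-trans long (n≤1+n _)))
    go (inj₂ l) (inj₁ p) = ⊥-elim (1≰0 (≤-trans l (≤-trans has (≤-reflexive p))))
    go _ (inj₂ p) = inj₂ (≤-trans (+-monoˡ-≤ (2 * r) (*-monoʳ-≤ 2 (≤-trans (placed-∷ v us X) (+-monoˡ-≤ _ (u v)))))
      (≤-trans (≤-reflexive (trans (cong (_+ 2 * r) (*-suc 2 (placed us X)))
          (trans (cong (_+ 2 * r) (+-comm 2 (2 * placed us X)))
        (trans (+-assoc (2 * placed us X) 2 (2 * r)) (cong (2 * placed us X +_) (sym (*-suc 2 r))))))) p))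

  -- One order in its two readings, so that out-leaves and in-leaves are placed by the same
  -- argument.
  record Window (r : ℕ) (us : List V) : Set where
    field
      M : Bool → List V
      flip : ∀ s → M (not s) ≡ reverse (M s)
      half : ∀ s → Half s (M s)
      uniq : Uniq (M true)
      inv : ∀ s → Inv r us (M s)
      inside : us ⊆ M true

  open Window

  M≈ : ∀ {r us} (S : Window r us) s → M S s ≈ M S true
  M≈ S true = ≈-refl (M S true)
  M≈ S false p = trans (cong (cnt p) (flip S true)) (cnt-reverse p (M S true))

  reverse-middle : ∀ (xs : List V) v ys → reverse (xs ++ v ∷ ys) ≡ reverse ys ++ v ∷ reverse xs
  reverse-middle xs v ys = trans (reverse-++ xs (v ∷ ys)) (trans (cong (_++ reverse xs) (unfold-reverse v ys))
    (++-assoc (reverse ys) (v ∷ []) (reverse xs)))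

  Placement : ∀ {r us} → Window (suc r) us → Bool → V → Set
  Placement {r} {us} S s u = Σ[ v ∈ V ] (E s u v ≡ true) × (# v us ≡ 0)
      × (Σ[ S′ ∈ Window r (v ∷ us) ] M S′ true ≡ M S true)

  -- The last `2 * r` vertices are set aside. At least half of the vertices between `u` and them
  -- succeed `u`, while by the invariant fewer than half are taken. Afterwards the invariant holds
  -- in this reading thanks to the vertices set aside, and in the other one because `u`, placed
  -- already, lies behind `v`.
  place : ∀ {r us} (S : Window (suc r) us) s u → u ∈ us → Placement S s u
  place {r} {us} S s u mu = split
      (∈-split (M S s) (≤-trans (≤-trans mu (inside S u)) (≤-reflexive (sym (M≈ S s (u ==_))))))
    where
    uq : Uniq (M S s)
    uq v = ≤-trans (≤-reflexive (M≈ S s (v ==_))) (uniq S v)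
    split : (Σ[ I ∈ List V ] Σ[ J ∈ List V ] (M S s ≡ I ++ u ∷ J)) → Placement S s u
    split (I , J , eqM) = go (proj₁ (inv-suffix (suc r) us I (u ∷ J) (subst (Inv (suc r) us) eqM (inv S s))))
      where
      halfJ : Half s (u ∷ J)
      halfJ = Half-drop s I (u ∷ J) (subst (Half s) eqM (half S s))
      mem-u : b2n (member us u) ≡ 1
      mem-u = cong b2n (member-complete us u mu)
      go : (placed us (u ∷ J) ≡ 0) ⊎ (2 * placed us (u ∷ J) + 2 * suc r ≤ 1 + length (u ∷ J)) → Placement S s u
      go (inj₁ z) = ⊥-elim (1≰0 (lin (b2n (member us u) ∷ cnt (member us) J ∷ []) (x₀ ⊕ x₁ ⊑ con 0 ⊢ con 1 ⊑ x₀
          ⊢ ⊩ con 1 ⊑ con 0) refl (≤-reflexive z) (≥-reflexive mem-u)))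
      go (inj₂ l) = cutTail (cut-suffix (2 * r) J
          (lin (r ∷ length J ∷ b2n (member us u) ∷ cnt (member us) J ∷ [])
          (2 ⊛ (x₂ ⊕ x₃) ⊕ 2 ⊛ (con 1 ⊕ x₀) ⊑ con 2 ⊕ x₁ ⊢ 2 ⊛ (con 1 ⊕ x₀) ⊑ con 2 ⊕ 2 ⊛ x₀ ⊢ ⊩ 2 ⊛ x₀ ⊑ x₁)
          refl l (≤-reflexive (*-suc 2 r))))
        where
        cutTail : (Σ[ J° ∈ List V ] Σ[ T ∈ List V ] (J ≡ J° ++ T) × (length T ≡ 2 * r)) → Placement S s u
        cutTail (J° , T , refl , lenT) = found (cnt-exists (E s u) (member us) J° (*-cancelˡ-≤ 2
            (lin (cnt (member us) J° ∷ cnt (E s u) J° ∷ b2n (member us u) ∷ cnt (member us) (J° ++ T) ∷ r ∷ length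
            (J° ++ T) ∷ cnt (member us) T ∷ length J° ∷ length T ∷ []) (2 ⊛ (x₂ ⊕ x₃) ⊕ 2 ⊛ (con 1 ⊕ x₄) ⊑ con 2 ⊕ x₅
            ⊢ 2 ⊛ (con 1 ⊕ x₄) ⊑ con 2 ⊕ 2 ⊛ x₄ ⊢ con 2 ⊑ x₂ ⊕ 1 ⊛ x₂ ⊢ x₀ ⊕ x₆ ⊕ 1 ⊛ (x₀ ⊕ x₆) ⊑ x₃ ⊕ 1 ⊛ x₃
            ⊢ x₅ ⊑ x₇ ⊕ x₈ ⊢ x₈ ⊑ 2 ⊛ x₄ ⊢ x₇ ⊑ 2 ⊛ x₁ ⊢ ⊩ 2 ⊛ (con 1 ⊕ x₀) ⊑ 2 ⊛ x₁)
            refl l (≤-reflexive (*-suc 2 r)) (*-monoʳ-≤ 2 (≤-reflexive (sym mem-u)))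
            (*-monoʳ-≤ 2 (≤-reflexive (sym (cnt-++ (member us) J° T)))) (≤-reflexive (length-++ J° {T}))
            (≤-reflexive lenT) (proj₁ halfJ J° T refl))))
          where
          found : (Σ[ v ∈ V ] (v ∈ J°) × (E s u v ≡ true) × (member us v ≡ false)) → Placement S s u
          found (v , mv , t , f) = finish (∈-split J° mv)
            where
            v∉ : # v us ≡ 0
            v∉ = nonmember us v f
            finish : (Σ[ P ∈ List V ] Σ[ Q ∈ List V ] (J° ≡ P ++ v ∷ Q)) → Placement S s u
            finish (P , Q , refl) = v , t , v∉ , record
              { M = M S ; flip = flip S ; half = half S ; uniq = uniq S ; inv = invs ; inside = ins } , refl
              where
              A₁ = I ++ u ∷ P
              B₁ = Q ++ T
              eq₁ : M S s ≡ A₁ ++ v ∷ B₁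
              eq₁ = trans eqM (trans (cong (λ l → I ++ u ∷ l) (++-assoc P (v ∷ Q) T))
                  (sym (++-assoc I (u ∷ P) (v ∷ Q ++ T))))
              eq₂ : M S (not s) ≡ reverse B₁ ++ v ∷ reverse A₁
              eq₂ = trans (flip S s) (trans (cong reverse eq₁) (reverse-middle A₁ v B₁))
              inv₁ : Inv r (v ∷ us) (M S s)
              inv₁ = subst (Inv r (v ∷ us)) (sym eq₁) (inv-add r us v A₁ B₁ (subst Uniq eq₁ uq)
                (inj₁ (≤-trans (≤-reflexive (sym lenT))
                    (≤-trans (m≤n+m _ (length Q)) (≤-reflexive (sym (length-++ Q))))))
                (subst (Inv (suc r) us) eq₁ (inv S s)))
              inv₂ : Inv r (v ∷ us) (M S (not s))
              inv₂ = subst (Inv r (v ∷ us)) (sym eq₂) (inv-add r us v (reverse B₁) (reverse A₁)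
                (subst Uniq eq₂ λ x → ≤-trans (≤-reflexive (M≈ S (not s) (x ==_))) (uniq S x))
                (inj₂ (≤-trans (∈-pred (member us) (member-complete us u mu) A₁ (∈-++ʳ I (u ∷ P) (∈-here u P)))
                  (≤-reflexive (sym (cnt-reverse (member us) A₁)))))
                (subst (Inv (suc r) us) eq₂ (inv S (not s))))
              invs : ∀ s′ → Inv r (v ∷ us) (M S s′)
              invs s′ = pick s s′ inv₁ inv₂
                where
                pick : ∀ s s′ → Inv r (v ∷ us) (M S s) → Inv r (v ∷ us) (M S (not s)) → Inv r (v ∷ us) (M S s′)
                pick true true a b = a
                pick true false a b = b
                pick false true a b = b
                pick false false a b = a
              ins : (v ∷ us) ⊆ M S true
              ins = cons-⊆ v us (M S true) v∉ (≤-trans (subst (v ∈_) (sym eq₁) (∈-++ʳ A₁ (v ∷ B₁) (∈-here v B₁)))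
                  (≤-reflexive (M≈ S s (v ==_)))) (inside S)

  -- The first vertex needs `2 * r` vertices on either side, which explains `1 + 4 * r`.
  window : ∀ r xs → Uniq xs → 1 + 4 * r ≤ length xs → Σ[ z ∈ V ] Σ[ S ∈ Window r (z ∷ []) ] (M S true ≈ xs)
  window r xs u l = go (median xs u)
    where
    go : (Σ[ ys ∈ List V ] (ys ≈ xs) × Half true ys × Half false (reverse ys))
        → Σ[ z ∈ V ] Σ[ S ∈ Window r (z ∷ []) ] (M S true ≈ xs)
    go (ys , eq , h₁ , h₂) = cut (cut-suffix (2 * r) ys
        (lin (r ∷ length ys ∷ length xs ∷ []) (con 1 ⊕ 4 ⊛ x₀ ⊑ x₂ ⊢ x₂ ⊑ x₁ ⊢ ⊩ 2 ⊛ x₀ ⊑ x₁)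
        refl l (≥-reflexive (≈-length ys xs eq))))
      where
      uy : Uniq ys
      uy v = ≤-trans (≤-reflexive (eq (v ==_))) (u v)
      cut : (Σ[ P ∈ List V ] Σ[ J ∈ List V ] (ys ≡ P ++ J) × (length J ≡ 2 * r))
          → Σ[ z ∈ V ] Σ[ S ∈ Window r (z ∷ []) ] (M S true ≈ xs)
      cut (P , J , refl , lenJ) = cut′ (cut-suffix 1 P
          (lin (length P ∷ r ∷ length xs ∷ length (P ++ J) ∷ length J ∷ []) (con 1 ⊕ 4 ⊛ x₁ ⊑ x₂ ⊢ x₂ ⊑ x₃
          ⊢ x₃ ⊑ x₀ ⊕ x₄ ⊢ x₄ ⊑ 2 ⊛ x₁ ⊢ ⊩ con 1 ⊑ x₀)
          refl l (≥-reflexive (≈-length ys xs eq)) (≤-reflexive (length-++ P {J})) (≤-reflexive lenJ)))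
        where
        cut′ : (Σ[ I ∈ List V ] Σ[ Z ∈ List V ] (P ≡ I ++ Z) × (length Z ≡ 1))
            → Σ[ z ∈ V ] Σ[ S ∈ Window r (z ∷ []) ] (M S true ≈ xs)
        cut′ (I , z ∷ [] , refl , _) = z , S , eq
          where
          ys₁ = (I ++ z ∷ []) ++ J
          eq₁ : ys₁ ≡ I ++ z ∷ J
          eq₁ = ++-assoc I (z ∷ []) J
          eq₂ : reverse ys₁ ≡ reverse J ++ z ∷ reverse I
          eq₂ = trans (cong reverse eq₁) (reverse-middle I z J)
          lenI : 2 * r ≤ length I
          lenI = lin (r ∷ length I ∷ length xs ∷ length ys₁ ∷ length (I ++ z ∷ []) ∷ length J ∷ [])
              (con 1 ⊕ 4 ⊛ x₀ ⊑ x₂ ⊢ x₂ ⊑ x₃ ⊢ x₃ ⊑ x₄ ⊕ x₅ ⊢ x₅ ⊑ 2 ⊛ x₀ ⊢ x₄ ⊑ x₁ ⊕ con 1 ⊢ ⊩ 2 ⊛ x₀ ⊑ x₁)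
              refl l (≥-reflexive (≈-length ys₁ xs eq)) (≤-reflexive (length-++ (I ++ z ∷ []) {J}))
              (≤-reflexive lenJ) (≤-reflexive (length-++ I {z ∷ []}))
          S : Window r (z ∷ [])
          S = record { M = λ { true → ys₁ ; false → reverse ys₁ }
              ; flip = λ { true → refl ; false → sym (reverse-involutive ys₁) }
            ; half = λ { true → h₁ ; false → h₂ } ; uniq = uy
            ; inv = λ { true → subst (Inv r (z ∷ [])) (sym eq₁)
                (inv-add r [] z I J (subst Uniq eq₁ uy) (inj₁ (≤-reflexive (sym lenJ)))
                (inv-empty (suc r) (I ++ z ∷ J)))
                      ; false → subst (Inv r (z ∷ [])) (sym eq₂) (inv-add r [] z (reverse J) (reverse I)
                          (subst Uniq eq₂ λ x → ≤-trans (≤-reflexive (cnt-reverse (x ==_) ys₁)) (uy x))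
                          (inj₁ (≤-trans lenI (≤-reflexive (sym (length-reverse I)))))
                              (inv-empty (suc r) (reverse J ++ z ∷ reverse I))) }
            ; inside = single z ys₁ (subst (z ∈_) (sym eq₁) (∈-++ʳ I (z ∷ J) (∈-here z J))) }

-- Copies of trees, candidate roots, and limbs that remain to be laid.

module Copies {V : Set} (_≟_ : DecidableEquality V) (e : V → V → Bool) (tot : ∀ u v → u ≢ v → e u v ≡ not (e v u))
    where
  open Counting _≟_
  open MedianOrder _≟_ e tot
  open Paths _≟_ e tot
  open Jumping _≟_ e tot
  open Routing _≟_ e tot
  open Windows _≟_ e tot
  open Trees

  mutual
    data Emb : Tree → V → Set where
      node : ∀ {ts r} → EmbF r ts → Emb (node ts) r

    data EmbF (r : V) : List (Bool × Tree) → Set where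
      []   : EmbF r []
      cons : ∀ {s t ts r′} → E s r r′ ≡ true → Emb t r′ → EmbF r ts → EmbF r ((s , t) ∷ ts)

  mutual
    verts : ∀ {t r} → Emb t r → List V
    verts {r = r} (node f) = r ∷ vertsF f

    vertsF : ∀ {r ts} → EmbF r ts → List V
    vertsF [] = []
    vertsF (cons _ em f) = verts em ++ vertsF f

  walk-emb : ∀ {x ys s w z t} → Walk x ys (s ∷ w) z → (em : Emb t z) → Σ[ f ∈ EmbF x (graft s w t ∷ []) ]
      (vertsF f ≈ (ys ++ verts em))
  walk-emb {w = []} (end t) em = cons t em [] , λ p → cong (cnt p) (++-identityʳ (verts em))
  walk-emb {x} {y ∷ ys} {s} {s′ ∷ w} {t = t₀} (step t wk) em = go (walk-emb wk em)
    where
    go : (Σ[ f ∈ EmbF y (graft s′ w t₀ ∷ []) ] (vertsF f ≈ (ys ++ verts em))) →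
      Σ[ f ∈ EmbF x (graft s (s′ ∷ w) t₀ ∷ []) ] (vertsF f ≈ (y ∷ ys ++ verts em))
    go (f , eq) = cons t (node f) [] , λ p → trans (cong (cnt p) (++-identityʳ (y ∷ vertsF f)))
        (cong (b2n (p y) +_) (eq p))

  record Med (o : Bool) (xs : List V) : Set where
    constructor med
    field
      ahead  : Half o xs
      behind : Half (not o) (reverse xs)
  open Med

  med-take : ∀ o xs ys → Med o (xs ++ ys) → Med o xs
  med-take o xs ys (med h k) = med (Half-take o xs ys h)
      (Half-drop (not o) (reverse ys) (reverse xs) (subst (Half (not o)) (reverse-++ xs ys) k))

  med-drop : ∀ o xs ys → Med o (xs ++ ys) → Med o ys
  med-drop o xs ys (med h k) = med (Half-drop o xs ys h)
      (Half-take (not o) (reverse ys) (reverse xs) (subst (Half (not o)) (reverse-++ xs ys) k))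

  med-reverse : ∀ o xs → Med o xs → Med (not o) (reverse xs)
  med-reverse o xs (med h k) = med k (subst₂ Half (sym (not-not o)) (sym (reverse-involutive xs)) h)
    where
    not-not : ∀ b → not (not b) ≡ b
    not-not true = refl
    not-not false = refl

  -- The root z is fixed before the vertices es that lead to it, and the copy is completed only afterwards;
  -- S lists the vertices which es must not touch.
  record Candidate (t : Tree) (xs : List V) (A : V → Bool) (z : V) : Set where
    field
      S : List V
      root : z ∈ S
      S⊆ : S ⊆ xs
      S-free : ∀ u → u ∈ S → A u ≡ false
      ps qs : List V
      at : xs ≡ ps ++ z ∷ qs
      sparse : 20 + 10 * (cnt A ps + length S) ≤ length ps
      embed : ∀ es → length es ≤ 2 → (∀ u → u ∈ es → # u S ≡ 0) →
        Σ[ em ∈ Emb t z ] (verts em ⊆ xs) × (∀ u → u ∈ verts em → (A u ≡ false) × (# u es ≡ 0))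

  -- A route may pass through two other members of the zone on its way to `z`, so these must not be
  -- reserved for the copy rooted at `z`.
  record Zoned (t : Tree) (xs : List V) (A : V → Bool) : Set where
    field
      zs : List V
      uniqᶻ : Uniq zs
      big : 7 ≤ length zs
      cand : ∀ z → z ∈ zs → Candidate t xs A z
      apart : ∀ z (m : z ∈ zs) u → u ∈ zs → u ≢ z → # u (Candidate.S (cand z m)) ≡ 0

  -- The induction needs any forbidden set, since a region contains vertices already in use, and
  -- both directions, since regions for in-paths are read backwards.
  Claim : Core → Set
  Claim c = ∀ o xs A → Med o xs → Uniq xs → Room (need c) A xs → Zoned (flat c) xs A

  -- A zigzag holds two neighbours `a` and `b` of its anchor, both along its first letter `d`:
  -- routing succeeds from one of them, but not from a prescribed one.
  data Item : Set where
    dirI : V → Bool → ℕ → (c : Core) → Claim c → Item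
    zigI : (u a b : V) (d s : Bool) (w : List Bool) → EndsTurn (s ∷ not s ∷ w) → (c : Core) → Claim c →
      E d u a ≡ true → E d u b ≡ true → Item

  anchor : Item → V
  anchor (dirI u _ _ _ _) = u
  anchor (zigI u _ _ _ _ _ _ _ _ _ _) = u

  spare : Item → List V
  spare (dirI _ _ _ _ _) = []
  spare (zigI _ a b _ _ _ _ _ _ _ _) = a ∷ b ∷ []

  limb : Item → Bool × Tree
  limb (dirI _ s m c _) = flatC (dir s m c)
  limb (zigI _ _ _ d s w et c _ _ _) = flatC (zig d s w et c)

  side : Item → Bool
  side (dirI _ s _ _ _) = s
  side (zigI _ _ _ _ _ _ _ _ _ _ _) = true

  needI : Item → ℕ
  needI (dirI _ _ m c _) = 1 + (m + need c)
  needI (zigI _ _ _ _ _ w _ c _ _ _) = 3 + length w + need c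

  Done : Item → List V → Set
  Done i rest = Σ[ f ∈ EmbF (anchor i) (limb i ∷ []) ] (vertsF f ⊆ (spare i ++ rest))

  AllDone : List Item → List V → Set
  AllDone [] rest = ⊤
  AllDone (i ∷ is) rest = Σ[ r₁ ∈ List V ] Σ[ r₂ ∈ List V ] Done i r₁ × AllDone is r₂ × ((r₁ ++ r₂) ⊆ rest)

  ItemOK : List V → Item → Set
  ItemOK us i = (anchor i ∈ us) × (∀ v → v ∈ spare i → v ∈ us) × Uniq (spare i)

  AllOK : List V → List Item → Set
  AllOK us [] = ⊤
  AllOK us (i ∷ is) = ItemOK us i × AllOK us is

  total : Bool → List Item → ℕ
  total σ [] = 0
  total σ (i ∷ is) = 40 + charge (side i) σ (needI i) + total σ is

  allOK-++ : ∀ us is js → AllOK us is → AllOK us js → AllOK us (is ++ js)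
  allOK-++ us [] js p q = q
  allOK-++ us (i ∷ is) js (p , ps) q = p , allOK-++ us is js ps q

  allOK-mono : ∀ us us′ is → (∀ v → v ∈ us → v ∈ us′) → AllOK us is → AllOK us′ is
  allOK-mono us us′ [] h p = tt
  allOK-mono us us′ (i ∷ is) h ((m , m′ , q) , p) = (h _ m , (λ v k → h v (m′ v k)) , q) , allOK-mono us us′ is h p

  total-++ : ∀ σ is js → total σ (is ++ js) ≡ total σ is + total σ js
  total-++ σ [] js = refl
  total-++ σ (i ∷ is) js = trans (cong (40 + charge (side i) σ (needI i) +_) (total-++ σ is js))
      (sym (+-assoc (40 + charge (side i) σ (needI i)) (total σ is) (total σ js)))

  Shared : List Item → List Item → List V → Set
  Shared is js rest = Σ[ r₁ ∈ List V ] Σ[ r₂ ∈ List V ] AllDone is r₁ × AllDone js r₂ × ((r₁ ++ r₂) ⊆ rest)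

  AllDone-++ : ∀ is js rest → AllDone (is ++ js) rest → Shared is js rest
  AllDone-++ [] js rest d = [] , rest , tt , d , λ v → ≤-refl
  AllDone-++ (i ∷ is) js rest (r₁ , r₂ , d , ds , sb) = go (AllDone-++ is js r₂ ds)
    where
    go : Shared is js r₂ → Shared (i ∷ is) js rest
    go (q₁ , q₂ , d₁ , d₂ , sb′) = r₁ ++ q₁ , q₂ , (r₁ , q₁ , d , d₁ , λ v → ≤-refl) , d₂ ,
      λ v → lin (# v ((r₁ ++ q₁) ++ q₂) ∷ # v rest ∷ # v (r₁ ++ r₂) ∷ # v (q₁ ++ q₂) ∷ # v r₂ ∷ # v (r₁ ++ q₁) ∷ # v
          q₂ ∷ # v r₁ ∷ # v q₁ ∷ []) (x₂ ⊑ x₁ ⊢ x₃ ⊑ x₄ ⊢ x₀ ⊑ x₅ ⊕ x₆ ⊢ x₅ ⊑ x₇ ⊕ x₈ ⊢ x₇ ⊕ x₄ ⊑ x₂ ⊢ x₈ ⊕ x₆ ⊑ x₃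
          ⊢ ⊩ x₀ ⊑ x₁) refl (sb v) (sb′ v) (≤-reflexive (cnt-++ (v ==_) (r₁ ++ q₁) q₂))
          (≤-reflexive (cnt-++ (v ==_) r₁ q₁)) (≥-reflexive (cnt-++ (v ==_) r₁ r₂))
          (≥-reflexive (cnt-++ (v ==_) q₁ q₂))

  -- Claims are stored in the items so that the recursion in claim is structural.
  Claims : List Child → Set
  Claims [] = ⊤
  Claims (sub s (core cs′) ∷ cs) = Claims cs′ × Claims cs
  Claims (dir s m c ∷ cs) = Claim c × Claims cs
  Claims (zig d s w et c ∷ cs) = Claim c × Claims cs

  -- The limbs must avoid the whole skeleton, so they cannot be laid while it grows. Growing
  -- therefore returns the `items` that remain and a function that completes the copy later.
  record Grown (cs : List Child) (r : ℕ) (us : List V) (M : List V) (u : V) : Set where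
    field
      new us′ : List V
      win : Window r us′
      same : Window.M win true ≡ M
      us′≈ : us′ ≈ (new ++ us)
      len : length new ≡ skel cs
      items : List Item
      ok : AllOK us′ items
      sum : ∀ σ → total σ items ≡ sideN σ cs
      assemble : ∀ rest → AllDone items rest → Σ[ f ∈ EmbF u (flats cs) ] (vertsF f ⊆ (new ++ rest))

  ∈-grown : ∀ us′ new us → us′ ≈ (new ++ us) → ∀ v → v ∈ us → v ∈ us′
  ∈-grown us′ new us eq v m = ≤-trans (∈-++ʳ new us m) (≤-reflexive (sym (eq _)))

  grow : ∀ cs → Claims cs → ∀ n r us (S : Window n us) u → u ∈ us → n ≡ skel cs + r → Grown cs r us (Window.M S true)
      u
  grow [] cl n r us S u mu refl = record { new = [] ; us′ = us ; win = S ; same = refl ; us′≈ = ≈-refl us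
      ; len = refl ; items = [] ; ok = tt ; sum = λ σ → refl
    ; assemble = λ rest _ → [] , λ v → z≤n }
  grow (sub s (core cs₁) ∷ cs) (cl₁ , cl) .(suc (skel cs₁ + skel cs + r)) r us S u mu refl = go (place S s u mu)
    where
    Goal = Grown (sub s (core cs₁) ∷ cs) r us (Window.M S true) u
    go : Placement S s u → Goal
    -- The subtree at `v` is grown first and must leave `skel cs + r` placements, for the siblings
    -- and for all that comes after them.
    go (v , t , v∉ , S₁ , eqM) = go₁ (grow cs₁ cl₁ _ (skel cs + r) (v ∷ us) S₁ v (∈-here v us)
        (+-assoc (skel cs₁) (skel cs) r))
      where
      go₁ : Grown cs₁ (skel cs + r) (v ∷ us) (Window.M S₁ true) v → Goal
      go₁ record { new = new₁ ; us′ = us₁ ; win = S₂ ; same = same₁ ; us′≈ = eq₁ ; len = len₁ ; items = is₁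
          ; ok = ok₁ ; sum = sum₁ ; assemble = as₁ } =
        go₂ (grow cs cl _ r us₁ S₂ u (∈-grown us₁ new₁ (v ∷ us) eq₁ u (∈-there v us mu)) refl)
        where
        go₂ : Grown cs r us₁ (Window.M S₂ true) u → Goal
        go₂ record { new = new₂ ; us′ = us₂ ; win = S₃ ; same = same₂ ; us′≈ = eq₂ ; len = len₂ ; items = is₂
            ; ok = ok₂ ; sum = sum₂ ; assemble = as₂ } = record
          { new = v ∷ new₁ ++ new₂ ; us′ = us₂ ; win = S₃ ; same = trans same₂ (trans same₁ eqM)
          ; us′≈ = λ p → ≤-antisym
              (lin (cnt p us₂ ∷ b2n (p v) ∷ cnt p ((new₁ ++ new₂) ++ us) ∷ cnt p (new₂ ++ us₁) ∷ cnt p us₁ ∷ cnt p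
                  (new₁ ++ v ∷ us) ∷ cnt p new₂ ∷ cnt p new₁ ∷ cnt p us ∷ cnt p (new₁ ++ new₂) ∷ []) (x₀ ⊑ x₃
                  ⊢ x₄ ⊑ x₅ ⊢ x₃ ⊑ x₆ ⊕ x₄ ⊢ x₅ ⊑ x₇ ⊕ (x₁ ⊕ x₈) ⊢ x₉ ⊕ x₈ ⊑ x₂ ⊢ x₇ ⊕ x₆ ⊑ x₉ ⊢ ⊩ x₀ ⊑ x₁ ⊕ x₂)
                  refl (≤-reflexive (eq₂ p)) (≤-reflexive (eq₁ p)) (≤-reflexive (cnt-++ p new₂ us₁))
                  (≤-reflexive (cnt-++ p new₁ (v ∷ us))) (≥-reflexive (cnt-++ p (new₁ ++ new₂) us))
                  (≥-reflexive (cnt-++ p new₁ new₂)))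
              (lin (b2n (p v) ∷ cnt p ((new₁ ++ new₂) ++ us) ∷ cnt p us₂ ∷ cnt p (new₂ ++ us₁) ∷ cnt p us₁ ∷ cnt p
                  (new₁ ++ v ∷ us) ∷ cnt p new₂ ∷ cnt p new₁ ∷ cnt p us ∷ cnt p (new₁ ++ new₂) ∷ []) (x₃ ⊑ x₂
                  ⊢ x₅ ⊑ x₄ ⊢ x₆ ⊕ x₄ ⊑ x₃ ⊢ x₇ ⊕ (x₀ ⊕ x₈) ⊑ x₅ ⊢ x₁ ⊑ x₉ ⊕ x₈ ⊢ x₉ ⊑ x₇ ⊕ x₆ ⊢ ⊩ x₀ ⊕ x₁ ⊑ x₂)
                  refl (≥-reflexive (eq₂ p)) (≥-reflexive (eq₁ p)) (≥-reflexive (cnt-++ p new₂ us₁))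
                  (≥-reflexive (cnt-++ p new₁ (v ∷ us))) (≤-reflexive (cnt-++ p (new₁ ++ new₂) us))
                  (≤-reflexive (cnt-++ p new₁ new₂)))
          ; len = cong suc (trans (length-++ new₁) (cong₂ _+_ len₁ len₂))
          ; items = is₁ ++ is₂
          ; ok = allOK-++ us₂ is₁ is₂ (allOK-mono us₁ us₂ is₁ (∈-grown us₂ new₂ us₁ eq₂) ok₁) ok₂
          ; sum = λ σ → trans (total-++ σ is₁ is₂) (cong₂ _+_ (sum₁ σ) (sum₂ σ))
          ; assemble = assemble }
          where
          assemble : ∀ rest → AllDone (is₁ ++ is₂) rest → Σ[ f ∈ EmbF u (flats (sub s (core cs₁) ∷ cs)) ]
              (vertsF f ⊆ ((v ∷ new₁ ++ new₂) ++ rest))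
          assemble rest d = split (AllDone-++ is₁ is₂ rest d)
            where
            split : Shared is₁ is₂ rest → Σ[ f ∈ EmbF u (flats (sub s (core cs₁) ∷ cs)) ]
                (vertsF f ⊆ ((v ∷ new₁ ++ new₂) ++ rest))
            split (r₁ , r₂ , d₁ , d₂ , sb) = fin (as₁ r₁ d₁) (as₂ r₂ d₂)
              where
              fin : (Σ[ f ∈ EmbF v (flats cs₁) ] (vertsF f ⊆ (new₁ ++ r₁)))
                  → (Σ[ f ∈ EmbF u (flats cs) ] (vertsF f ⊆ (new₂ ++ r₂))) →
                Σ[ f ∈ EmbF u (flats (sub s (core cs₁) ∷ cs)) ] (vertsF f ⊆ ((v ∷ new₁ ++ new₂) ++ rest))
              fin (f₁ , s₁) (f₂ , s₂) = cons t (node f₁) f₂ , λ x → lin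
                  (b2n (x == v) ∷ # x (vertsF f₁ ++ vertsF f₂) ∷ # x ((new₁ ++ new₂) ++ rest) ∷ # x (vertsF f₁) ∷ # x
                  (new₁ ++ r₁) ∷ # x (vertsF f₂) ∷ # x (new₂ ++ r₂) ∷ # x (r₁ ++ r₂) ∷ # x rest ∷ # x new₁ ∷ # x
                  r₁ ∷ # x new₂ ∷ # x r₂ ∷ # x (new₁ ++ new₂) ∷ []) (x₃ ⊑ x₄ ⊢ x₅ ⊑ x₆ ⊢ x₇ ⊑ x₈ ⊢ x₁ ⊑ x₃ ⊕ x₅
                  ⊢ x₄ ⊑ x₉ ⊕ x₁₀ ⊢ x₆ ⊑ x₁₁ ⊕ x₁₂ ⊢ x₁₀ ⊕ x₁₂ ⊑ x₇ ⊢ x₁₃ ⊕ x₈ ⊑ x₂ ⊢ x₉ ⊕ x₁₁ ⊑ x₁₃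
                  ⊢ ⊩ x₀ ⊕ x₁ ⊑ x₀ ⊕ x₂) refl (s₁ x) (s₂ x) (sb x)
                  (≤-reflexive (cnt-++ (x ==_) (vertsF f₁) (vertsF f₂))) (≤-reflexive (cnt-++ (x ==_) new₁ r₁))
                  (≤-reflexive (cnt-++ (x ==_) new₂ r₂)) (≥-reflexive (cnt-++ (x ==_) r₁ r₂))
                  (≥-reflexive (cnt-++ (x ==_) (new₁ ++ new₂) rest)) (≥-reflexive (cnt-++ (x ==_) new₁ new₂))
  grow (dir s m c ∷ cs) (cl₁ , cl) n r us S u mu eq = go (grow cs cl n r us S u mu eq)
    where
    go : Grown cs r us (Window.M S true) u → Grown (dir s m c ∷ cs) r us (Window.M S true) u
    go record { new = new ; us′ = us′ ; win = win ; same = same ; us′≈ = us′≈ ; len = len ; items = is ; ok = ok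
        ; sum = sum ; assemble = as } = record
      { new = new ; us′ = us′ ; win = win ; same = same ; us′≈ = us′≈ ; len = len
      ; items = dirI u s m c cl₁ ∷ is ; ok = (∈-grown us′ new us us′≈ u mu , (λ v ()) , (λ v → z≤n)) , ok
      ; sum = λ σ → cong (40 + charge s σ (1 + (m + need c)) +_) (sum σ) ; assemble = assemble }
      where
      assemble : ∀ rest → AllDone (dirI u s m c cl₁ ∷ is) rest → Σ[ f ∈ EmbF u (flats (dir s m c ∷ cs)) ]
          (vertsF f ⊆ (new ++ rest))
      assemble rest (r₁ , r₂ , (cons {r′ = v} t em [] , s₁) , ds , sb) = fin s₁ (as r₂ ds)
        where
        fin : (verts em ++ []) ⊆ r₁ → (Σ[ f ∈ EmbF u (flats cs) ] (vertsF f ⊆ (new ++ r₂)))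
            → Σ[ f ∈ EmbF u (flats (dir s m c ∷ cs)) ] (vertsF f ⊆ (new ++ rest))
        fin s₁ (f , s₂) = cons t em f , λ x → lin (# x (verts em ++ vertsF f) ∷ # x (new ++ rest) ∷ # x
            (verts em ++ []) ∷ # x r₁ ∷ # x (vertsF f) ∷ # x (new ++ r₂) ∷ # x (r₁ ++ r₂) ∷ # x rest ∷ # x
            (verts em) ∷ # x new ∷ # x r₂ ∷ []) (x₂ ⊑ x₃ ⊢ x₄ ⊑ x₅ ⊢ x₆ ⊑ x₇ ⊢ x₈ ⊕ con 0 ⊑ x₂ ⊢ x₀ ⊑ x₈ ⊕ x₄
            ⊢ x₅ ⊑ x₉ ⊕ x₁₀ ⊢ x₉ ⊕ x₇ ⊑ x₁ ⊢ x₃ ⊕ x₁₀ ⊑ x₆ ⊢ ⊩ x₀ ⊑ x₁)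
            refl (s₁ x) (s₂ x) (sb x) (≥-reflexive (cnt-++ (x ==_) (verts em) []))
            (≤-reflexive (cnt-++ (x ==_) (verts em) (vertsF f))) (≤-reflexive (cnt-++ (x ==_) new r₂))
            (≥-reflexive (cnt-++ (x ==_) new rest)) (≥-reflexive (cnt-++ (x ==_) r₁ r₂))
  grow (zig d s w et c ∷ cs) (cl₁ , cl) .(suc (suc (skel cs + r))) r us S u mu refl = go (place S d u mu)
    where
    Goal = Grown (zig d s w et c ∷ cs) r us (Window.M S true) u
    go : Placement S d u → Goal
    go (a , ta , a∉ , S₁ , eqM₁) = go₁ (place S₁ d u (∈-there a us mu))
      where
      go₁ : Placement S₁ d u → Goal
      go₁ (b , tb , b∉ , S₂ , eqM₂) = go₂ (grow cs cl _ r (b ∷ a ∷ us) S₂ u (∈-there b (a ∷ us) (∈-there a us mu))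
          refl)
        where
        b≢a : b ≢ a
        b≢a refl = 1≰0 (≤-trans (∈-here a us) (≤-reflexive b∉))
        go₂ : Grown cs r (b ∷ a ∷ us) (Window.M S₂ true) u → Goal
        go₂ record { new = new ; us′ = us′ ; win = win ; same = same ; us′≈ = us′≈ ; len = len ; items = is ; ok = ok
            ; sum = sum ; assemble = as } = record
          { new = a ∷ b ∷ new ; us′ = us′ ; win = win ; same = trans same (trans eqM₂ eqM₁)
          ; us′≈ = λ p → ≤-antisym (lin (cnt p us′ ∷ b2n (p a) ∷ b2n (p b) ∷ cnt p (new ++ us) ∷ cnt p
              (new ++ b ∷ a ∷ us) ∷ cnt p new ∷ cnt p us ∷ []) (x₀ ⊑ x₄ ⊢ x₄ ⊑ x₅ ⊕ (x₂ ⊕ (x₁ ⊕ x₆)) ⊢ x₅ ⊕ x₆ ⊑ x₃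
              ⊢ ⊩ x₀ ⊑ x₁ ⊕ (x₂ ⊕ x₃)) refl (≤-reflexive (us′≈ p)) (≤-reflexive (cnt-++ p new (b ∷ a ∷ us)))
              (≥-reflexive (cnt-++ p new us)))
              (lin (b2n (p a) ∷ b2n (p b) ∷ cnt p (new ++ us) ∷ cnt p us′ ∷ cnt p (new ++ b ∷ a ∷ us) ∷ cnt p
              new ∷ cnt p us ∷ []) (x₄ ⊑ x₃ ⊢ x₅ ⊕ (x₁ ⊕ (x₀ ⊕ x₆)) ⊑ x₄ ⊢ x₂ ⊑ x₅ ⊕ x₆ ⊢ ⊩ x₀ ⊕ (x₁ ⊕ x₂) ⊑ x₃)
              refl (≥-reflexive (us′≈ p)) (≥-reflexive (cnt-++ p new (b ∷ a ∷ us))) (≤-reflexive (cnt-++ p new us)))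
          ; len = cong (2 +_) len
          ; items = it ∷ is
          ; ok = (mem u (∈-there b (a ∷ us) (∈-there a us mu)) , spares , uq) , ok
          ; sum = λ σ → cong (40 + charge true σ (3 + length w + need c) +_) (sum σ) ; assemble = assemble }
          where
          it = zigI u a b d s w et c cl₁ ta tb
          mem : ∀ v → v ∈ (b ∷ a ∷ us) → v ∈ us′
          mem = ∈-grown us′ new (b ∷ a ∷ us) us′≈
          spares : ∀ v → v ∈ (a ∷ b ∷ []) → v ∈ us′
          spares v k = mem v (lin (b2n (v == b) ∷ b2n (v == a) ∷ # v us ∷ []) (con 1 ⊑ x₁ ⊕ (x₀ ⊕ con 0)
              ⊢ ⊩ con 1 ⊑ x₀ ⊕ (x₁ ⊕ x₂)) refl k)
          uq : Uniq (a ∷ b ∷ [])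
          uq v = two (v ≟ b)
            where
            two : Dec (v ≡ b) → # v (a ∷ b ∷ []) ≤ 1
            two (yes refl) = lin (b2n (b == a) ∷ b2n (b == b) ∷ []) (x₁ ⊑ con 1 ⊢ x₀ ⊑ con 0
                ⊢ ⊩ x₀ ⊕ (x₁ ⊕ con 0) ⊑ con 1) refl (b2n≤1 (b == b)) (≤-reflexive (≢⇒∉ b≢a))
            two (no n) = lin (b2n (v == a) ∷ b2n (v == b) ∷ []) (x₁ ⊑ con 0 ⊢ x₀ ⊑ con 1
                ⊢ ⊩ x₀ ⊕ (x₁ ⊕ con 0) ⊑ con 1) refl (≤-reflexive (≢⇒∉ n)) (b2n≤1 (v == a))
          assemble : ∀ rest → AllDone (it ∷ is) rest → Σ[ f ∈ EmbF u (flats (zig d s w et c ∷ cs)) ]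
              (vertsF f ⊆ ((a ∷ b ∷ new) ++ rest))
          assemble rest (r₁ , r₂ , (cons {r′ = v} t em [] , s₁) , ds , sb) = fin s₁ (as r₂ ds)
            where
            fin : (verts em ++ []) ⊆ (a ∷ b ∷ r₁) → (Σ[ f ∈ EmbF u (flats cs) ] (vertsF f ⊆ (new ++ r₂)))
                → Σ[ f ∈ EmbF u (flats (zig d s w et c ∷ cs)) ] (vertsF f ⊆ ((a ∷ b ∷ new) ++ rest))
            fin s₁ (f , s₂) = cons t em f , λ x → lin (# x (verts em ++ vertsF f) ∷ b2n (x == a) ∷ b2n (x == b) ∷ # x
                (new ++ rest) ∷ # x (verts em ++ []) ∷ # x r₁ ∷ # x (vertsF f) ∷ # x (new ++ r₂) ∷ # x (r₁ ++ r₂) ∷ #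
                x rest ∷ # x (verts em) ∷ # x new ∷ # x r₂ ∷ []) (x₄ ⊑ x₁ ⊕ (x₂ ⊕ x₅) ⊢ x₆ ⊑ x₇ ⊢ x₈ ⊑ x₉
                ⊢ x₁₀ ⊕ con 0 ⊑ x₄ ⊢ x₀ ⊑ x₁₀ ⊕ x₆ ⊢ x₇ ⊑ x₁₁ ⊕ x₁₂ ⊢ x₁₁ ⊕ x₉ ⊑ x₃ ⊢ x₅ ⊕ x₁₂ ⊑ x₈
                ⊢ ⊩ x₀ ⊑ x₁ ⊕ (x₂ ⊕ x₃)) refl (s₁ x) (s₂ x) (sb x) (≥-reflexive (cnt-++ (x ==_) (verts em) []))
                (≤-reflexive (cnt-++ (x ==_) (verts em) (vertsF f))) (≤-reflexive (cnt-++ (x ==_) new r₂))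
                (≥-reflexive (cnt-++ (x ==_) new rest)) (≥-reflexive (cnt-++ (x ==_) r₁ r₂))

-- Laying one directed path or one zigzag together with the core at its end.

module Limbs {V : Set} (_≟_ : DecidableEquality V) (e : V → V → Bool) (tot : ∀ u v → u ≢ v → e u v ≡ not (e v u))
    where
  open Counting _≟_
  open MedianOrder _≟_ e tot
  open Paths _≟_ e tot
  open Jumping _≟_ e tot
  open Routing _≟_ e tot
  open Windows _≟_ e tot
  open Trees
  open Copies _≟_ e tot
  open Room
  open Med

  _∪_ : (V → Bool) → List V → V → Bool
  (A ∪ T) v = A v ∨ member T v

  ∨-false : ∀ a b → (a ∨ b) ≡ false → (a ≡ false) × (b ≡ false)
  ∨-false false b p = refl , p

  cnt-∪ : ∀ A T xs → Uniq xs → cnt (A ∪ T) xs ≤ cnt A xs + length T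
  cnt-∪ A T xs u = ≤-trans (cnt-∨ A (member T) xs) (+-monoʳ-≤ (cnt A xs) (cnt-member T xs u))

  ∪-false : ∀ A T v → (A ∪ T) v ≡ false → (A v ≡ false) × (# v T ≡ 0)
  ∪-false A T v p with ∨-false (A v) (member T v) p
  ... | a , t = a , nonmember T v t

  member-++ : ∀ J T v → member (J ++ T) v ≡ member J v ∨ member T v
  member-++ [] T v = refl
  member-++ (x ∷ J) T v with v == x
  ... | true = refl
  ... | false = member-++ J T v

  -- At most two vertices, at ten positions each: this is the `20` in `demand`.
  room-grow : ∀ A n T J xs → Uniq xs → length J ≤ 2 → Room (20 + n) (A ∪ T) xs → Room n (A ∪ (J ++ T)) xs
  room-grow A n T J xs u l r = room
      (lin (n ∷ cnt (A ∪ (J ++ T)) xs ∷ length xs ∷ cnt (A ∪ T) xs ∷ length J ∷ []) (con 20 ⊕ x₀ ⊕ 10 ⊛ x₃ ⊑ x₂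
      ⊢ x₁ ⊕ 9 ⊛ x₁ ⊑ x₃ ⊕ x₄ ⊕ 9 ⊛ (x₃ ⊕ x₄) ⊢ x₄ ⊕ 9 ⊛ x₄ ⊑ con 20 ⊢ ⊩ x₀ ⊕ 10 ⊛ x₁ ⊑ x₂)
      refl (fits r) (*-monoʳ-≤ 10 grown) (*-monoʳ-≤ 10 l))
    where
    l′ : ∀ a j t → b2n (a ∨ (j ∨ t)) ≤ b2n (a ∨ t) + b2n j
    l′ true j t = s≤s z≤n
    l′ false true true = s≤s z≤n
    l′ false true false = s≤s z≤n
    l′ false false true = s≤s z≤n
    l′ false false false = z≤n
    grown : cnt (A ∪ (J ++ T)) xs ≤ cnt (A ∪ T) xs + length J
    grown = ≤-trans (cnt-le (A ∪ (J ++ T)) (A ∪ T) (member J) xs λ x _ →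
        subst (λ b → b2n (A x ∨ b) ≤ b2n (A x ∨ member T x) + b2n (member J x)) (sym (member-++ J T x))
            (l′ (A x) (member J x) (member T x)))
      (+-monoʳ-≤ (cnt (A ∪ T) xs) (cnt-member J xs u))

  replicate-shift : ∀ m (s : Bool) l → replicate m s ++ s ∷ l ≡ s ∷ (replicate m s ++ l)
  replicate-shift zero s l = refl
  replicate-shift (suc m) s l = cong (s ∷_) (replicate-shift m s l)

  -- Three edges of a jump, `m` edges along the order and three edges of a second jump are what a
  -- directed child consists of.
  six : ∀ m (s : Bool) → replicate m s ++ s ∷ s ∷ s ∷ [] ≡ s ∷ s ∷ s ∷ replicate m s
  six m s = trans (replicate-shift m s _)
      (cong (s ∷_) (trans (replicate-shift m s _) (cong (s ∷_) (trans (replicate-shift m s _)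
    (cong (s ∷_) (++-identityʳ _))))))

  module Process (A : V → Bool) (Mm P : List V) where

    -- The stretch of the window interval that a jump from `u` to the region has to cross. It is
    -- sparse in `A` but may contain all of `T`, for which the region holds a reserve.
    record Near (R : List V) (σ : Bool) (u : V) : Set where
      field
        N : List V
        meds : Med σ (u ∷ N ++ R)
        N⊆ : N ⊆ Mm
        sparseN : Room 0 A N

    -- rest ++ D is the current region of a side, D being the part set aside for the item.
    record Served (i : Item) (T rest D : List V) : Set where
      field
        J D₁ D₂ r₁ : List V
        D≡ : D ≡ D₁ ++ D₂
        J≤2 : length J ≤ 2
        done : Done i r₁
        J⊆ : J ⊆ (Mm ++ rest ++ D₁)
        r₁⊆ : r₁ ⊆ (J ++ D₂)
        J-free : ∀ v → v ∈ J → (A ∪ T) v ≡ false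
        r₁-free : ∀ v → v ∈ r₁ → (A ∪ T) v ≡ false

    module ServeDir (u : V) (s : Bool) (m : ℕ) (c : Core) (cl : Claim c) (T rest D : List V)
        (near : Near (rest ++ D) s u)
      (uniq : Uniq (Mm ++ rest ++ D)) (p : ℕ) (pad : 5 + 10 * length T ≤ p) (roomR : Room p (A ∪ T) rest) where

      open Near near
      A′ : V → Bool
      A′ = A ∪ T

      Goal : Set
      Goal = Served (dirI u s m c cl) T rest D

      module Picked (pre : List V) (a : V) (ms : List V) (D≡ : D ≡ pre ++ a ∷ ms) (fa : A′ a ≡ false)
        (roomPre : Room 0 A′ pre) where

        seg : List V
        seg = N ++ rest ++ pre

        whole : u ∷ N ++ rest ++ D ≡ (u ∷ seg) ++ a ∷ ms
        whole = cong (u ∷_) (trans (cong (λ l → N ++ rest ++ l) D≡) (sym (trans (++-assoc N (rest ++ pre) (a ∷ ms))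
          (cong (N ++_) (++-assoc rest pre (a ∷ ms))))))

        medW : Med s ((u ∷ seg) ++ a ∷ ms)
        medW = subst (Med s) whole meds

        uniqD : Uniq D
        uniqD = Uniq-++ʳ rest D (Uniq-++ʳ Mm (rest ++ D) uniq)

        uniqDa : Uniq (a ∷ ms)
        uniqDa = Uniq-++ʳ pre (a ∷ ms) (subst Uniq D≡ uniqD)

        seg⊆ : seg ⊆ (Mm ++ rest ++ pre)
        seg⊆ v = lin (# v seg ∷ # v (Mm ++ rest ++ pre) ∷ # v N ∷ # v Mm ∷ # v (rest ++ pre) ∷ []) (x₂ ⊑ x₃
            ⊢ x₀ ⊑ x₂ ⊕ x₄ ⊢ x₃ ⊕ x₄ ⊑ x₁ ⊢ ⊩ x₀ ⊑ x₁) refl (N⊆ v) (≤-reflexive (cnt-++ (v ==_) N (rest ++ pre)))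
            (≥-reflexive (cnt-++ (v ==_) Mm (rest ++ pre)))

        uniqM : Uniq (Mm ++ rest ++ pre)
        uniqM v = lin (# v (Mm ++ rest ++ pre) ∷ # v (Mm ++ rest ++ D) ∷ # v Mm ∷ # v (rest ++ pre) ∷ # v rest ∷ # v
            pre ∷ # v (rest ++ D) ∷ # v D ∷ # v (pre ++ a ∷ ms) ∷ b2n (v == a) ∷ # v ms ∷ []) (x₁ ⊑ con 1
            ⊢ x₀ ⊑ x₂ ⊕ x₃ ⊢ x₃ ⊑ x₄ ⊕ x₅ ⊢ x₂ ⊕ x₆ ⊑ x₁ ⊢ x₄ ⊕ x₇ ⊑ x₆ ⊢ x₈ ⊑ x₇ ⊢ x₅ ⊕ (x₉ ⊕ x₁₀) ⊑ x₈
            ⊢ ⊩ x₀ ⊑ con 1) refl (uniq v) (≤-reflexive (cnt-++ (v ==_) Mm (rest ++ pre)))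
            (≤-reflexive (cnt-++ (v ==_) rest pre)) (≥-reflexive (cnt-++ (v ==_) Mm (rest ++ D)))
            (≥-reflexive (cnt-++ (v ==_) rest D)) (≥-reflexive (cong (# v) D≡))
            (≥-reflexive (cnt-++ (v ==_) pre (a ∷ ms)))

        uniqSeg : Uniq seg
        uniqSeg v = ≤-trans (seg⊆ v) (uniqM v)

        -- `pre` balances its own forbidden vertices, `N` only those of `A`. The `p` surplus
        -- positions of `rest` pay for the vertices of `T` in `N` and for the `5` that a jump asks
        -- for.
        big₁ : 5 + 10 * cnt A′ seg ≤ length seg
        big₁ = lin (cnt A′ seg ∷ length seg ∷ cnt A N ∷ length N ∷ p ∷ cnt (A ∪ T) rest ∷ length rest ∷ cnt A′
            pre ∷ length pre ∷ length T ∷ cnt (A ∪ T) N ∷ cnt A′ (rest ++ pre) ∷ length (rest ++ pre) ∷ [])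
            (con 0 ⊕ 10 ⊛ x₂ ⊑ x₃ ⊢ x₄ ⊕ 10 ⊛ x₅ ⊑ x₆ ⊢ con 0 ⊕ 10 ⊛ x₇ ⊑ x₈ ⊢ con 5 ⊕ 10 ⊛ x₉ ⊑ x₄
            ⊢ x₁₀ ⊕ 9 ⊛ x₁₀ ⊑ x₂ ⊕ x₉ ⊕ 9 ⊛ (x₂ ⊕ x₉) ⊢ x₀ ⊕ 9 ⊛ x₀ ⊑ x₁₀ ⊕ x₁₁ ⊕ 9 ⊛ (x₁₀ ⊕ x₁₁)
            ⊢ x₁₁ ⊕ 9 ⊛ x₁₁ ⊑ x₅ ⊕ x₇ ⊕ 9 ⊛ (x₅ ⊕ x₇) ⊢ x₃ ⊕ x₁₂ ⊑ x₁ ⊢ x₆ ⊕ x₈ ⊑ x₁₂ ⊢ ⊩ con 5 ⊕ 10 ⊛ x₀ ⊑ x₁)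
            refl (fits sparseN) (fits roomR) (fits roomPre) pad
            (*-monoʳ-≤ 10 (cnt-∪ A T N (Uniq-++ˡ N (rest ++ pre) uniqSeg)))
            (*-monoʳ-≤ 10 (≤-reflexive (cnt-++ A′ N (rest ++ pre))))
            (*-monoʳ-≤ 10 (≤-reflexive (cnt-++ A′ rest pre))) (≥-reflexive (length-++ N {rest ++ pre}))
            (≥-reflexive (length-++ rest {pre}))

        jump₁ : Jump s A′ u seg a
        jump₁ = jump s A′ u a seg (λ v → ≤-trans (≤-reflexive (cnt-reverse (v ==_) seg)) (uniqSeg v))
          (Half-take s (u ∷ seg) (a ∷ ms) (ahead medW))
          (Half-take (not s) (a ∷ reverse seg) (u ∷ [])
            (subst (λ l → Half (not s) (a ∷ l)) (unfold-reverse u seg)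
              (Half-drop (not s) (reverse ms) (a ∷ reverse (u ∷ seg))
                  (subst (Half (not s)) (reverse-middle (u ∷ seg) a ms) (behind medW)))))
          big₁

        module Laid (π ps zs′ : List V) (b : V) (cut : a ∷ ms ≡ ps ++ zs′) (len : length π ≡ m)
            (reach : Reach s a π b)
          (inside : (a ∷ π) ⊆ ps) (avoids : ∀ x → x ∈ (a ∷ π) → A′ x ≡ false) (halfB : Half s (b ∷ zs′)) where

          medZ : Med s zs′
          medZ = med-drop s ps zs′ (subst (Med s) cut (med-drop s (u ∷ seg) (a ∷ ms) medW))

          uniqZ : Uniq zs′
          uniqZ = Uniq-++ʳ ps zs′ (subst Uniq cut uniqDa)

          module Rooted (z : V) (S ps₂ qs₂ : List V) (at : zs′ ≡ ps₂ ++ z ∷ qs₂)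
              (sparse : 20 + 10 * (cnt A′ ps₂ + length S) ≤ length ps₂)
            (embed : ∀ es → length es ≤ 2 → (∀ v → v ∈ es → # v S ≡ 0) →
              Σ[ em ∈ Emb (flat c) z ] (verts em ⊆ zs′) × (∀ v → v ∈ verts em → (A′ v ≡ false) × (# v es ≡ 0))) where

            uniqP : Uniq ps₂
            uniqP = Uniq-++ˡ ps₂ (z ∷ qs₂) (subst Uniq at uniqZ)

            jump₂ : Jump s (A′ ∪ S) b ps₂ z
            jump₂ = jump s (A′ ∪ S) b z ps₂ (λ v → ≤-trans (≤-reflexive (cnt-reverse (v ==_) ps₂)) (uniqP v))
              (Half-take s (b ∷ ps₂) (z ∷ qs₂) (subst (λ l → Half s (b ∷ l)) at halfB))
              (Half-drop (not s) (reverse qs₂) (z ∷ reverse ps₂)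
                  (subst (Half (not s)) (trans (cong reverse at) (reverse-middle ps₂ z qs₂)) (behind medZ)))
              (lin (cnt (A′ ∪ S) ps₂ ∷ length ps₂ ∷ cnt A′ ps₂ ∷ length S ∷ []) (con 20 ⊕ 10 ⊛ (x₂ ⊕ x₃) ⊑ x₁
                  ⊢ x₀ ⊕ 9 ⊛ x₀ ⊑ x₂ ⊕ x₃ ⊕ 9 ⊛ (x₂ ⊕ x₃) ⊢ ⊩ con 5 ⊕ 10 ⊛ x₀ ⊑ x₁)
                  refl sparse (*-monoʳ-≤ 10 (cnt-∪ A′ S ps₂ uniqP)))

            -- The order of choices matters: first the root `z` with its reserved list `S`, then the
            -- jump from `b` to `z` that avoids `S`, and last the copy at `z`, which avoids the
            -- inner vertices `x′` and `y′` of that jump.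
            finish : Jump s A′ u seg a → Jump s (A′ ∪ S) b ps₂ z → Goal
            finish (x , y , mx , my , x≢y , fx , fy , ux , xy , ya)
                (x′ , y′ , mx′ , my′ , x≢y′ , fx′ , fy′ , bx , xy′ , yz) =
              close (embed (x′ ∷ y′ ∷ []) ≤-refl notS)
              where
              notS : ∀ v → v ∈ (x′ ∷ y′ ∷ []) → # v S ≡ 0
              notS v m = cases (∈-uncons x′ (y′ ∷ []) m)
                where
                cases : (v ≡ x′) ⊎ (v ∈ (y′ ∷ [])) → # v S ≡ 0
                cases (inj₁ refl) = proj₂ (∪-false A′ S x′ fx′)
                cases (inj₂ k) with ∈-uncons y′ [] k
                ... | inj₁ refl = proj₂ (∪-false A′ S y′ fy′)
              close : (Σ[ em ∈ Emb (flat c) z ] (verts em ⊆ zs′)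
                  × (∀ v → v ∈ verts em → (A′ v ≡ false) × (# v (x′ ∷ y′ ∷ []) ≡ 0))) → Goal
              close (em , sb , free) = pack (walk-emb word em)
                where
                ys : List V
                ys = x ∷ y ∷ a ∷ (π ++ x′ ∷ y′ ∷ [])
                word : Walk u ys (s ∷ replicate (5 + m) s) z
                word = subst (λ w → Walk u ys w z)
                    (cong (λ w → s ∷ s ∷ s ∷ w) (trans (cong (λ k → replicate k s ++ s ∷ s ∷ s ∷ []) len) (six m s)))
                  (step ux (step xy (step ya (reach ⊙ʳ step bx (step xy′ (end yz))))))
                tail₀ tail₁ r₁ : List V
                tail₀ = verts em
                tail₁ = x′ ∷ y′ ∷ tail₀
                r₁ = x ∷ y ∷ (a ∷ π) ++ tail₁
                at-x′ : x′ ∈ zs′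
                at-x′ = subst (x′ ∈_) (sym at) (∈-++ˡ ps₂ (z ∷ qs₂) mx′)
                at-y′ : y′ ∈ zs′
                at-y′ = subst (y′ ∈_) (sym at) (∈-++ˡ ps₂ (z ∷ qs₂) my′)
                absent : ∀ v → v ∈ (x′ ∷ y′ ∷ []) → # v tail₀ ≡ 0
                absent v k = n<1⇒n≡0 (≰⇒> λ k′ → 1≰0 (≤-trans k (≤-reflexive (proj₂ (free v k′)))))
                tail⊆ : tail₁ ⊆ zs′
                tail⊆ = cons-⊆ x′ (y′ ∷ tail₀) zs′ (cong₂ _+_ (≢⇒∉ x≢y′) (absent x′ (∈-here x′ (y′ ∷ [])))) at-x′
                  (cons-⊆ y′ tail₀ zs′ (absent y′ (∈-there x′ (y′ ∷ []) (∈-here y′ []))) at-y′ sb)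
                tail-free : ∀ v → v ∈ tail₁ → A′ v ≡ false
                tail-free v k = cases (∈-uncons x′ (y′ ∷ tail₀) k)
                  where
                  cases : (v ≡ x′) ⊎ (v ∈ (y′ ∷ tail₀)) → A′ v ≡ false
                  cases (inj₁ refl) = proj₁ (∪-false A′ S x′ fx′)
                  cases (inj₂ k) with ∈-uncons y′ tail₀ k
                  ... | inj₁ refl = proj₁ (∪-false A′ S y′ fy′)
                  ... | inj₂ k′ = proj₁ (free v k′)
                J-free : ∀ v → v ∈ (x ∷ y ∷ []) → A′ v ≡ false
                J-free v k = cases (∈-uncons x (y ∷ []) k)
                  where
                  cases : (v ≡ x) ⊎ (v ∈ (y ∷ [])) → A′ v ≡ false
                  cases (inj₁ refl) = fx
                  cases (inj₂ k) with ∈-uncons y [] k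
                  ... | inj₁ refl = fy
                r₁-free : ∀ v → v ∈ r₁ → A′ v ≡ false
                r₁-free v k = cases (∈-++ (x ∷ y ∷ []) ((a ∷ π) ++ tail₁) k)
                  where
                  cases : (v ∈ (x ∷ y ∷ [])) ⊎ (v ∈ ((a ∷ π) ++ tail₁)) → A′ v ≡ false
                  cases (inj₁ k) = J-free v k
                  cases (inj₂ k) with ∈-++ (a ∷ π) tail₁ k
                  ... | inj₁ k′ = avoids v k′
                  ... | inj₂ k′ = tail-free v k′
                pack : (Σ[ f ∈ EmbF u (graft s (replicate (5 + m) s) (flat c) ∷ []) ] (vertsF f ≈ (ys ++ verts em)))
                    → Goal
                pack (f , eqf) = record
                  -- The inner vertices of the first jump may lie in the window interval or in the
                  -- part of the region left to later items, so they are reported in order to be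
                  -- forbidden from now on.
                  { J = x ∷ y ∷ [] ; D₁ = pre ; D₂ = a ∷ ms ; r₁ = r₁ ; D≡ = D≡ ; J≤2 = ≤-refl
                  ; done = f , λ v → ≤-reflexive (trans (eqf (v ==_))
                      (cong (# v) (cong (λ l → x ∷ y ∷ a ∷ l) (++-assoc π (x′ ∷ y′ ∷ []) tail₀))))
                  ; J⊆ = λ v → ≤-trans (cons-⊆ x (y ∷ []) seg (≢⇒∉₁ x≢y) mx (single y seg my) v) (seg⊆ v)
                  ; r₁⊆ = λ v → lin (b2n (v == x) ∷ b2n (v == y) ∷ b2n (v == a) ∷ # v (π ++ tail₁) ∷ # v ms ∷ # v
                      π ∷ # v ps ∷ b2n (v == x′) ∷ b2n (v == y′) ∷ # v tail₀ ∷ # v zs′ ∷ # v (ps ++ zs′) ∷ [])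
                      (x₂ ⊕ x₅ ⊑ x₆ ⊢ x₇ ⊕ (x₈ ⊕ x₉) ⊑ x₁₀ ⊢ x₂ ⊕ x₃ ⊑ x₂ ⊕ x₅ ⊕ (x₇ ⊕ (x₈ ⊕ x₉)) ⊢ x₆ ⊕ x₁₀ ⊑ x₁₁
                      ⊢ x₁₁ ⊑ x₂ ⊕ x₄ ⊢ ⊩ x₀ ⊕ (x₁ ⊕ (x₂ ⊕ x₃)) ⊑ x₀ ⊕ (x₁ ⊕ (x₂ ⊕ x₄)))
                      refl (inside v) (tail⊆ v) (≤-reflexive (cnt-++ (v ==_) (a ∷ π) tail₁))
                      (≥-reflexive (cnt-++ (v ==_) ps zs′)) (≥-reflexive (cong (# v) cut))
                  ; J-free = J-free ; r₁-free = r₁-free }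

            goal : Goal
            goal = finish jump₁ jump₂

          choose : Zoned (flat c) zs′ A′ → Goal
          choose ζ = go (Zoned.zs ζ) refl (Zoned.big ζ)
            where
            go : ∀ zs → Zoned.zs ζ ≡ zs → 7 ≤ length zs → Goal
            go (z ∷ zs) eq _ = Rooted.goal z K.S K.ps K.qs K.at K.sparse K.embed
              where module K = Candidate (Zoned.cand ζ z (subst (z ∈_) (sym eq) (∈-here z zs)))

        laid : Bulk s A′ (need c) m a ms → Goal
        laid record { π = π ; ps = ps ; zs = zs′ ; c = b ; cut = cut ; len = len ; reach = reach ; inside = inside
            ; avoids = avoids ; half = half ; rest = r } =
          L.choose (cl s zs′ A′ L.medZ L.uniqZ r)
          where module L = Laid π ps zs′ b cut len reach inside avoids half

      serve : Room (1 + (m + need c)) A′ D → Goal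
      serve r = go (room-pick A′ 0 (m + need c) D r)
        where
        go : Pick 0 (m + need c) A′ D → Goal
        go (pre , a , ms , D≡ , fa , r₁ , r₂) = Q.laid
            (bulk s A′ (need c) m a ms (Half-drop s (u ∷ Q.seg) (a ∷ ms) (ahead Q.medW)) fa r₂)
          where module Q = Picked pre a ms D≡ fa r₁

    module ServeZig (u a b : V) (d s : Bool) (w : List Bool) (et : EndsTurn (s ∷ not s ∷ w)) (c : Core) (cl : Claim c)
      (ua : E d u a ≡ true) (ub : E d u b ≡ true) (T rest D : List V) (medD : Med true D) (uniqD : Uniq D)
      (spare∈ : ∀ v → v ∈ (a ∷ b ∷ []) → v ∈ T) (uniqS : Uniq (a ∷ b ∷ [])) where

      A′ : V → Bool
      A′ = A ∪ T

      W : List Bool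
      W = s ∷ not s ∷ w

      Goal : Set
      Goal = Served (zigI u a b d s w et c cl ua ub) T rest D

      used : ∀ v → v ∈ (a ∷ b ∷ []) → A′ v ≡ true
      used v m = go (A v) (member-complete T v (spare∈ v m))
        where
        go : ∀ x {y} → y ≡ true → (x ∨ y) ≡ true
        go true _ = refl
        go false p = p

      a≢b : a ≢ b
      a≢b = ∉-≢ (b ∷ []) (Uniq-head a (b ∷ []) uniqS) (∈-here b [])

      module Parts (DU DT : List V) (D≡ : D ≡ DU ++ DT) (roomU : Room (3 + length w) A′ DU) where

        free : List V
        free = filt (λ v → not (A′ v)) DU

        U : List V
        U = a ∷ b ∷ free

        uniqDD : Uniq (DU ++ DT)
        uniqDD = subst Uniq D≡ uniqD

        medT : Med true DT
        medT = med-drop true DU DT (subst (Med true) D≡ medD)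

        uniqT : Uniq DT
        uniqT = Uniq-++ʳ DU DT uniqDD

        free-false : ∀ v → v ∈ free → A′ v ≡ false
        free-false v m = k (∈-filt (λ v → not (A′ v)) DU m)
          where
          k : ∀ {b} → not b ≡ true → b ≡ false
          k {false} _ = refl

        free⊆ : free ⊆ DU
        free⊆ = filt-⊆ (λ v → not (A′ v)) DU

        uniqU : Uniq U
        uniqU v = go (1 ≤? # v (a ∷ b ∷ []))
          where
          go : Dec (1 ≤ # v (a ∷ b ∷ [])) → # v U ≤ 1
          go (yes m) = lin (b2n (v == a) ∷ b2n (v == b) ∷ # v free ∷ []) (x₀ ⊕ (x₁ ⊕ con 0) ⊑ con 1 ⊢ x₂ ⊑ con 0
              ⊢ ⊩ x₀ ⊕ (x₁ ⊕ x₂) ⊑ con 1) refl (uniqS v)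
              (≤-reflexive (#-filt-false (λ v → not (A′ v)) DU v (cong not (used v m))))
          go (no n) = lin (b2n (v == a) ∷ b2n (v == b) ∷ # v free ∷ # v DU ∷ []) (con 1 ⊕ (x₀ ⊕ (x₁ ⊕ con 0)) ⊑ con 1
              ⊢ x₂ ⊑ x₃ ⊢ x₃ ⊑ con 1 ⊢ ⊩ x₀ ⊕ (x₁ ⊕ x₂) ⊑ con 1) refl (≰⇒> n) (free⊆ v) (Uniq-++ˡ DU DT uniqDD v)

        -- The `3 + length w` positions booked for the path become free vertices, and with `a` and
        -- `b` there are three vertices more than letters of `W`.
        lenU : 3 + length W ≤ length U
        lenU = lin (length w ∷ length (filt (λ v → not (A′ v)) DU) ∷ cnt A′ DU ∷ length DU ∷ cnt (λ x → not (A′ x))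
            DU ∷ []) (con 3 ⊕ x₀ ⊕ 10 ⊛ x₂ ⊑ x₃ ⊢ x₃ ⊑ x₂ ⊕ x₄ ⊢ x₄ ⊑ x₁ ⊢ ⊩ con 5 ⊕ x₀ ⊑ con 2 ⊕ x₁)
            refl (fits roomU) (≥-reflexive (cnt-not A′ DU)) (≥-reflexive (length-filt (λ v → not (A′ v)) DU))

        module Zoning (ζ : Zoned (flat c) DT A′) where
          open Zoned ζ
          open Zone zs uniqᶻ big

          zs-in : ∀ v → v ∈ zs → (v ∈ DT) × (A′ v ≡ false)
          zs-in v m = ≤-trans (Candidate.root (cand v m)) (Candidate.S⊆ (cand v m) v) , Candidate.S-free (cand v m) v
              (Candidate.root (cand v m))

          off : ∀ v → v ∈ U → # v zs ≡ 0
          off v m = n<1⇒n≡0 (≰⇒> λ k → cases k (∈-++ (a ∷ b ∷ []) free m))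
            where
            cases : v ∈ zs → (v ∈ (a ∷ b ∷ [])) ⊎ (v ∈ free) → ⊥
            cases k (inj₁ l) = true≢false (used v l) (proj₂ (zs-in v k))
            cases k (inj₂ l) = 1≰0 (lin (# v (DU ++ DT) ∷ # v DU ∷ # v DT ∷ # v free ∷ []) (x₀ ⊑ con 1 ⊢ x₁ ⊕ x₂ ⊑ x₀
                ⊢ con 1 ⊑ x₃ ⊢ x₃ ⊑ x₁ ⊢ con 1 ⊑ x₂ ⊢ ⊩ con 1 ⊑ con 0)
                refl (uniqDD v) (≥-reflexive (cnt-++ (v ==_) DU DT)) l (free⊆ v) (proj₁ (zs-in v k)))

          -- This is why a zigzag has to open with a turn: its first run has length one, and the arc
          -- between `a` and `b` already is a path for it.
          starts : Starts U W a b
          starts = go (E-or s a b a≢b)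
            where
            one : lead s W ≤ 1
            one = ≤-reflexive (trans (lead-same s (not s ∷ w)) (cong suc (lead-diff s w)))
            go : E s a b ≡ true ⊎ E (not s) a b ≡ true → Starts U W a b
            go (inj₁ t) = inj₁ (b ∷ [] , (t , tt) , (λ v → lin (b2n (v == a) ∷ b2n (v == b) ∷ # v free ∷ [])
                (⊩ x₀ ⊕ (x₁ ⊕ con 0) ⊑ x₀ ⊕ (x₁ ⊕ x₂)) refl) , one)
            go (inj₂ t) = inj₂ (a ∷ [] , (E-flip s a b t , tt) ,
                (λ v → lin (b2n (v == b) ∷ b2n (v == a) ∷ # v free ∷ []) (⊩ x₀ ⊕ (x₁ ⊕ con 0) ⊑ x₁ ⊕ (x₀ ⊕ x₂)) refl)
                , one)

          from : ∀ q → E d u q ≡ true → Route U W q → Goal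
          from q uq (mkRoute vs es z walk inside zone few _) = close (Candidate.embed (cand z mz) es few λ v m
              → apart z mz v (es∈ v m) (es≢ v m))
            where
            mz : z ∈ zs
            mz = ≤-trans (∈-here z es) (zone z)
            es∈ : ∀ v → v ∈ es → v ∈ zs
            es∈ v m = ≤-trans (∈-there z es m) (zone v)
            es≢ : ∀ v → v ∈ es → v ≢ z
            es≢ v m refl = 1≰0 (lin (# v es ∷ b2n (v == v) ∷ # v zs ∷ []) (con 1 ⊑ x₀ ⊢ x₁ ⊕ x₀ ⊑ x₂ ⊢ x₂ ⊑ con 1
                ⊢ con 1 ⊑ x₁ ⊢ ⊩ con 1 ⊑ con 0) refl m (zone z) (uniqᶻ z) (≥-reflexive (cong b2n (==-refl z))))
            close : (Σ[ em ∈ Emb (flat c) z ] (verts em ⊆ DT) × (∀ v → v ∈ verts em → (A′ v ≡ false) × (# v es ≡ 0)))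
                → Goal
            close (em , sb , em-free) = pack (walk-emb (step uq walk) em)
              where
              tail₀ tail₁ : List V
              tail₀ = verts em
              tail₁ = es ++ tail₀
              es⊆ : es ⊆ DT
              es⊆ v = go (1 ≤? # v es)
                where
                go : Dec (1 ≤ # v es) → # v es ≤ # v DT
                go (yes m) = lin (# v es ∷ # v DT ∷ b2n (v == z) ∷ # v zs ∷ []) (x₂ ⊕ x₀ ⊑ x₃ ⊢ x₃ ⊑ con 1
                    ⊢ con 1 ⊑ x₁ ⊢ ⊩ x₀ ⊑ x₁) refl (zone v) (uniqᶻ v) (proj₁ (zs-in v (es∈ v m)))
                go (no n) = ≤-trans (≤-pred (≰⇒> n)) z≤n
              tail⊆ : tail₁ ⊆ DT
              tail⊆ v = go (1 ≤? # v tail₀)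
                where
                go : Dec (1 ≤ # v tail₀) → # v tail₁ ≤ # v DT
                go (yes m) = lin (# v tail₁ ∷ # v DT ∷ # v es ∷ # v tail₀ ∷ []) (x₀ ⊑ x₂ ⊕ x₃ ⊢ x₃ ⊑ x₁ ⊢ x₂ ⊑ con 0
                    ⊢ ⊩ x₀ ⊑ x₁) refl (≤-reflexive (cnt-++ (v ==_) es tail₀)) (sb v)
                    (≤-reflexive (proj₂ (em-free v m)))
                go (no n) = lin (# v tail₁ ∷ # v DT ∷ # v es ∷ # v tail₀ ∷ []) (x₀ ⊑ x₂ ⊕ x₃ ⊢ x₂ ⊑ x₁
                    ⊢ con 1 ⊕ x₃ ⊑ con 1 ⊢ ⊩ x₀ ⊑ x₁) refl (≤-reflexive (cnt-++ (v ==_) es tail₀)) (es⊆ v) (≰⇒> n)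
              r₁ : List V
              r₁ = free ++ tail₁
              r₁-free : ∀ v → v ∈ r₁ → A′ v ≡ false
              r₁-free v m = cases (∈-++ free tail₁ m)
                where
                cases : (v ∈ free) ⊎ (v ∈ tail₁) → A′ v ≡ false
                cases (inj₁ k) = free-false v k
                cases (inj₂ k) with ∈-++ es tail₀ k
                ... | inj₁ l = proj₂ (zs-in v (es∈ v l))
                ... | inj₂ l = proj₁ (em-free v l)
              pack : (Σ[ f ∈ EmbF u (graft d W (flat c) ∷ []) ] (vertsF f ≈ ((q ∷ vs ++ es) ++ verts em))) → Goal
              pack (f , eqf) = record
                -- Besides its two neighbours in the window, which are in `T` already, a zigzag uses
                -- only its own interval and forbids nothing new.
                { J = [] ; D₁ = [] ; D₂ = D ; r₁ = r₁ ; D≡ = refl ; J≤2 = z≤n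
                ; done = f , λ v → lin (# v (vertsF f) ∷ b2n (v == a) ∷ b2n (v == b) ∷ # v r₁ ∷ b2n (v == q) ∷ # v
                    ((vs ++ es) ++ verts em) ∷ # v (vs ++ es) ∷ # v tail₀ ∷ # v vs ∷ # v es ∷ # v free ∷ # v
                    tail₁ ∷ []) (x₀ ⊑ x₄ ⊕ x₅ ⊢ x₄ ⊕ x₅ ⊑ x₄ ⊕ x₆ ⊕ x₇ ⊢ x₆ ⊑ x₈ ⊕ x₉ ⊢ x₄ ⊕ x₈ ⊑ x₁ ⊕ (x₂ ⊕ x₁₀)
                    ⊢ x₁₀ ⊕ x₁₁ ⊑ x₃ ⊢ x₉ ⊕ x₇ ⊑ x₁₁ ⊢ ⊩ x₀ ⊑ x₁ ⊕ (x₂ ⊕ x₃))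
                    refl (≤-reflexive (eqf (v ==_))) (≤-reflexive (cnt-++ (v ==_) (q ∷ vs ++ es) tail₀))
                    (≤-reflexive (cnt-++ (v ==_) vs es)) (inside v) (≥-reflexive (cnt-++ (v ==_) free tail₁))
                    (≥-reflexive (cnt-++ (v ==_) es tail₀))
                ; J⊆ = λ v → z≤n
                ; r₁⊆ = λ v → lin (# v r₁ ∷ # v D ∷ # v free ∷ # v tail₁ ∷ # v DU ∷ # v DT ∷ # v (DU ++ DT) ∷ [])
                    (x₀ ⊑ x₂ ⊕ x₃ ⊢ x₂ ⊑ x₄ ⊢ x₃ ⊑ x₅ ⊢ x₆ ⊑ x₁ ⊢ x₄ ⊕ x₅ ⊑ x₆ ⊢ ⊩ x₀ ⊑ x₁)
                    refl (≤-reflexive (cnt-++ (v ==_) free tail₁)) (free⊆ v) (tail⊆ v) (≥-reflexive (cong (# v) D≡))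
                    (≥-reflexive (cnt-++ (v ==_) DU DT))
                ; J-free = λ v () ; r₁-free = r₁-free }

          goal : Goal
          goal = go (route (length W) W ≤-refl et U a b (record { uniq = uniqU ; apart = off ; room′ = lenU })
            (∈-here a (b ∷ free)) (∈-there a (b ∷ free) (∈-here b free)) a≢b starts)
            where
            go : Result U W a b → Goal
            go (inj₁ ρ) = from a ua ρ
            go (inj₂ ρ) = from b ub ρ

      serve : Room (3 + length w + need c) A′ D → Goal
      serve r = go (room-split A′ (3 + length w) (need c) D r)
        where
        go : Split (3 + length w) (need c) A′ D → Goal
        go (DU , DT , D≡ , r₁ , r₂) = Q.Zoning.goal (cl true DT A′ Q.medT Q.uniqT r₂)
          where module Q = Parts DU DT D≡ r₁

-- Serving all limbs of a core, and the induction over cores.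

module Embedding {V : Set} (_≟_ : DecidableEquality V) (e : V → V → Bool) (tot : ∀ u v → u ≢ v → e u v ≡ not (e v u))
    where
  open Counting _≟_
  open MedianOrder _≟_ e tot
  open Paths _≟_ e tot
  open Routing _≟_ e tot
  open Windows _≟_ e tot
  open Trees
  open Copies _≟_ e tot
  open Limbs _≟_ e tot
  open Room
  open Med

  upd : Bool → List V → (Bool → List V) → Bool → List V
  upd true l R true = l
  upd true l R false = R false
  upd false l R true = R true
  upd false l R false = l

  upd-elim : ∀ σ l R (Q : Bool → List V → Set) → Q σ l → (∀ τ → Q τ (R τ)) → ∀ τ → Q τ (upd σ l R τ)
  upd-elim true l R Q q h true = q
  upd-elim true l R Q q h false = h false
  upd-elim false l R Q q h true = h true
  upd-elim false l R Q q h false = q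

  demand : Bool → List Item → ℕ
  demand σ [] = 0
  demand σ (i ∷ is) = 20 + charge (side i) σ (needI i) + demand σ is

  module Serving (A : V → Bool) (Mm P : List V) where
    open Process A Mm P

    all : (Bool → List V) → List V
    all R = Mm ++ R true ++ R false

    Outcome : List Item → List V → (Bool → List V) → Set
    Outcome items T R = Σ[ rest ∈ List V ] AllDone items rest × (rest ⊆ all R) × (∀ v → v ∈ rest → (A ∪ T) v ≡ false)

    #-all : ∀ R v → # v (all R) ≡ # v Mm + (# v (R true) + # v (R false))
    #-all R v = trans (cnt-++ (v ==_) Mm (R true ++ R false)) (cong (# v Mm +_) (cnt-++ (v ==_) (R true) (R false)))

    #-upd : ∀ σ rest D R v → R σ ≡ rest ++ D → # v (all (upd σ rest R)) + # v D ≡ # v (all R)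
    #-upd true rest D R v eq = ≤-antisym
      (lin (# v (all (upd true rest R)) ∷ # v D ∷ # v (all R) ∷ # v Mm ∷ # v (R true) ∷ # v (R false) ∷ # v
          (upd true rest R true) ∷ # v (rest ++ D) ∷ []) (x₃ ⊕ (x₄ ⊕ x₅) ⊑ x₂ ⊢ x₀ ⊑ x₃ ⊕ (x₆ ⊕ x₅) ⊢ x₇ ⊑ x₄
          ⊢ x₆ ⊕ x₁ ⊑ x₇ ⊢ ⊩ x₀ ⊕ x₁ ⊑ x₂) refl (≥-reflexive (#-all R v)) (≤-reflexive (#-all (upd true rest R) v))
          (≥-reflexive (cong (# v) eq)) (≥-reflexive (cnt-++ (v ==_) rest D)))
      (lin (# v (all R) ∷ # v (all (upd true rest R)) ∷ # v D ∷ # v Mm ∷ # v (R true) ∷ # v (R false) ∷ # v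
          (upd true rest R true) ∷ # v (rest ++ D) ∷ []) (x₀ ⊑ x₃ ⊕ (x₄ ⊕ x₅) ⊢ x₃ ⊕ (x₆ ⊕ x₅) ⊑ x₁ ⊢ x₄ ⊑ x₇
          ⊢ x₇ ⊑ x₆ ⊕ x₂ ⊢ ⊩ x₀ ⊑ x₁ ⊕ x₂) refl (≤-reflexive (#-all R v)) (≥-reflexive (#-all (upd true rest R) v))
          (≤-reflexive (cong (# v) eq)) (≤-reflexive (cnt-++ (v ==_) rest D)))
    #-upd false rest D R v eq = ≤-antisym
      (lin (# v (all (upd false rest R)) ∷ # v D ∷ # v (all R) ∷ # v Mm ∷ # v (R true) ∷ # v (R false) ∷ # v
          (upd false rest R false) ∷ # v (rest ++ D) ∷ []) (x₃ ⊕ (x₄ ⊕ x₅) ⊑ x₂ ⊢ x₀ ⊑ x₃ ⊕ (x₄ ⊕ x₆) ⊢ x₇ ⊑ x₅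
          ⊢ x₆ ⊕ x₁ ⊑ x₇ ⊢ ⊩ x₀ ⊕ x₁ ⊑ x₂) refl (≥-reflexive (#-all R v)) (≤-reflexive (#-all (upd false rest R) v))
          (≥-reflexive (cong (# v) eq)) (≥-reflexive (cnt-++ (v ==_) rest D)))
      (lin (# v (all R) ∷ # v (all (upd false rest R)) ∷ # v D ∷ # v Mm ∷ # v (R true) ∷ # v (R false) ∷ # v
          (upd false rest R false) ∷ # v (rest ++ D) ∷ []) (x₀ ⊑ x₃ ⊕ (x₄ ⊕ x₅) ⊢ x₃ ⊕ (x₄ ⊕ x₆) ⊑ x₁ ⊢ x₅ ⊑ x₇
          ⊢ x₇ ⊑ x₆ ⊕ x₂ ⊢ ⊩ x₀ ⊑ x₁ ⊕ x₂) refl (≤-reflexive (#-all R v)) (≥-reflexive (#-all (upd false rest R) v))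
          (≤-reflexive (cong (# v) eq)) (≤-reflexive (cnt-++ (v ==_) rest D)))

    #-side : ∀ σ R v → # v Mm + # v (R σ) ≤ # v (all R)
    #-side true R v = lin (# v Mm ∷ # v (R true) ∷ # v (all R) ∷ # v (R false) ∷ []) (x₀ ⊕ (x₁ ⊕ x₃) ⊑ x₂
        ⊢ ⊩ x₀ ⊕ x₁ ⊑ x₂) refl (≥-reflexive (#-all R v))
    #-side false R v = lin (# v Mm ∷ # v (R false) ∷ # v (all R) ∷ # v (R true) ∷ []) (x₀ ⊕ (x₃ ⊕ x₁) ⊑ x₂
        ⊢ ⊩ x₀ ⊕ x₁ ⊑ x₂) refl (≥-reflexive (#-all R v))

    near-take : ∀ rest D σ u → Near (rest ++ D) σ u → Near rest σ u
    near-take rest D σ u record { N = N ; meds = meds ; N⊆ = N⊆ ; sparseN = sparseN } = record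
      { N = N ; meds = med-take σ (u ∷ N ++ rest) D (subst (Med σ) (cong (u ∷_) (sym (++-assoc N rest D))) meds)
          ; N⊆ = N⊆ ; sparseN = sparseN }

    med-region : ∀ rest D σ u → Near (rest ++ D) σ u → Med σ D
    med-region rest D σ u n = med-drop σ rest D (med-drop σ (u ∷ Near.N n) (rest ++ D) (Near.meds n))

    serve : ∀ i T rest D p → (∀ v → v ∈ P → v ∈ T) → (∀ u → u ∈ P → Near (rest ++ D) (side i) u)
        → Uniq (Mm ++ rest ++ D) → ItemOK P i →
      5 + 10 * length T ≤ p → Room p (A ∪ T) rest → Room (needI i) (A ∪ T) D → Served i T rest D
    serve (dirI u s m c cl) T rest D p P⊆ near uq (mu , _) pad r r′ = ServeDir.serve u s m c cl T rest D (near u mu)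
        uq p pad r r′
    serve (zigI u a b d s w et c cl ua ub) T rest D p P⊆ near uq (mu , sp , us) pad r r′ =
      ServeZig.serve u a b d s w et c cl ua ub T rest D (med-region rest D true u (near u mu))
          (Uniq-++ʳ rest D (Uniq-++ʳ Mm (rest ++ D) uq))
        (λ v m → P⊆ v (sp v m)) us r′

    room-weaken : ∀ m n B X → m ≤ n → Room n B X → Room m B X
    room-weaken m n B X l r = room (lin (m ∷ cnt B X ∷ length X ∷ n ∷ []) (x₀ ⊑ x₃ ⊢ x₃ ⊕ 10 ⊛ x₁ ⊑ x₂
        ⊢ ⊩ x₀ ⊕ 10 ⊛ x₁ ⊑ x₂) refl l (fits r))

    -- The same reserve `p` lasts to the end: with each item served, `T` grows by at most two
    -- vertices while `2 * length items` drops by two.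
    process : ∀ items T R p → (∀ v → v ∈ P → v ∈ T) → (∀ u → u ∈ P → ∀ σ → Near (R σ) σ u) → Uniq (all R)
        → AllOK P items →
      5 + 10 * (length T + 2 * length items) ≤ p → (∀ σ → Room (p + demand σ items) (A ∪ T) (R σ)) → Outcome items T R
    process [] T R p P⊆ near uq ok pad rm = [] , tt , (λ v → z≤n) , λ v ()
    process (i ∷ is) T R p P⊆ near uq (ok , oks) pad rm = split
        (room-split (A ∪ T) (p + (20 + demand σ is)) (needI i) (R σ) roomσ)
      where
      σ = side i
      Goal = Outcome (i ∷ is) T R
      roomσ : Room (p + (20 + demand σ is) + needI i) (A ∪ T) (R σ)
      roomσ = room (lin (p ∷ demand σ is ∷ needI i ∷ cnt (A ∪ T) (R σ) ∷ length (R σ) ∷ charge (side i) σ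
          (needI i) ∷ []) (x₀ ⊕ (con 20 ⊕ (x₅ ⊕ x₁)) ⊕ 10 ⊛ x₃ ⊑ x₄ ⊢ x₂ ⊑ x₅
          ⊢ ⊩ x₀ ⊕ (con 20 ⊕ x₁) ⊕ x₂ ⊕ 10 ⊛ x₃ ⊑ x₄) refl (fits (rm σ)) (≥-reflexive (charge-same σ (needI i))))
      split : Split (p + (20 + demand σ is)) (needI i) (A ∪ T) (R σ) → Goal
      split (rest , D , eqR , r₁ , r₂) = served
          (serve i T rest D p P⊆ (λ u m → subst (λ l → Near l σ u) eqR (near u m σ)) uqD ok
          (lin (length T ∷ p ∷ length is ∷ []) (con 5 ⊕ 10 ⊛ (x₀ ⊕ 2 ⊛ (con 1 ⊕ x₂)) ⊑ x₁ ⊢ ⊩ con 5 ⊕ 10 ⊛ x₀ ⊑ x₁)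
              refl pad) (room-weaken p _ (A ∪ T) rest (m≤m+n p _) r₁) r₂)
        where
        uqD : Uniq (Mm ++ rest ++ D)
        uqD v = lin (# v (Mm ++ rest ++ D) ∷ # v (all R) ∷ # v Mm ∷ # v (R σ) ∷ # v (rest ++ D) ∷ []) (x₁ ⊑ con 1
            ⊢ x₂ ⊕ x₃ ⊑ x₁ ⊢ x₄ ⊑ x₃ ⊢ x₀ ⊑ x₂ ⊕ x₄ ⊢ ⊩ x₀ ⊑ con 1)
            refl (uq v) (#-side σ R v) (≥-reflexive (cong (# v) eqR)) (≤-reflexive (cnt-++ (v ==_) Mm (rest ++ D)))
        uqR : ∀ τ → Uniq (R τ)
        uqR τ v = lin (# v (R τ) ∷ # v (all R) ∷ # v Mm ∷ []) (x₁ ⊑ con 1 ⊢ x₂ ⊕ x₀ ⊑ x₁ ⊢ ⊩ x₀ ⊑ con 1)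
            refl (uq v) (#-side τ R v)
        R′ : Bool → List V
        R′ = upd σ rest R
        served : Served i T rest D → Goal
        served record { J = J ; D₁ = D₁ ; D₂ = D₂ ; r₁ = q₁ ; D≡ = D≡ ; J≤2 = J≤2 ; done = done ; J⊆ = J⊆ ; r₁⊆ = q₁⊆
            ; J-free = J-free ; r₁-free = q₁-free } =
          combine (process is (J ++ T) R′ p (λ v m → ∈-++ʳ J T (P⊆ v m))
            (λ u m → upd-elim σ rest R (λ τ X → Near X τ u)
                (near-take rest D σ u (subst (λ l → Near l σ u) eqR (near u m σ))) (near u m))
            (λ v → lin (# v (all R′) ∷ # v D ∷ # v (all R) ∷ []) (x₀ ⊕ x₁ ⊑ x₂ ⊢ x₂ ⊑ con 1 ⊢ ⊩ x₀ ⊑ con 1)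
                refl (≤-reflexive (#-upd σ rest D R v eqR)) (uq v)) oks
            (lin (length (J ++ T) ∷ length is ∷ p ∷ length T ∷ []) (con 5 ⊕ 10 ⊛ (x₃ ⊕ 2 ⊛ (con 1 ⊕ x₁)) ⊑ x₂
                ⊢ x₀ ⊕ 9 ⊛ x₀ ⊑ con 2 ⊕ (x₃ ⊕ 9 ⊛ (con 2 ⊕ x₃)) ⊢ ⊩ con 5 ⊕ 10 ⊛ (x₀ ⊕ 2 ⊛ x₁) ⊑ x₂)
                refl pad (*-monoʳ-≤ 10 (≤-trans (≤-reflexive (length-++ J {T})) (+-monoˡ-≤ (length T) J≤2))))
            (upd-elim σ rest R (λ τ X → Room (p + demand τ is) (A ∪ (J ++ T)) X)
              (room-grow A _ T J rest (Uniq-++ˡ rest D (subst Uniq eqR (uqR σ))) J≤2 (room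
                  (lin (p ∷ demand σ is ∷ cnt (A ∪ T) rest ∷ length rest ∷ []) (x₀ ⊕ (con 20 ⊕ x₁) ⊕ 10 ⊛ x₂ ⊑ x₃
                  ⊢ ⊩ con 20 ⊕ (x₀ ⊕ x₁) ⊕ 10 ⊛ x₂ ⊑ x₃) refl (fits r₁))))
              (λ τ → room-grow A _ T J (R τ) (uqR τ) J≤2 (room
                  (lin (p ∷ demand τ is ∷ cnt (A ∪ T) (R τ) ∷ length (R τ) ∷ charge (side i) τ (needI i) ∷ [])
                  (x₀ ⊕ (con 20 ⊕ (x₄ ⊕ x₁)) ⊕ 10 ⊛ x₂ ⊑ x₃ ⊢ ⊩ con 20 ⊕ (x₀ ⊕ x₁) ⊕ 10 ⊛ x₂ ⊑ x₃)
                  refl (fits (rm τ)))))))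
          where
          combine : Outcome is (J ++ T) R′ → Goal
          combine (q₂ , ds , q₂⊆ , q₂-free) = q₁ ++ q₂ , (q₁ , q₂ , done , ds , λ v → ≤-refl) , inside , free
            where
            q₂-off : ∀ v → v ∈ q₂ → (# v J ≡ 0) × ((A ∪ T) v ≡ false)
            q₂-off v m with ∪-false A (J ++ T) v (q₂-free v m)
            ... | fa , z = n≤0⇒n≡0 (≤-trans (m≤m+n _ (# v T)) (≤-reflexive (trans (sym (cnt-++ (v ==_) J T)) z))) ,
              k (A v) (member T v) fa (#-nonmember T v
                  (n≤0⇒n≡0 (≤-trans (m≤n+m _ (# v J)) (≤-reflexive (trans (sym (cnt-++ (v ==_) J T)) z)))))
              where
              k : ∀ a t → a ≡ false → t ≡ false → (a ∨ t) ≡ false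
              k false false _ _ = refl
            free : ∀ v → v ∈ (q₁ ++ q₂) → (A ∪ T) v ≡ false
            free v m with ∈-++ q₁ q₂ m
            ... | inj₁ k = q₁-free v k
            ... | inj₂ k = proj₂ (q₂-off v k)
            -- A vertex of `J` may belong to a region that is handed on, but later items avoid it
            -- because it has become forbidden. All other vertices of `q₁` come from `D`, which is
            -- no longer part of any region.
            inside : (q₁ ++ q₂) ⊆ all R
            inside v = go (1 ≤? # v J)
              where
              go : Dec (1 ≤ # v J) → # v (q₁ ++ q₂) ≤ # v (all R)
              go (no n) = lin (# v (q₁ ++ q₂) ∷ # v (all R) ∷ # v J ∷ # v q₁ ∷ # v q₂ ∷ # v (J ++ D₂) ∷ # v D₂ ∷ # v
                  (all R′) ∷ # v D ∷ # v (D₁ ++ D₂) ∷ # v D₁ ∷ []) (con 1 ⊕ x₂ ⊑ con 1 ⊢ x₀ ⊑ x₃ ⊕ x₄ ⊢ x₃ ⊑ x₅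
                  ⊢ x₅ ⊑ x₂ ⊕ x₆ ⊢ x₄ ⊑ x₇ ⊢ x₇ ⊕ x₈ ⊑ x₁ ⊢ x₉ ⊑ x₈ ⊢ x₁₀ ⊕ x₆ ⊑ x₉ ⊢ ⊩ x₀ ⊑ x₁)
                  refl (≰⇒> n) (≤-reflexive (cnt-++ (v ==_) q₁ q₂)) (q₁⊆ v) (≤-reflexive (cnt-++ (v ==_) J D₂))
                  (q₂⊆ v) (≤-reflexive (#-upd σ rest D R v eqR)) (≥-reflexive (cong (# v) D≡))
                  (≥-reflexive (cnt-++ (v ==_) D₁ D₂))
              go (yes m) = lin (# v (q₁ ++ q₂) ∷ # v (all R) ∷ # v q₂ ∷ # v q₁ ∷ # v (J ++ D₂) ∷ # v J ∷ # v D₂ ∷ # v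
                  (Mm ++ rest ++ D₁) ∷ # v Mm ∷ # v (rest ++ D) ∷ # v (R σ) ∷ []) (x₂ ⊑ con 0 ⊢ x₀ ⊑ x₃ ⊕ x₂
                  ⊢ x₃ ⊑ x₄ ⊢ x₄ ⊑ x₅ ⊕ x₆ ⊢ x₅ ⊑ x₇ ⊢ x₇ ⊕ x₆ ⊑ x₈ ⊕ x₉ ⊢ x₈ ⊕ x₁₀ ⊑ x₁ ⊢ x₉ ⊑ x₁₀ ⊢ ⊩ x₀ ⊑ x₁)
                  refl (≤-reflexive none) (≤-reflexive (cnt-++ (v ==_) q₁ q₂)) (q₁⊆ v)
                  (≤-reflexive (cnt-++ (v ==_) J D₂)) (J⊆ v) base (#-side σ R v) (≥-reflexive (cong (# v) eqR))
                where
                none : # v q₂ ≡ 0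
                none = n<1⇒n≡0 (≰⇒> λ k → 1≰0 (≤-trans m (≤-reflexive (proj₁ (q₂-off v k)))))
                base : # v (Mm ++ rest ++ D₁) + # v D₂ ≤ # v Mm + # v (rest ++ D)
                base = lin (# v (Mm ++ rest ++ D₁) ∷ # v D₂ ∷ # v Mm ∷ # v (rest ++ D) ∷ # v (rest ++ D₁) ∷ # v
                    rest ∷ # v D₁ ∷ # v D ∷ # v (D₁ ++ D₂) ∷ []) (x₀ ⊑ x₂ ⊕ x₄ ⊢ x₄ ⊑ x₅ ⊕ x₆ ⊢ x₅ ⊕ x₇ ⊑ x₃
                    ⊢ x₈ ⊑ x₇ ⊢ x₆ ⊕ x₁ ⊑ x₈ ⊢ ⊩ x₀ ⊕ x₁ ⊑ x₂ ⊕ x₃)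
                    refl (≤-reflexive (cnt-++ (v ==_) Mm (rest ++ D₁))) (≤-reflexive (cnt-++ (v ==_) rest D₁))
                    (≥-reflexive (cnt-++ (v ==_) rest D)) (≥-reflexive (cong (# v) D≡))
                    (≥-reflexive (cnt-++ (v ==_) D₁ D₂))

  -- The `40` booked for an item falls into `20` here and `20` in the reserve `p` chosen by `embed`.
  demand-total : ∀ σ is → demand σ is + 20 * length is ≡ total σ is
  demand-total σ [] = refl
  demand-total σ (i ∷ is) = ≤-antisym
      (lin (charge (side i) σ (needI i) ∷ demand σ is ∷ length is ∷ total σ is ∷ []) (x₁ ⊕ 20 ⊛ x₂ ⊑ x₃
      ⊢ 20 ⊛ (con 1 ⊕ x₂) ⊑ con 20 ⊕ 20 ⊛ x₂ ⊢ ⊩ con 20 ⊕ (x₀ ⊕ x₁) ⊕ 20 ⊛ (con 1 ⊕ x₂) ⊑ con 40 ⊕ (x₀ ⊕ x₃))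
      refl (≤-reflexive (demand-total σ is)) (≤-reflexive (*-suc 20 (length is))))
      (lin (charge (side i) σ (needI i) ∷ total σ is ∷ demand σ is ∷ length is ∷ []) (x₁ ⊑ x₂ ⊕ 20 ⊛ x₃
      ⊢ 20 ⊛ (con 1 ⊕ x₃) ⊑ con 20 ⊕ 20 ⊛ x₃ ⊢ ⊩ con 40 ⊕ (x₀ ⊕ x₁) ⊑ con 20 ⊕ (x₀ ⊕ x₂) ⊕ 20 ⊛ (con 1 ⊕ x₃))
      refl (≥-reflexive (demand-total σ is)) (≤-reflexive (*-suc 20 (length is))))

  -- The list before a vertex of the window lies on the side opposite to the orientation, read backwards.
  sides : Bool → List V → List V → Bool → List V
  sides true L R true = R
  sides true L R false = reverse L
  sides false L R false = R
  sides false L R true = reverse L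

  sides-elim : ∀ o L R (Q : Bool → List V → Set) → Q o R → Q (not o) (reverse L) → ∀ σ → Q σ (sides o L R σ)
  sides-elim true L R Q q q′ true = q
  sides-elim true L R Q q q′ false = q′
  sides-elim false L R Q q q′ true = q′
  sides-elim false L R Q q q′ false = q

  -- Of `65 + 20 * skel cs`, the part `30 + 10 * skel cs` pays for forbidding the `1 + skel cs`
  -- skeleton vertices and two vertices of the incoming path; `35 + 10 * skel cs` is the fixed part
  -- of the reserve: `5` for a jump and ten for each of the same vertices.
  margin : Bool → List Child → ℕ
  margin σ cs = 65 + 20 * skel cs + sideN σ cs

  module Build (cs : List Child) (cl : Claims cs) (o : Bool) (A : V → Bool) (L M R : List V)
    (medX : Med o (L ++ M ++ R)) (uniqX : Uniq (L ++ M ++ R)) (roomL : Room (margin (not o) cs) A L)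
        (roomR : Room (margin o cs) A R) where

    xs : List V
    xs = L ++ M ++ R

    Rs : Bool → List V
    Rs = sides o L R

    #-xs : ∀ v → # v xs ≡ # v L + (# v M + # v R)
    #-xs v = trans (cnt-++ (v ==_) L (M ++ R)) (cong (# v L +_) (cnt-++ (v ==_) M R))

    #-sides : ∀ v → # v (Rs true) + # v (Rs false) ≡ # v L + # v R
    #-sides v = go o
      where
      go : ∀ o → # v (sides o L R true) + # v (sides o L R false) ≡ # v L + # v R
      go true = trans (+-comm (# v R) _) (cong (_+ # v R) (cnt-reverse (v ==_) L))
      go false = cong (_+ # v R) (cnt-reverse (v ==_) L)

    #-all-xs : ∀ v → # v (M ++ Rs true ++ Rs false) ≡ # v xs
    #-all-xs v = ≤-antisym
      (lin (# v (M ++ Rs true ++ Rs false) ∷ # v xs ∷ # v L ∷ # v M ∷ # v R ∷ # v (Rs true) ∷ # v (Rs false) ∷ # v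
          (Rs true ++ Rs false) ∷ []) (x₂ ⊕ (x₃ ⊕ x₄) ⊑ x₁ ⊢ x₅ ⊕ x₆ ⊑ x₂ ⊕ x₄ ⊢ x₀ ⊑ x₃ ⊕ x₇ ⊢ x₇ ⊑ x₅ ⊕ x₆
          ⊢ ⊩ x₀ ⊑ x₁) refl (≥-reflexive (#-xs v)) (≤-reflexive (#-sides v))
          (≤-reflexive (cnt-++ (v ==_) M (Rs true ++ Rs false))) (≤-reflexive (cnt-++ (v ==_) (Rs true) (Rs false))))
      (lin (# v xs ∷ # v (M ++ Rs true ++ Rs false) ∷ # v L ∷ # v M ∷ # v R ∷ # v (Rs true) ∷ # v (Rs false) ∷ # v
          (Rs true ++ Rs false) ∷ []) (x₀ ⊑ x₂ ⊕ (x₃ ⊕ x₄) ⊢ x₂ ⊕ x₄ ⊑ x₅ ⊕ x₆ ⊢ x₃ ⊕ x₇ ⊑ x₁ ⊢ x₅ ⊕ x₆ ⊑ x₇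
          ⊢ ⊩ x₀ ⊑ x₁) refl (≤-reflexive (#-xs v)) (≥-reflexive (#-sides v))
          (≥-reflexive (cnt-++ (v ==_) M (Rs true ++ Rs false))) (≥-reflexive (cnt-++ (v ==_) (Rs true) (Rs false))))

    uniqR : ∀ σ → Uniq (Rs σ)
    uniqR = sides-elim o L R (λ _ X → Uniq X) (λ v → lin (# v R ∷ # v (L ++ M ++ R) ∷ # v L ∷ # v M ∷ []) (x₁ ⊑ con 1
        ⊢ x₂ ⊕ (x₃ ⊕ x₀) ⊑ x₁ ⊢ ⊩ x₀ ⊑ con 1) refl (uniqX v) (≥-reflexive (#-xs v)))
        (λ v → lin (# v (reverse L) ∷ # v (L ++ M ++ R) ∷ # v L ∷ # v M ∷ # v R ∷ []) (x₁ ⊑ con 1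
        ⊢ x₂ ⊕ (x₃ ⊕ x₄) ⊑ x₁ ⊢ x₀ ⊑ x₂ ⊢ ⊩ x₀ ⊑ con 1)
        refl (uniqX v) (≥-reflexive (#-xs v)) (≤-reflexive (cnt-reverse (v ==_) L)))

    roomS : ∀ σ → Room (margin σ cs) A (Rs σ)
    roomS = sides-elim o L R (λ σ X → Room (margin σ cs) A X) roomR
      (room (lin (skel cs ∷ sideN (not o) cs ∷ cnt A (reverse L) ∷ length (reverse L) ∷ cnt A L ∷ length L ∷ [])
          (con 65 ⊕ (x₀ ⊕ 19 ⊛ x₀ ⊕ x₁) ⊕ 10 ⊛ x₄ ⊑ x₅ ⊢ x₂ ⊕ 9 ⊛ x₂ ⊑ x₄ ⊕ 9 ⊛ x₄ ⊢ x₅ ⊑ x₃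
          ⊢ ⊩ con 65 ⊕ (x₀ ⊕ 19 ⊛ x₀ ⊕ x₁) ⊕ 10 ⊛ x₂ ⊑ x₃)
          refl (fits roomL) (*-monoʳ-≤ 10 (≤-reflexive (cnt-reverse A L))) (≥-reflexive (length-reverse L))))

    module At (z : V) (us′ new : List V) (us′≈ : us′ ≈ (new ++ z ∷ [])) (len : length new ≡ skel cs) (us′⊆ : us′ ⊆ M)
      (cuts : ∀ a → a ∈ us′ → Cut A M a) (items : List Item) (ok : AllOK us′ items)
          (sum : ∀ σ → total σ items ≡ sideN σ cs)
      (assemble : ∀ rest → AllDone items rest → Σ[ f ∈ EmbF z (flats cs) ] (vertsF f ⊆ (new ++ rest))) where

      open Process A M us′ using (Near)
      open Serving A M us′

      lenU : length us′ ≡ 1 + skel cs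
      lenU = trans (≈-length us′ (new ++ z ∷ []) us′≈)
          (trans (length-++ new) (trans (+-comm (length new) 1) (cong suc len)))

      near : ∀ u → u ∈ us′ → ∀ σ → Near (Rs σ) σ u
      near u mu = go (proj₂ (cuts u mu))
        where
        go : (Σ[ M₁ ∈ List V ] Σ[ M₂ ∈ List V ] (M ≡ M₁ ++ u ∷ M₂) × Room 0 A M₁ × Room 0 A M₂) → ∀ σ
            → Near (Rs σ) σ u
        go (M₁ , M₂ , eqM , s₁ , s₂) = sides-elim o L R (λ σ X → Near X σ u)
          (record { N = M₂ ; meds = med-drop o (L ++ M₁) (u ∷ M₂ ++ R) (subst (Med o) eq₁ medX)
            ; N⊆ = λ v → lin (# v M₂ ∷ # v M ∷ # v (M₁ ++ u ∷ M₂) ∷ # v M₁ ∷ b2n (v == u) ∷ []) (x₂ ⊑ x₁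
                ⊢ x₃ ⊕ (x₄ ⊕ x₀) ⊑ x₂ ⊢ ⊩ x₀ ⊑ x₁)
                refl (≥-reflexive (cong (# v) eqM)) (≥-reflexive (cnt-++ (v ==_) M₁ (u ∷ M₂))) ; sparseN = s₂ })
          (record { N = reverse M₁ ; meds = subst (Med (not o)) eq₂
              (med-reverse o ((L ++ M₁) ++ u ∷ []) (med-take o ((L ++ M₁) ++ u ∷ []) (M₂ ++ R)
                (subst (Med o) (trans eq₁ (sym (++-assoc (L ++ M₁) (u ∷ []) (M₂ ++ R)))) medX)))
            ; N⊆ = λ v → lin (# v (reverse M₁) ∷ # v M ∷ # v (M₁ ++ u ∷ M₂) ∷ # v M₁ ∷ b2n (v == u) ∷ # v M₂ ∷ [])
                (x₂ ⊑ x₁ ⊢ x₃ ⊕ (x₄ ⊕ x₅) ⊑ x₂ ⊢ x₀ ⊑ x₃ ⊢ ⊩ x₀ ⊑ x₁)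
                refl (≥-reflexive (cong (# v) eqM)) (≥-reflexive (cnt-++ (v ==_) M₁ (u ∷ M₂)))
                (≤-reflexive (cnt-reverse (v ==_) M₁))
            ; sparseN = room (lin (cnt A (reverse M₁) ∷ length (reverse M₁) ∷ cnt A M₁ ∷ length M₁ ∷ [])
                (con 0 ⊕ 10 ⊛ x₂ ⊑ x₃ ⊢ x₀ ⊕ 9 ⊛ x₀ ⊑ x₂ ⊕ 9 ⊛ x₂ ⊢ x₃ ⊑ x₁ ⊢ ⊩ con 0 ⊕ 10 ⊛ x₀ ⊑ x₁)
                refl (fits s₁) (*-monoʳ-≤ 10 (≤-reflexive (cnt-reverse A M₁))) (≥-reflexive (length-reverse M₁))) })
          where
          eq₁ : xs ≡ (L ++ M₁) ++ u ∷ M₂ ++ R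
          eq₁ = trans (cong (λ l → L ++ l ++ R) eqM)
              (trans (cong (L ++_) (++-assoc M₁ (u ∷ M₂) R)) (sym (++-assoc L M₁ (u ∷ M₂ ++ R))))
          eq₂ : reverse ((L ++ M₁) ++ u ∷ []) ≡ u ∷ reverse M₁ ++ reverse L
          eq₂ = trans (reverse-++ (L ++ M₁) (u ∷ [])) (cong (u ∷_) (reverse-++ L M₁))

      mz : z ∈ us′
      mz = ≤-trans (∈-++ʳ new (z ∷ []) (∈-here z [])) (≤-reflexive (sym (us′≈ (z ==_))))

      free′ : ∀ u → u ∈ us′ → A u ≡ false
      free′ u m = proj₁ (cuts u m)

      us⊆xs : us′ ⊆ xs
      us⊆xs v = lin (# v us′ ∷ # v xs ∷ # v M ∷ # v L ∷ # v R ∷ []) (x₀ ⊑ x₂ ⊢ x₃ ⊕ (x₂ ⊕ x₄) ⊑ x₁ ⊢ ⊩ x₀ ⊑ x₁)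
          refl (us′⊆ v) (≥-reflexive (#-xs v))

      embed : ∀ es → length es ≤ 2 → (∀ u → u ∈ es → # u us′ ≡ 0) →
        Σ[ em ∈ Emb (node (flats cs)) z ] (verts em ⊆ xs) × (∀ u → u ∈ verts em → (A u ≡ false) × (# u es ≡ 0))
      embed es few off = go (process items T Rs p (λ v m → ∈-++ʳ es us′ m) near
          (λ v → ≤-trans (≤-reflexive (#-all-xs v)) (uniqX v)) ok
          (lin (length T ∷ length items ∷ skel cs ∷ []) (x₀ ⊕ 9 ⊛ x₀ ⊑ con 3 ⊕ (x₂ ⊕ 9 ⊛ (con 3 ⊕ x₂))
              ⊢ ⊩ con 5 ⊕ 10 ⊛ (x₀ ⊕ 2 ⊛ x₁) ⊑ con 35 ⊕ (x₂ ⊕ 9 ⊛ x₂ ⊕ 20 ⊛ x₁)) refl (*-monoʳ-≤ 10 lenT)) rooms)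
        where
        T : List V
        T = es ++ us′
        lenT : length T ≤ 3 + skel cs
        lenT = lin (length T ∷ skel cs ∷ length es ∷ length us′ ∷ []) (x₀ ⊑ x₂ ⊕ x₃ ⊢ x₂ ⊑ con 2 ⊢ x₃ ⊑ con 1 ⊕ x₁
            ⊢ ⊩ x₀ ⊑ con 3 ⊕ x₁) refl (≤-reflexive (length-++ es {us′})) few (≤-reflexive lenU)
        p : ℕ
        p = 35 + 10 * skel cs + 20 * length items
        rooms : ∀ σ → Room (p + demand σ items) (A ∪ T) (Rs σ)
        rooms σ = room (lin (skel cs ∷ length items ∷ demand σ items ∷ cnt (A ∪ T) (Rs σ) ∷ length (Rs σ) ∷ sideN σ
            cs ∷ cnt A (Rs σ) ∷ total σ items ∷ length T ∷ []) (con 65 ⊕ (x₀ ⊕ 19 ⊛ x₀ ⊕ x₅) ⊕ 10 ⊛ x₆ ⊑ x₄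
            ⊢ x₂ ⊕ 20 ⊛ x₁ ⊑ x₇ ⊢ x₇ ⊑ x₅ ⊢ x₃ ⊕ 9 ⊛ x₃ ⊑ x₆ ⊕ x₈ ⊕ 9 ⊛ (x₆ ⊕ x₈)
            ⊢ x₈ ⊕ 9 ⊛ x₈ ⊑ con 3 ⊕ (x₀ ⊕ 9 ⊛ (con 3 ⊕ x₀)) ⊢ ⊩ con 35 ⊕ (x₀ ⊕ 9 ⊛ x₀ ⊕ 20 ⊛ x₁) ⊕ x₂ ⊕ 10 ⊛ x₃ ⊑ x₄)
            refl (fits (roomS σ)) (≤-reflexive (demand-total σ items)) (≤-reflexive (sum σ))
            (*-monoʳ-≤ 10 (cnt-∪ A T (Rs σ) (uniqR σ))) (*-monoʳ-≤ 10 lenT))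
        go : Outcome items T Rs → Σ[ em ∈ Emb (node (flats cs)) z ] (verts em ⊆ xs)
            × (∀ u → u ∈ verts em → (A u ≡ false) × (# u es ≡ 0))
        go (rest , done , rest⊆ , rest-free) = fin (assemble rest done)
          where
          fin : (Σ[ f ∈ EmbF z (flats cs) ] (vertsF f ⊆ (new ++ rest))) →
            Σ[ em ∈ Emb (node (flats cs)) z ] (verts em ⊆ xs) × (∀ u → u ∈ verts em → (A u ≡ false) × (# u es ≡ 0))
          fin (f , sb) = node f , (λ v → inside v (1 ≤? # v rest)) , λ v m
              → avoid v (∈-++ us′ rest (≤-trans m (le v)))
            where
            vf : List V
            vf = vertsF f
            le : ∀ v → # v (z ∷ vf) ≤ # v (us′ ++ rest)
            le v = lin (b2n (v == z) ∷ # v vf ∷ # v (us′ ++ rest) ∷ # v (new ++ rest) ∷ # v us′ ∷ # v rest ∷ # v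
                new ∷ # v (new ++ z ∷ []) ∷ []) (x₁ ⊑ x₃ ⊢ x₄ ⊕ x₅ ⊑ x₂ ⊢ x₃ ⊑ x₆ ⊕ x₅ ⊢ x₇ ⊑ x₄
                ⊢ x₆ ⊕ (x₀ ⊕ con 0) ⊑ x₇ ⊢ ⊩ x₀ ⊕ x₁ ⊑ x₂) refl (sb v) (≥-reflexive (cnt-++ (v ==_) us′ rest))
                (≤-reflexive (cnt-++ (v ==_) new rest)) (≥-reflexive (us′≈ (v ==_)))
                (≥-reflexive (cnt-++ (v ==_) new (z ∷ [])))
            offT : ∀ v → v ∈ rest → (# v es ≡ 0) × (# v us′ ≡ 0)
            offT v m with ∪-false A T v (rest-free v m)
            ... | _ , q = n≤0⇒n≡0 (≤-trans (m≤m+n _ (# v us′)) (≤-reflexive (trans (sym (cnt-++ (v ==_) es us′)) q)))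
                ,
              n≤0⇒n≡0 (≤-trans (m≤n+m _ (# v es)) (≤-reflexive (trans (sym (cnt-++ (v ==_) es us′)) q)))
            inside : ∀ v → Dec (1 ≤ # v rest) → # v (z ∷ vf) ≤ # v xs
            inside v (yes m) = lin (b2n (v == z) ∷ # v vf ∷ # v xs ∷ # v (us′ ++ rest) ∷ # v us′ ∷ # v rest ∷ # v
                (all Rs) ∷ []) (x₀ ⊕ x₁ ⊑ x₃ ⊢ x₃ ⊑ x₄ ⊕ x₅ ⊢ x₄ ⊑ con 0 ⊢ x₅ ⊑ x₆ ⊢ x₆ ⊑ x₂ ⊢ ⊩ x₀ ⊕ x₁ ⊑ x₂)
                refl (le v) (≤-reflexive (cnt-++ (v ==_) us′ rest)) (≤-reflexive (proj₂ (offT v m))) (rest⊆ v)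
                (≤-reflexive (#-all-xs v))
            inside v (no n) = lin (b2n (v == z) ∷ # v vf ∷ # v xs ∷ # v (us′ ++ rest) ∷ # v us′ ∷ # v rest ∷ [])
                (x₀ ⊕ x₁ ⊑ x₃ ⊢ x₃ ⊑ x₄ ⊕ x₅ ⊢ con 1 ⊕ x₅ ⊑ con 1 ⊢ x₄ ⊑ x₂ ⊢ ⊩ x₀ ⊕ x₁ ⊑ x₂)
                refl (le v) (≤-reflexive (cnt-++ (v ==_) us′ rest)) (≰⇒> n) (us⊆xs v)
            avoid : ∀ v → (v ∈ us′) ⊎ (v ∈ rest) → (A v ≡ false) × (# v es ≡ 0)
            avoid v (inj₁ m) = free′ v m , n<1⇒n≡0 (≰⇒> λ k → 1≰0 (≤-trans m (≤-reflexive (off v k))))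
            avoid v (inj₂ m) = proj₁ (∪-false A T v (rest-free v m)) , proj₁ (offT v m)

      candidate : Candidate (node (flats cs)) xs A z
      candidate = go (proj₂ (cuts z mz))
        where
        go : (Σ[ M₁ ∈ List V ] Σ[ M₂ ∈ List V ] (M ≡ M₁ ++ z ∷ M₂) × Room 0 A M₁ × Room 0 A M₂)
            → Candidate (node (flats cs)) xs A z
        go (M₁ , M₂ , eqM , s₁ , s₂) = record
          { S = us′ ; root = mz ; S⊆ = us⊆xs ; S-free = free′ ; ps = L ++ M₁ ; qs = M₂ ++ R
          ; at = trans (cong (λ l → L ++ l ++ R) eqM)
              (trans (cong (L ++_) (++-assoc M₁ (z ∷ M₂) R)) (sym (++-assoc L M₁ (z ∷ M₂ ++ R))))
          ; sparse = lin (cnt A (L ++ M₁) ∷ length us′ ∷ length (L ++ M₁) ∷ skel cs ∷ sideN (not o) cs ∷ cnt A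
              L ∷ length L ∷ cnt A M₁ ∷ length M₁ ∷ []) (con 65 ⊕ (x₃ ⊕ 19 ⊛ x₃ ⊕ x₄) ⊕ 10 ⊛ x₅ ⊑ x₆
              ⊢ con 0 ⊕ 10 ⊛ x₇ ⊑ x₈ ⊢ x₀ ⊕ 9 ⊛ x₀ ⊑ x₅ ⊕ x₇ ⊕ 9 ⊛ (x₅ ⊕ x₇) ⊢ x₆ ⊕ x₈ ⊑ x₂
              ⊢ x₁ ⊕ 9 ⊛ x₁ ⊑ con 1 ⊕ (x₃ ⊕ 9 ⊛ (con 1 ⊕ x₃)) ⊢ ⊩ con 20 ⊕ 10 ⊛ (x₀ ⊕ x₁) ⊑ x₂)
              refl (fits roomL) (fits s₁) (*-monoʳ-≤ 10 (≤-reflexive (cnt-++ A L M₁)))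
              (≥-reflexive (length-++ L {M₁})) (*-monoʳ-≤ 10 (≤-reflexive lenU))
          ; embed = embed }

    Found : List V → V → Set
    Found ps z = Σ[ C ∈ Candidate (node (flats cs)) xs A z ] (Candidate.S C ⊆ ps)

    -- The picked vertices get a median order of their own, in which the skeleton is grown. Their
    -- place in the region enters through the fact that each of them is a cut of `M`.
    found : ∀ ps → Uniq ps → ps ⊆ M → (∀ a → a ∈ ps → Cut A M a) → 1 + 4 * skel cs ≤ length ps → Σ[ z ∈ V ] (z ∈ ps)
        × Found ps z
    found ps uq sb cuts l = go (window (skel cs) ps uq l)
      where
      go : (Σ[ z ∈ V ] Σ[ S ∈ Window (skel cs) (z ∷ []) ] (Window.M S true ≈ ps)) → Σ[ z ∈ V ] (z ∈ ps) × Found ps z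
      go (z , S , eqS) = close (grow cs cl (skel cs) 0 (z ∷ []) S z (∈-here z []) (sym (+-identityʳ _)))
        where
        close : Grown cs 0 (z ∷ []) (Window.M S true) z → Σ[ z ∈ V ] (z ∈ ps) × Found ps z
        close record { new = new ; us′ = us′ ; win = win ; same = same ; us′≈ = us′≈ ; len = len ; items = items
            ; ok = ok ; sum = sum ; assemble = assemble } =
          z , ≤-trans K.mz (us⊆ z) , K.candidate , us⊆
          where
          us⊆ : us′ ⊆ ps
          us⊆ v = ≤-trans (Window.inside win v) (≤-reflexive (trans (cong (# v) same) (eqS (v ==_))))
          module K = At z us′ new us′≈ len (λ v → ≤-trans (us⊆ v) (sb v)) (λ a m → cuts a (≤-trans m (us⊆ a))) items
              ok sum assemble

    record Roots (k : ℕ) (ps : List V) : Set where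
      field
        zs : List V
        count : length zs ≡ k
        zs⊆ : zs ⊆ ps
        cand : ∀ z → z ∈ zs → Σ[ f ∈ Found ps z ] (∀ u → u ∈ zs → u ≢ z → # u (Candidate.S (proj₁ f)) ≡ 0)

    -- The picked vertices are divided into blocks of the size of a window; disjoint blocks give
    -- disjoint reserved lists.
    roots : ∀ k ps → Uniq ps → ps ⊆ M → (∀ a → a ∈ ps → Cut A M a) → k * (1 + 4 * skel cs) ≤ length ps → Roots k ps
    roots zero ps uq sb cuts l = record { zs = [] ; count = refl ; zs⊆ = λ v → z≤n ; cand = λ z () }
    roots (suc k) ps uq sb cuts l = go (cut-suffix (k * (1 + 4 * skel cs)) ps (≤-trans (m≤n+m _ (1 + 4 * skel cs)) l))
      where
      go : (Σ[ as ∈ List V ] Σ[ bs ∈ List V ] (ps ≡ as ++ bs) × (length bs ≡ k * (1 + 4 * skel cs)))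
          → Roots (suc k) ps
      go (as , bs , refl , lenB) = join (found as (Uniq-++ˡ as bs uq) (λ v → ≤-trans (a⊆ v) (sb v))
          (λ a m → cuts a (∈-++ˡ as bs m))
          (+-cancelʳ-≤ (k * (1 + 4 * skel cs)) _ _
              (≤-trans l (≤-reflexive (trans (length-++ as) (cong (length as +_) lenB))))))
        (roots k bs (Uniq-++ʳ as bs uq) (λ v → ≤-trans (b⊆ v) (sb v)) (λ a m → cuts a (∈-++ʳ as bs m))
            (≤-reflexive (sym lenB)))
        where
        a⊆ : as ⊆ (as ++ bs)
        a⊆ v = ≤-trans (m≤m+n _ (# v bs)) (≤-reflexive (sym (cnt-++ (v ==_) as bs)))
        b⊆ : bs ⊆ (as ++ bs)
        b⊆ v = ≤-trans (m≤n+m _ (# v as)) (≤-reflexive (sym (cnt-++ (v ==_) as bs)))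
        apart : ∀ v → v ∈ as → # v bs ≡ 0
        apart v m = n≤0⇒n≡0 (lin (# v bs ∷ # v (as ++ bs) ∷ # v as ∷ []) (x₁ ⊑ con 1 ⊢ x₂ ⊕ x₀ ⊑ x₁ ⊢ con 1 ⊑ x₂
            ⊢ ⊩ x₀ ⊑ con 0) refl (uq v) (≥-reflexive (cnt-++ (v ==_) as bs)) m)
        apart′ : ∀ v → v ∈ bs → # v as ≡ 0
        apart′ v m = n≤0⇒n≡0 (lin (# v as ∷ # v (as ++ bs) ∷ # v bs ∷ []) (x₁ ⊑ con 1 ⊢ x₀ ⊕ x₂ ⊑ x₁ ⊢ con 1 ⊑ x₂
            ⊢ ⊩ x₀ ⊑ con 0) refl (uq v) (≥-reflexive (cnt-++ (v ==_) as bs)) m)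
        join : (Σ[ z ∈ V ] (z ∈ as) × Found as z) → Roots k bs → Roots (suc k) (as ++ bs)
        join (z₀ , m₀ , C₀ , S₀⊆) record { zs = zs ; count = count ; zs⊆ = zs⊆ ; cand = cand } = record
          { zs = z₀ ∷ zs ; count = cong suc count
          ; zs⊆ = λ v → ≤-trans (+-mono-≤ (≤-trans (≤-reflexive (sym (+-identityʳ _))) (single z₀ as m₀ v)) (zs⊆ v))
              (≤-reflexive (sym (cnt-++ (v ==_) as bs)))
          ; cand = λ z m → pick z m (z ≟ z₀) }
          where
          pick : ∀ z → z ∈ (z₀ ∷ zs) → Dec (z ≡ z₀) →
            Σ[ f ∈ Found (as ++ bs) z ] (∀ u → u ∈ (z₀ ∷ zs) → u ≢ z → # u (Candidate.S (proj₁ f)) ≡ 0)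
          pick .z₀ m (yes refl) = (C₀ , λ v → ≤-trans (S₀⊆ v) (a⊆ v)) , λ u mu ne →
            n≤0⇒n≡0 (≤-trans (S₀⊆ u) (≤-reflexive (apart′ u (≤-trans (≢-∈-∷ z₀ zs ne mu) (zs⊆ u)))))
          pick z m (no n) with cand z (≢-∈-∷ z₀ zs n m)
          ... | (C , S⊆) , h = (C , λ v → ≤-trans (S⊆ v) (b⊆ v)) , λ u mu ne → other u ne (∈-uncons z₀ zs mu)
            where
            other : ∀ u → u ≢ z → (u ≡ z₀) ⊎ (u ∈ zs) → # u (Candidate.S C) ≡ 0
            other u ne (inj₁ refl) = n≤0⇒n≡0 (≤-trans (S⊆ u) (≤-reflexive (apart u m₀)))
            other u ne (inj₂ k) = h u k ne

    zoned : Picks (7 * (1 + 4 * skel cs)) A M → Zoned (node (flats cs)) xs A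
    zoned (ps , len , sb , cuts) = go (roots 7 ps uqP sb cuts (≤-reflexive (sym len)))
      where
      uqP : Uniq ps
      uqP v = ≤-trans (sb v) (lin (# v M ∷ # v (L ++ M ++ R) ∷ # v L ∷ # v R ∷ []) (x₁ ⊑ con 1 ⊢ x₂ ⊕ (x₀ ⊕ x₃) ⊑ x₁
          ⊢ ⊩ x₀ ⊑ con 1) refl (uniqX v) (≥-reflexive (#-xs v)))
      go : Roots 7 ps → Zoned (node (flats cs)) xs A
      go record { zs = zs ; count = count ; zs⊆ = zs⊆ ; cand = cand } = record
        { zs = zs ; uniqᶻ = λ v → ≤-trans (zs⊆ v) (uqP v) ; big = ≤-reflexive (sym count)
        ; cand = λ z m → proj₁ (proj₁ (cand z m)) ; apart = λ z m → proj₂ (cand z m) }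

  margins : ∀ o cs → margin (not o) cs + (7 * (1 + 4 * skel cs) + margin o cs) ≤ need (core cs)
  margins true cs = lin (skel cs ∷ sideN (not true) cs ∷ sideN true cs ∷ stemN cs ∷ []) (x₂ ⊕ x₁ ⊑ x₃
      ⊢ ⊩ con 65 ⊕ (x₀ ⊕ 19 ⊛ x₀ ⊕ x₁) ⊕ (7 ⊛ (con 1 ⊕ 4 ⊛ x₀) ⊕ (con 65 ⊕ (x₀ ⊕ 19 ⊛ x₀ ⊕ x₂))) ⊑ con 137
      ⊕ (x₀ ⊕ 67 ⊛ x₀ ⊕ x₃)) refl (≤-reflexive (side-split cs))
  margins false cs = lin (skel cs ∷ sideN (not false) cs ∷ sideN false cs ∷ stemN cs ∷ []) (x₁ ⊕ x₂ ⊑ x₃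
      ⊢ ⊩ con 65 ⊕ (x₀ ⊕ 19 ⊛ x₀ ⊕ x₁) ⊕ (7 ⊛ (con 1 ⊕ 4 ⊛ x₀) ⊕ (con 65 ⊕ (x₀ ⊕ 19 ⊛ x₀ ⊕ x₂))) ⊑ con 137
      ⊕ (x₀ ⊕ 67 ⊛ x₀ ⊕ x₃)) refl (≤-reflexive (side-split cs))

  claim-core : ∀ cs → Claims cs → Claim (core cs)
  claim-core cs cl o xs A md uq rm = go (room-split A (margin (not o) cs) (w + margin o cs) xs
      (room (≤-trans (+-monoˡ-≤ (10 * cnt A xs) (margins o cs)) (fits rm))))
    where
    w : ℕ
    w = 7 * (1 + 4 * skel cs)
    go : Split (margin (not o) cs) (w + margin o cs) A xs → Zoned (node (flats cs)) xs A
    go (L , X , refl , r₁ , r₂) = go′ (room-split A w (margin o cs) X r₂)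
      where
      go′ : Split w (margin o cs) A X → Zoned (node (flats cs)) (L ++ X) A
      go′ (M , R , refl , r₃ , r₄) = Build.zoned cs cl o A L M R md uq r₁ r₄ (room-picks A w M r₃)

  mutual
    claim : ∀ c → Claim c
    claim (core cs) = claim-core cs (claims cs)

    claims : ∀ cs → Claims cs
    claims [] = tt
    claims (sub s (core cs′) ∷ cs) = claims cs′ , claims cs
    claims (dir s m c ∷ cs) = claim c , claims cs
    claims (zig d s w et c ∷ cs) = claim c , claims cs

-- Decomposing a tree, and bounding the positions by its size and leaves.

module Planting where
  open Trees

  mutual
    size : Tree → ℕ
    size (node ts) = suc (sizes ts)

    sizes : List (Bool × Tree) → ℕ
    sizes [] = 0
    sizes ((s , t) ∷ ts) = size t + sizes ts

  mutual
    leaves : Tree → ℕ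
    leaves (node []) = 1
    leaves (node (b ∷ ts)) = leavesF (b ∷ ts)

    leavesF : List (Bool × Tree) → ℕ
    leavesF [] = 0
    leavesF ((s , t) ∷ ts) = leaves t + leavesF ts

  1≤leaves : ∀ t → 1 ≤ leaves t
  1≤leaves (node []) = ≤-refl
  1≤leaves (node ((s , t) ∷ ts)) = ≤-trans (1≤leaves t) (m≤m+n _ (leavesF ts))

  cost : List Child → ℕ
  cost cs = 68 * skel cs + stemN cs

  costC : Core → ℕ
  costC (core cs) = cost cs

  need-cost : ∀ c → need c ≡ 137 + costC c
  need-cost (core cs) = +-assoc 137 (68 * skel cs) (stemN cs)

  -- `k` is the price of the path beyond the number of its edges, wherever it is cut into children.
  Plant : Bool → List Bool → ℕ → Set
  Plant s w k = ∀ c → Σ[ ch ∈ Child ] (flatC ch ≡ graft s w (flat c))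
      × (cost (ch ∷ []) ≤ costC c + (suc (length w) + k))

  plant-mono : ∀ s w k k′ → k ≤ k′ → Plant s w k → Plant s w k′
  plant-mono s w k k′ l p c = let ch , eq , b = p c in ch , eq , ≤-trans b (+-monoʳ-≤ (costC c) (+-monoʳ-≤ (suc (length w)) l))

  graft-++ : ∀ s w s′ w′ t → graft s (w ++ s′ ∷ w′) t ≡ graft s w (node (graft s′ w′ t ∷ []))
  graft-++ s [] s′ w′ t = refl
  graft-++ s (x ∷ w) s′ w′ t = cong (λ b → s , node (b ∷ [])) (graft-++ x w s′ w′ t)

  plant-edge : ∀ s → Plant s [] 67
  plant-edge s (core cs) = sub s (core cs) ,
      refl , lin (skel cs ∷ stemN cs ∷ [])
      (⊩ con 1 ⊕ (x₀ ⊕ con 0 ⊕ 67 ⊛ (con 1 ⊕ (x₀ ⊕ con 0)) ⊕ (x₁ ⊕ con 0)) ⊑ x₀ ⊕ 67 ⊛ x₀ ⊕ x₁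
      ⊕ (con 1 ⊕ con 0 ⊕ con 67)) refl

  plant-++ : ∀ s w k s′ w′ k′ → Plant s w k → Plant s′ w′ k′ → Plant s (w ++ s′ ∷ w′) (k + k′)
  plant-++ s w k s′ w′ k′ p q c = go (q c)
    where
    Goal = Σ[ ch ∈ Child ] (flatC ch ≡ graft s (w ++ s′ ∷ w′) (flat c))
        × (cost (ch ∷ []) ≤ costC c + (suc (length (w ++ s′ ∷ w′)) + (k + k′)))
    go : (Σ[ ch ∈ Child ] (flatC ch ≡ graft s′ w′ (flat c)) × (cost (ch ∷ []) ≤ costC c + (suc (length w′) + k′)))
        → Goal
    go (ch′ , eq′ , b′) = go′ (p (core (ch′ ∷ [])))
      where
      go′ : (Σ[ ch ∈ Child ] (flatC ch ≡ graft s w (flat (core (ch′ ∷ []))))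
          × (cost (ch ∷ []) ≤ cost (ch′ ∷ []) + (suc (length w) + k))) → Goal
      go′ (ch , eq , b) = ch , trans eq (trans (cong (λ b → graft s w (node (b ∷ []))) eq′)
          (sym (graft-++ s w s′ w′ (flat c)))) ,
        bound (cost (ch ∷ [])) (cost (ch′ ∷ [])) (costC c) b b′
        where
        bound : ∀ x y z → x ≤ y + (suc (length w) + k) → y ≤ z + (suc (length w′) + k′)
            → x ≤ z + (suc (length (w ++ s′ ∷ w′)) + (k + k′))
        bound x y z b b′ = lin (x ∷ z ∷ length (w ++ s′ ∷ w′) ∷ k ∷ k′ ∷ y ∷ length w ∷ length w′ ∷ [])
            (x₀ ⊑ x₅ ⊕ (con 1 ⊕ x₆ ⊕ x₃) ⊢ x₅ ⊑ x₁ ⊕ (con 1 ⊕ x₇ ⊕ x₄) ⊢ x₆ ⊕ (con 1 ⊕ x₇) ⊑ x₂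
            ⊢ ⊩ x₀ ⊑ x₁ ⊕ (con 1 ⊕ x₂ ⊕ (x₃ ⊕ x₄))) refl b b′ (≥-reflexive (length-++ w {s′ ∷ w′}))

  -- Up to five edges go into the window, at `67` each beyond the edge itself. From six edges on
  -- there is a directed child, whose fixed price `80 + 1 + 137` stays below `6 + 335`.
  plant-run : ∀ s q → Plant s (replicate q s) 335
  plant-run s 0 = plant-mono s [] 67 335 (m≤m+n 67 _) (plant-edge s)
  plant-run s 1 = plant-mono s (s ∷ []) 134 335 (m≤m+n 134 _) (plant-++ s [] 67 s [] 67 (plant-edge s) (plant-edge s))
  plant-run s 2 = plant-mono s (s ∷ s ∷ []) 201 335 (m≤m+n 201 _) (plant-++ s [] 67 s (s ∷ []) 134 (plant-edge s)
    (plant-++ s [] 67 s [] 67 (plant-edge s) (plant-edge s)))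
  plant-run s 3 = plant-mono s (s ∷ s ∷ s ∷ []) 268 335 (m≤m+n 268 _)
      (plant-++ s [] 67 s (s ∷ s ∷ []) 201 (plant-edge s) (plant-++ s [] 67 s (s ∷ []) 134 (plant-edge s)
    (plant-++ s [] 67 s [] 67 (plant-edge s) (plant-edge s))))
  plant-run s 4 = plant-++ s [] 67 s (s ∷ s ∷ s ∷ []) 268 (plant-edge s)
      (plant-++ s [] 67 s (s ∷ s ∷ []) 201 (plant-edge s) (plant-++ s [] 67 s (s ∷ []) 134 (plant-edge s)
    (plant-++ s [] 67 s [] 67 (plant-edge s) (plant-edge s))))
  plant-run s (suc (suc (suc (suc (suc m))))) c = dir s m c ,
      refl , bound (need c) (costC c) m (length (replicate m s)) (need-cost c) (len m)
    where
    len : ∀ m → length (replicate m s) ≡ m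
    len zero = refl
    len (suc m) = cong suc (len m)
    bound : ∀ n k m l → n ≡ 137 + k → l ≡ m → 80 + (1 + (m + n)) + 0 ≤ k + (suc (5 + l) + 335)
    bound n k m l p q = lin (m ∷ n ∷ k ∷ l ∷ []) (x₁ ⊑ con 137 ⊕ x₂ ⊢ x₀ ⊑ x₃
        ⊢ ⊩ con 81 ⊕ (x₀ ⊕ x₁) ⊕ con 0 ⊑ x₂ ⊕ (con 6 ⊕ x₃ ⊕ con 335)) refl (≤-reflexive p) (≥-reflexive q)

  -- Two reserved neighbours cost `136`, both sides `80`, the path and its core another `3 + 137`.
  -- Of these `356`, three are covered by the edges.
  plant-zig : ∀ d s w → EndsTurn (s ∷ not s ∷ w) → Plant d (s ∷ not s ∷ w) 353
  plant-zig d s w et c = zig d s w et c , refl , bound (need c) (costC c) (length w) (need-cost c)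
    where
    bound : ∀ n k l → n ≡ 137 + k → 136 + (80 + (3 + l + n) + 0) ≤ k + (suc (2 + l) + 353)
    bound n k l p = lin (l ∷ n ∷ k ∷ []) (x₁ ⊑ con 137 ⊕ x₂
        ⊢ ⊩ con 136 ⊕ (con 80 ⊕ (con 3 ⊕ x₀ ⊕ x₁) ⊕ con 0) ⊑ x₂ ⊕ (con 3 ⊕ x₀ ⊕ con 353)) refl (≤-reflexive p)

  -- A zigzag must turn right after its second edge, so all but the last two edges of the opening
  -- run are split off as a run of their own.
  plant-run-zig : ∀ t u → EndsTurn (t ∷ t ∷ u) → Plant t (t ∷ u) 688
  plant-run-zig t u et = go t u et λ s r → plant-mono s (s ∷ not s ∷ r) 353 688 (m≤m+n 353 _)
    where
    Parse : Bool → List Bool → Set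
    Parse t u = Σ[ q ∈ ℕ ] Σ[ r ∈ List Bool ] (t ∷ u ≡ replicate q t ++ t ∷ not t ∷ r) × EndsTurn (t ∷ not t ∷ r)
    parse : ∀ t u → EndsTurn (t ∷ t ∷ u) → Parse t u
    parse true [] (true ∷ (_ ∷ ()))
    parse false [] (false ∷ (_ ∷ ()))
    parse t (r ∷ u) (_ ∷ et) with same? t r
    ... | inj₂ refl = 0 , u , refl , et
    ... | inj₁ refl with parse t u et
    ...   | q , r′ , eq , et′ = suc q , r′ , cong (t ∷_) eq , et′
    go : ∀ t u → EndsTurn (t ∷ t ∷ u) → (∀ s r → Plant s (s ∷ not s ∷ r) 353 → Plant s (s ∷ not s ∷ r) 688)
        → Plant t (t ∷ u) 688
    go t u et up with parse t u et
    ... | zero , r , eq , et′ = subst (λ w → Plant t w 688) (sym eq) (up t r (plant-zig t t r et′))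
    ... | suc q , r , eq , et′ = subst (λ w → Plant t w 688) (sym eq)
      (subst (λ w → Plant t w 688) (shift q) (plant-++ t (replicate q t) 335 t (t ∷ not t ∷ r) 353 (plant-run t q)
          (plant-zig t t r et′)))
      where
      shift : ∀ q → replicate q t ++ t ∷ t ∷ not t ∷ r ≡ t ∷ (replicate q t ++ t ∷ not t ∷ r)
      shift zero = refl
      shift (suc q) = cong (t ∷_) (shift q)

  plant-turn : ∀ s u → EndsTurn (s ∷ u) → Plant s u 755
  plant-turn s .(not s ∷ []) (turn .s) = plant-mono s (not s ∷ []) 134 755 (m≤m+n 134 _)
      (plant-++ s [] 67 (not s) [] 67 (plant-edge s) (plant-edge (not s)))
  plant-turn s (t ∷ []) (.s ∷ (.t ∷ ()))
  plant-turn s (t ∷ r ∷ u) (.s ∷ et) with same? t r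
  ... | inj₂ refl = plant-mono s (t ∷ not t ∷ u) 353 755 (m≤m+n 353 _) (plant-zig s t u et)
  ... | inj₁ refl = plant-++ s [] 67 t (t ∷ u) 688 (plant-edge s) (plant-run-zig t u et)

  -- The path is cut at its last turn, behind which a run remains. The price is that of an edge, a
  -- run, a zigzag and the final run: `67 + 335 + 353 + 335`.
  plant : ∀ s w → Plant s w 1090
  plant s w = go (parse s w)
    where
    Parse : Bool → List Bool → Set
    Parse s w = (w ≡ replicate (length w) s) ⊎ (Σ[ u ∈ List Bool ] Σ[ t ∈ Bool ] Σ[ m ∈ ℕ ] (w ≡ u ++ replicate m t)
        × EndsTurn (s ∷ u))
    parse : ∀ s w → Parse s w
    parse s [] = inj₁ refl
    parse s (t ∷ w) with parse t w
    ... | inj₂ (u , t′ , m , eq , et) = inj₂ (t ∷ u , t′ , m , cong (t ∷_) eq , s ∷ et)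
    ... | inj₁ eq with same? s t
    ...   | inj₁ refl = inj₁ (cong (s ∷_) eq)
    ...   | inj₂ refl = inj₂ (not s ∷ [] , not s , length w , cong (not s ∷_) eq , turn s)
    go : Parse s w → Plant s w 1090
    go (inj₁ eq) = subst (λ w → Plant s w 1090) (sym eq)
        (plant-mono s (replicate (length w) s) 335 1090 (m≤m+n 335 _) (plant-run s (length w)))
    go (inj₂ (u , t , zero , refl , et)) = subst (λ w → Plant s w 1090) (sym (++-identityʳ u))
        (plant-mono s u 755 1090 (m≤m+n 755 _) (plant-turn s u et))
    go (inj₂ (u , t , suc m , refl , et)) = plant-++ s u 755 t (replicate m t) 335 (plant-turn s u et) (plant-run t m)

  module Decompose (K : ℕ) (big : 1092 ≤ K) where

    -- The `K` on the left is a credit handed upwards. A leaf brings in `2 * K`; a branching vertex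
    -- collects at least two credits and hands on one. In both cases one `K` is set free to pay for
    -- the path above.
    Dec-C : Bool → List Bool → Tree → Set
    Dec-C s w t = Σ[ ch ∈ Child ] (flatC ch ≡ graft s w t)
        × (cost (ch ∷ []) + K ≤ suc (length w) + size t + 2 * (K * leaves t))

    Dec-F : List (Bool × Tree) → Set
    Dec-F ts = Σ[ cs ∈ List Child ] (flats cs ≡ ts)
        × (cost cs + K * length ts ≤ length ts + sizes ts + 2 * (K * leavesF ts))

    planted : ∀ s w ts cs → flats cs ≡ ts → cost cs + K + 1090 ≤ size (node ts) + 2 * (K * leaves (node ts))
        → Dec-C s w (node ts)
    planted s w ts cs refl b = go (plant s w (core cs))
      where
      go : (Σ[ ch ∈ Child ] (flatC ch ≡ graft s w (node ts)) × (cost (ch ∷ []) ≤ cost cs + (suc (length w) + 1090)))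
          → Dec-C s w (node ts)
      go (ch , eq , b′) = ch , eq , bound (cost (ch ∷ [])) (cost cs) (size (node ts)) (2 * (K * leaves (node ts))) b
          b′
        where
        bound : ∀ x c n l → c + K + 1090 ≤ n + l → x ≤ c + (suc (length w) + 1090) → x + K ≤ suc (length w) + n + l
        bound x c n l b b′ = lin (x ∷ K ∷ length w ∷ n ∷ l ∷ c ∷ []) (x₅ ⊕ x₁ ⊕ con 1090 ⊑ x₃ ⊕ x₄
            ⊢ x₀ ⊑ x₅ ⊕ (con 1 ⊕ x₂ ⊕ con 1090) ⊢ ⊩ x₀ ⊕ x₁ ⊑ con 1 ⊕ x₂ ⊕ x₃ ⊕ x₄) refl b b′

    cost-∷ : ∀ ch cs → cost (ch ∷ cs) ≡ cost (ch ∷ []) + cost cs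
    cost-∷ (sub s (core cs′)) cs = ≤-antisym
        (lin (skel cs′ ∷ skel cs ∷ stemN cs′ ∷ stemN cs ∷ [])
        (⊩ con 1 ⊕ (x₀ ⊕ x₁ ⊕ 67 ⊛ (con 1 ⊕ (x₀ ⊕ x₁)) ⊕ (x₂ ⊕ x₃)) ⊑ con 1
        ⊕ (x₀ ⊕ con 0 ⊕ 67 ⊛ (con 1 ⊕ (x₀ ⊕ con 0)) ⊕ (x₂ ⊕ con 0)) ⊕ (x₁ ⊕ 67 ⊛ x₁ ⊕ x₃)) refl)
        (lin (skel cs′ ∷ stemN cs′ ∷ skel cs ∷ stemN cs ∷ [])
        (⊩ con 1 ⊕ (x₀ ⊕ con 0 ⊕ 67 ⊛ (con 1 ⊕ (x₀ ⊕ con 0)) ⊕ (x₁ ⊕ con 0)) ⊕ (x₂ ⊕ 67 ⊛ x₂ ⊕ x₃) ⊑ con 1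
        ⊕ (x₀ ⊕ x₂ ⊕ 67 ⊛ (con 1 ⊕ (x₀ ⊕ x₂)) ⊕ (x₁ ⊕ x₃))) refl)
    cost-∷ (dir s m c) cs = ≤-antisym
        (lin (skel cs ∷ m ∷ need c ∷ stemN cs ∷ [])
        (⊩ x₀ ⊕ 67 ⊛ x₀ ⊕ (con 81 ⊕ (x₁ ⊕ x₂ ⊕ x₃)) ⊑ con 81 ⊕ (x₁ ⊕ x₂ ⊕ con 0) ⊕ (x₀ ⊕ 67 ⊛ x₀ ⊕ x₃)) refl)
        (lin (m ∷ need c ∷ skel cs ∷ stemN cs ∷ [])
        (⊩ con 81 ⊕ (x₀ ⊕ x₁ ⊕ con 0) ⊕ (x₂ ⊕ 67 ⊛ x₂ ⊕ x₃) ⊑ x₂ ⊕ 67 ⊛ x₂ ⊕ (con 81 ⊕ (x₀ ⊕ x₁ ⊕ x₃))) refl)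
    cost-∷ (zig d s w et c) cs = ≤-antisym
        (lin (skel cs ∷ length w ∷ need c ∷ stemN cs ∷ [])
        (⊩ con 2 ⊕ (x₀ ⊕ 67 ⊛ (con 2 ⊕ x₀) ⊕ (con 83 ⊕ (x₁ ⊕ x₂ ⊕ x₃))) ⊑ con 219 ⊕ (x₁ ⊕ x₂ ⊕ con 0)
        ⊕ (x₀ ⊕ 67 ⊛ x₀ ⊕ x₃)) refl) (lin (length w ∷ need c ∷ skel cs ∷ stemN cs ∷ [])
        (⊩ con 219 ⊕ (x₀ ⊕ x₁ ⊕ con 0) ⊕ (x₂ ⊕ 67 ⊛ x₂ ⊕ x₃) ⊑ con 2
        ⊕ (x₂ ⊕ 67 ⊛ (con 2 ⊕ x₂) ⊕ (con 83 ⊕ (x₀ ⊕ x₁ ⊕ x₃)))) refl)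

    mutual
      -- Vertices with a single child are collected in `w` until a leaf or a branching vertex ends
      -- the path.
      decompose : ∀ t s w → Dec-C s w t
      decompose (node []) s w = planted s w [] [] refl
          (lin (K ∷ K * leaves (node []) ∷ []) (con 1092 ⊑ x₀ ⊢ 2 ⊛ x₀ ⊑ 2 ⊛ x₁
          ⊢ ⊩ con 0 ⊕ x₀ ⊕ con 1090 ⊑ con 1 ⊕ 2 ⊛ x₁) refl big (≥-reflexive (cong (2 *_) (*-identityʳ K))))
      decompose (node ((s′ , t) ∷ [])) s w = go (decompose t s (w ++ s′ ∷ []))
        where
        go : Dec-C s (w ++ s′ ∷ []) t → Dec-C s w (node ((s′ , t) ∷ []))
        go (ch , eq , b) = ch , trans eq (graft-++ s w s′ [] t) , bound (cost (ch ∷ [])) (size t) (leaves t) b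
          where
          bound : ∀ x n l → x + K ≤ suc (length (w ++ s′ ∷ [])) + n + 2 * (K * l) → x + K ≤ suc (length w) + suc
              (n + 0) + 2 * (K * (l + 0))
          bound x n l b = subst (λ l′ → x + K ≤ suc (length w) + suc (n + 0) + 2 * (K * l′)) (sym (+-identityʳ l))
              (lin (x ∷ K ∷ length w ∷ n ∷ K * l ∷ length (w ++ s′ ∷ []) ∷ []) (x₀ ⊕ x₁ ⊑ con 1 ⊕ x₅ ⊕ x₃ ⊕ 2 ⊛ x₄
              ⊢ x₅ ⊑ x₂ ⊕ con 1 ⊢ ⊩ x₀ ⊕ x₁ ⊑ con 1 ⊕ x₂ ⊕ (con 1 ⊕ (x₃ ⊕ con 0)) ⊕ 2 ⊛ x₄)
              refl b (≤-reflexive (length-++ w {s′ ∷ []})))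
      decompose (node ts@(_ ∷ _ ∷ us)) s w = go (decomposeF ts)
        where
        go : Dec-F ts → Dec-C s w (node ts)
        go (cs , eq , b) = planted s w ts cs eq (bound (cost cs) (sizes ts) (K * leavesF ts) (length us) b
            (m≤n*m≡ (length us)))
          where
          m≤n*m≡ : ∀ r → r ≤ K * r
          m≤n*m≡ r = ≤-trans (≤-reflexive (sym (*-identityˡ r))) (*-monoˡ-≤ r (≤-trans (m≤m+n 1 1091) big))
          -- Two children set one `K` free, and `1092` covers the `1090` of the path and the term
          -- `2` for the edges to these children. Each further child pays its own edge with its
          -- credit.
          bound : ∀ c n l r → c + K * suc (suc r) ≤ suc (suc r) + n + 2 * l → r ≤ K * r → c + K + 1090 ≤ suc n + 2 * l
          bound c n l r b h = lin (c ∷ K ∷ n ∷ l ∷ K * suc (suc r) ∷ r ∷ K * r ∷ K * suc r ∷ [])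
              (x₀ ⊕ x₄ ⊑ con 2 ⊕ x₅ ⊕ x₂ ⊕ 2 ⊛ x₃ ⊢ x₅ ⊑ x₆ ⊢ con 1092 ⊑ x₁ ⊢ x₁ ⊕ x₇ ⊑ x₄ ⊢ x₁ ⊕ x₆ ⊑ x₇
              ⊢ ⊩ x₀ ⊕ x₁ ⊕ con 1090 ⊑ con 1 ⊕ x₂ ⊕ 2 ⊛ x₃)
              refl b h big (≥-reflexive (*-suc K (suc r))) (≥-reflexive (*-suc K r))

      decomposeF : ∀ ts → Dec-F ts
      decomposeF [] = [] , refl , lin (K * 0 ∷ []) (x₀ ⊑ con 0 ⊢ ⊩ con 0 ⊕ x₀ ⊑ con 0 ⊕ con 0 ⊕ 2 ⊛ x₀)
          refl (≤-reflexive (*-zeroʳ K))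
      decomposeF ((s , t) ∷ ts) = go (decompose t s []) (decomposeF ts)
        where
        go : Dec-C s [] t → Dec-F ts → Dec-F ((s , t) ∷ ts)
        go (ch , eq , b) (cs , eqs , b′) = ch ∷ cs , cong₂ _∷_ eq eqs ,
          ≤-trans (+-monoˡ-≤ (K * suc (length ts)) (≤-reflexive (cost-∷ ch cs)))
            (bound (cost (ch ∷ [])) (cost cs) (length ts) (size t) (sizes ts) (leaves t) (leavesF ts) b b′)
          where
          bound : ∀ x y r n n′ l l′ → x + K ≤ suc 0 + n + 2 * (K * l) → y + K * r ≤ r + n′ + 2 * (K * l′) →
            x + y + K * suc r ≤ suc r + (n + n′) + 2 * (K * (l + l′))
          bound x y r n n′ l l′ b b′ = lin (x ∷ y ∷ K * suc r ∷ r ∷ n ∷ n′ ∷ K * (l + l′) ∷ K ∷ K * l ∷ K * r ∷ K *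
              l′ ∷ []) (x₀ ⊕ x₇ ⊑ con 1 ⊕ con 0 ⊕ x₄ ⊕ 2 ⊛ x₈ ⊢ x₁ ⊕ x₉ ⊑ x₃ ⊕ x₅ ⊕ 2 ⊛ x₁₀ ⊢ x₂ ⊑ x₇ ⊕ x₉
              ⊢ 2 ⊛ (x₈ ⊕ x₁₀) ⊑ 2 ⊛ x₆ ⊢ ⊩ x₀ ⊕ x₁ ⊕ x₂ ⊑ con 1 ⊕ x₃ ⊕ (x₄ ⊕ x₅) ⊕ 2 ⊛ x₆)
              refl b b′ (≤-reflexive (*-suc K r)) (≥-reflexive (cong (2 *_) (*-distribˡ-+ K l l′)))

    core-of : ∀ t → Σ[ c ∈ Core ] (flat c ≡ t) × (need c ≤ 137 + size t + 2 * (K * leaves t))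
    core-of (node []) = core [] , refl , lin (K * leaves (node []) ∷ []) (⊩ con 137 ⊑ con 137 ⊕ con 1 ⊕ 2 ⊛ x₀) refl
    core-of (node ts@(_ ∷ _)) = go (decomposeF ts)
      where
      go : Dec-F ts → Σ[ c ∈ Core ] (flat c ≡ node ts) × (need c ≤ 137 + size (node ts) + 2 * (K * leaves (node ts)))
      go (cs , eq , b) = core cs , cong node eq , ≤-trans (≤-reflexive (need-cost (core cs)))
          (bound (cost cs) (length ts) (sizes ts) (2 * (K * leavesF ts)) b
          (≤-trans (≤-reflexive (sym (*-identityˡ (length ts))))
              (*-monoˡ-≤ (length ts) (≤-trans (m≤m+n 1 1091) big))))
        where
        bound : ∀ c r n l → c + K * r ≤ r + n + l → r ≤ K * r → 137 + c ≤ 137 + suc n + l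
        bound c r n l b h = lin (c ∷ n ∷ l ∷ K * r ∷ r ∷ []) (x₀ ⊕ x₃ ⊑ x₄ ⊕ x₁ ⊕ x₂ ⊢ x₄ ⊑ x₃
            ⊢ ⊩ con 137 ⊕ x₀ ⊑ con 138 ⊕ x₁ ⊕ x₂) refl b h

-- Rooted trees with labelled vertices.

module Labelled {A : Set} (_≟_ : DecidableEquality A) where
  open Counting _≟_
  open Trees using (Tree; node)
  open Planting using (leaves; leavesF; size; sizes)

  data LTree : Set where
    node : A → List (Bool × LTree) → LTree

  mutual
    shape : LTree → Tree
    shape (node a ts) = node (shapes ts)

    shapes : List (Bool × LTree) → List (Bool × Tree)
    shapes [] = []
    shapes ((s , t) ∷ ts) = (s , shape t) ∷ shapes ts

  mutual
    labels : LTree → List A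
    labels (node a ts) = a ∷ labelsF ts

    labelsF : List (Bool × LTree) → List A
    labelsF [] = []
    labelsF ((s , t) ∷ ts) = labels t ++ labelsF ts

  mutual
    ends : LTree → List A
    ends (node a []) = a ∷ []
    ends (node a (b ∷ ts)) = endsF (b ∷ ts)

    endsF : List (Bool × LTree) → List A
    endsF [] = []
    endsF ((s , t) ∷ ts) = ends t ++ endsF ts

  top : LTree → A
  top (node a ts) = a

  Root : List (Bool × LTree) → Bool → A → Set
  Root [] s c = ⊥
  Root ((s′ , t) ∷ ts) s c = ((s ≡ s′) × (c ≡ top t)) ⊎ Root ts s c

  mutual
    Link : LTree → A → Bool → A → Set
    Link (node a ts) p s c = ((p ≡ a) × Root ts s c) ⊎ LinkF ts p s c

    LinkF : List (Bool × LTree) → A → Bool → A → Set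
    LinkF [] p s c = ⊥
    LinkF ((s′ , t) ∷ ts) p s c = Link t p s c ⊎ LinkF ts p s c

  mutual
    size-labels : ∀ t → size (shape t) ≡ length (labels t)
    size-labels (node a ts) = cong suc (sizes-labels ts)

    sizes-labels : ∀ ts → sizes (shapes ts) ≡ length (labelsF ts)
    sizes-labels [] = refl
    sizes-labels ((s , t) ∷ ts) = trans (cong₂ _+_ (size-labels t) (sizes-labels ts)) (sym (length-++ (labels t)))

  mutual
    leaves-ends : ∀ t → leaves (shape t) ≡ length (ends t)
    leaves-ends (node a []) = refl
    leaves-ends (node a ((s , t) ∷ ts)) = leavesF-ends ((s , t) ∷ ts)

    leavesF-ends : ∀ ts → leavesF (shapes ts) ≡ length (endsF ts)
    leavesF-ends [] = refl
    leavesF-ends ((s , t) ∷ ts) = trans (cong₂ _+_ (leaves-ends t) (leavesF-ends ts)) (sym (length-++ (ends t)))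

  mutual
    ends⊆ : ∀ t → ends t ⊆ labels t
    ends⊆ (node a []) v = ≤-refl
    ends⊆ (node a (b ∷ ts)) v = ≤-trans (endsF⊆ (b ∷ ts) v) (m≤n+m _ (b2n (v == a)))

    endsF⊆ : ∀ ts → endsF ts ⊆ labelsF ts
    endsF⊆ [] v = z≤n
    endsF⊆ ((s , t) ∷ ts) v = lin (# v (endsF ((s , t) ∷ ts)) ∷ # v (labelsF ((s , t) ∷ ts)) ∷ # v (ends t) ∷ # v
        (labels t) ∷ # v (endsF ts) ∷ # v (labelsF ts) ∷ []) (x₂ ⊑ x₃ ⊢ x₄ ⊑ x₅ ⊢ x₀ ⊑ x₂ ⊕ x₄ ⊢ x₃ ⊕ x₅ ⊑ x₁
        ⊢ ⊩ x₀ ⊑ x₁) refl (ends⊆ t v) (endsF⊆ ts v) (≤-reflexive (cnt-++ (v ==_) (ends t) (endsF ts)))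
        (≥-reflexive (cnt-++ (v ==_) (labels t) (labelsF ts)))

  top∈ : ∀ t → top t ∈ labels t
  top∈ (node a ts) = ∈-here a (labelsF ts)

  root∈ : ∀ ts s c → Root ts s c → c ∈ labelsF ts
  root∈ ((s′ , t) ∷ ts) s c (inj₁ (_ , refl)) = ∈-++ˡ (labels t) (labelsF ts) (top∈ t)
  root∈ ((s′ , t) ∷ ts) s c (inj₂ r) = ∈-++ʳ (labels t) (labelsF ts) (root∈ ts s c r)

  mutual
    child∈ : ∀ a ts p s c → Link (node a ts) p s c → c ∈ labelsF ts
    child∈ a ts p s c (inj₁ (_ , r)) = root∈ ts s c r
    child∈ a ts p s c (inj₂ l) = childF∈ ts p s c l

    childF∈ : ∀ ts p s c → LinkF ts p s c → c ∈ labelsF ts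
    childF∈ ((s′ , node b us) ∷ ts) p s c (inj₁ l) = ∈-++ˡ (b ∷ us′) (labelsF ts)
        (∈-there b us′ (child∈ b us p s c l))
      where us′ = labelsF us
    childF∈ ((s′ , t) ∷ ts) p s c (inj₂ l) = ∈-++ʳ (labels t) (labelsF ts) (childF∈ ts p s c l)

  mutual
    parent∈ : ∀ t p s c → Link t p s c → p ∈ labels t
    parent∈ (node a ts) p s c (inj₁ (refl , _)) = ∈-here a (labelsF ts)
    parent∈ (node a ts) p s c (inj₂ l) = ∈-there a (labelsF ts) (parentF∈ ts p s c l)

    parentF∈ : ∀ ts p s c → LinkF ts p s c → p ∈ labelsF ts
    parentF∈ ((s′ , t) ∷ ts) p s c (inj₁ l) = ∈-++ˡ (labels t) (labelsF ts) (parent∈ t p s c l)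
    parentF∈ ((s′ , t) ∷ ts) p s c (inj₂ l) = ∈-++ʳ (labels t) (labelsF ts) (parentF∈ ts p s c l)

  child-label : ∀ t p s c → Link t p s c → c ∈ labels t
  child-label (node a ts) p s c l = ∈-there a (labelsF ts) (child∈ a ts p s c l)

  disjoint : ∀ xs ys v → Uniq (xs ++ ys) → v ∈ xs → v ∈ ys → ⊥
  disjoint xs ys v u m m′ = 1≰0 (lin (# v (xs ++ ys) ∷ # v xs ∷ # v ys ∷ []) (x₀ ⊑ con 1 ⊢ x₁ ⊕ x₂ ⊑ x₀ ⊢ con 1 ⊑ x₁
      ⊢ con 1 ⊑ x₂ ⊢ ⊩ con 1 ⊑ con 0) refl (u v) (≥-reflexive (cnt-++ (v ==_) xs ys)) m m′)

  twice : ∀ a xs → Uniq (a ∷ xs) → a ∈ xs → ⊥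
  twice a xs u m = 1≰0 (≤-trans m (≤-reflexive (Uniq-head a xs u)))

  mutual
    childless : ∀ t → Uniq (labels t) → ∀ v s c → v ∈ ends t → Link t v s c → ⊥
    childless (node a []) u v s c m (inj₁ (_ , ()))
    childless (node a []) u v s c m (inj₂ ())
    childless (node a (b ∷ ts)) u v s c m (inj₁ (refl , _)) = twice v (labelsF (b ∷ ts)) u
        (≤-trans m (endsF⊆ (b ∷ ts) v))
    childless (node a (b ∷ ts)) u v s c m (inj₂ l) = childlessF (b ∷ ts) (Uniq-tail a (labelsF (b ∷ ts)) u) v s c m l

    childlessF : ∀ ts → Uniq (labelsF ts) → ∀ v s c → v ∈ endsF ts → LinkF ts v s c → ⊥
    childlessF ((s′ , t) ∷ ts) u v s c m l = go (∈-++ (ends t) (endsF ts) m) l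
      where
      go : (v ∈ ends t) ⊎ (v ∈ endsF ts) → LinkF ((s′ , t) ∷ ts) v s c → ⊥
      go (inj₁ k) (inj₁ l) = childless t (Uniq-++ˡ (labels t) (labelsF ts) u) v s c k l
      go (inj₂ k) (inj₂ l) = childlessF ts (Uniq-++ʳ (labels t) (labelsF ts) u) v s c k l
      go (inj₁ k) (inj₂ l) = disjoint (labels t) (labelsF ts) v u (≤-trans k (ends⊆ t v)) (parentF∈ ts v s c l)
      go (inj₂ k) (inj₁ l) = disjoint (labels t) (labelsF ts) v u (parent∈ t v s c l) (≤-trans k (endsF⊆ ts v))

  top-no-child : ∀ t → Uniq (labels t) → ∀ p s → Link t p s (top t) → ⊥
  top-no-child (node a ts) u p s l = twice a (labelsF ts) u (child∈ a ts p s a l)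

  root-no-child : ∀ ts → Uniq (labelsF ts) → ∀ s c p s′ → Root ts s c → LinkF ts p s′ c → ⊥
  root-no-child ((_ , t) ∷ ts) u s c p s′ (inj₁ (_ , refl)) (inj₁ l) = top-no-child t
      (Uniq-++ˡ (labels t) (labelsF ts) u) p s′ l
  root-no-child ((_ , t) ∷ ts) u s c p s′ (inj₁ (_ , refl)) (inj₂ l) = disjoint (labels t) (labelsF ts) c u (top∈ t)
      (childF∈ ts p s′ c l)
  root-no-child ((_ , t) ∷ ts) u s c p s′ (inj₂ r) (inj₁ l) = disjoint (labels t) (labelsF ts) c u
      (child-label t p s′ c l) (root∈ ts s c r)
  root-no-child ((_ , t) ∷ ts) u s c p s′ (inj₂ r) (inj₂ l) = root-no-child ts (Uniq-++ʳ (labels t) (labelsF ts) u) s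
      c p s′ r l

  mutual
    one-parent : ∀ t → Uniq (labels t) → ∀ p s p′ s′ c → Link t p s c → Link t p′ s′ c → p ≡ p′
    one-parent (node a ts) u p s p′ s′ c (inj₁ (q , _)) (inj₁ (q′ , _)) = trans q (sym q′)
    one-parent (node a ts) u p s p′ s′ c (inj₁ (_ , r)) (inj₂ l) = ⊥-elim
        (root-no-child ts (Uniq-tail a (labelsF ts) u) s c p′ s′ r l)
    one-parent (node a ts) u p s p′ s′ c (inj₂ l) (inj₁ (_ , r)) = ⊥-elim
        (root-no-child ts (Uniq-tail a (labelsF ts) u) s′ c p s r l)
    one-parent (node a ts) u p s p′ s′ c (inj₂ l) (inj₂ l′) = one-parentF ts (Uniq-tail a (labelsF ts) u) p s p′ s′ c
        l l′

    one-parentF : ∀ ts → Uniq (labelsF ts) → ∀ p s p′ s′ c → LinkF ts p s c → LinkF ts p′ s′ c → p ≡ p′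
    one-parentF ((_ , t) ∷ ts) u p s p′ s′ c (inj₁ l) (inj₁ l′) = one-parent t (Uniq-++ˡ (labels t) (labelsF ts) u) p
        s p′ s′ c l l′
    one-parentF ((_ , t) ∷ ts) u p s p′ s′ c (inj₂ l) (inj₂ l′) = one-parentF ts (Uniq-++ʳ (labels t) (labelsF ts) u)
        p s p′ s′ c l l′
    one-parentF ((_ , t) ∷ ts) u p s p′ s′ c (inj₁ l) (inj₂ l′) = ⊥-elim
        (disjoint (labels t) (labelsF ts) c u (child-label t p s c l) (childF∈ ts p′ s′ c l′))
    one-parentF ((_ , t) ∷ ts) u p s p′ s′ c (inj₂ l) (inj₁ l′) = ⊥-elim
        (disjoint (labels t) (labelsF ts) c u (child-label t p′ s′ c l′) (childF∈ ts p s c l))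

  record Inserted (t : LTree) (p : A) (s : Bool) (v : A) : Set where
    field
      t′ : LTree
      labels≈ : labels t′ ≈ (v ∷ labels t)
      top≡ : top t′ ≡ top t
      keeps : ∀ x r y → Link t x r y → Link t′ x r y
      adds : Link t′ p s v

  record InsertedF (ts : List (Bool × LTree)) (p : A) (s : Bool) (v : A) : Set where
    field
      ts′ : List (Bool × LTree)
      labels≈ : labelsF ts′ ≈ (v ∷ labelsF ts)
      roots : ∀ r y → Root ts r y → Root ts′ r y
      keeps : ∀ x r y → LinkF ts x r y → LinkF ts′ x r y
      adds : LinkF ts′ p s v

  mutual
    insert : ∀ t p s v → p ∈ labels t → Inserted t p s v
    insert (node a ts) p s v m = go (p ≟ a)
      where
      lift : InsertedF ts p s v → Inserted (node a ts) p s v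
      lift record { ts′ = ts′ ; labels≈ = labels≈ ; roots = roots ; keeps = keeps ; adds = adds } = record
        { t′ = node a ts′
        ; labels≈ = λ q → ≤-antisym (lin (b2n (q a) ∷ cnt q (labelsF ts′) ∷ b2n (q v) ∷ cnt q (labelsF ts) ∷ [])
            (x₁ ⊑ x₂ ⊕ x₃ ⊢ ⊩ x₀ ⊕ x₁ ⊑ x₂ ⊕ (x₀ ⊕ x₃)) refl (≤-reflexive (labels≈ q)))
            (lin (b2n (q v) ∷ b2n (q a) ∷ cnt q (labelsF ts) ∷ cnt q (labelsF ts′) ∷ []) (x₀ ⊕ x₂ ⊑ x₃
            ⊢ ⊩ x₀ ⊕ (x₁ ⊕ x₂) ⊑ x₁ ⊕ x₃) refl (≥-reflexive (labels≈ q)))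
        ; top≡ = refl
        ; keeps = λ { x r y (inj₁ (e , k)) → inj₁ (e , roots r y k) ; x r y (inj₂ k) → inj₂ (keeps x r y k) }
        ; adds = inj₂ adds }
      go : Dec (p ≡ a) → Inserted (node a ts) p s v
      go (yes refl) = record
        { t′ = node a ((s , node v []) ∷ ts)
        ; labels≈ = λ q → ≤-antisym (lin (b2n (q a) ∷ b2n (q v) ∷ cnt q (labelsF [] ++ labelsF ts) ∷ [])
            (⊩ x₀ ⊕ (x₁ ⊕ x₂) ⊑ x₁ ⊕ (x₀ ⊕ x₂)) refl)
            (lin (b2n (q v) ∷ b2n (q a) ∷ cnt q (labelsF ts) ∷ []) (⊩ x₀ ⊕ (x₁ ⊕ x₂) ⊑ x₁ ⊕ (x₀ ⊕ x₂)) refl)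
        ; top≡ = refl
        ; keeps = λ { x r y (inj₁ (e , k)) → inj₁ (e , inj₂ k) ; x r y (inj₂ k) → inj₂ (inj₂ k) }
        ; adds = inj₁ (refl , inj₁ (refl , refl)) }
      go (no n) = lift (insertF ts p s v (≢-∈-∷ a (labelsF ts) n m))

    insertF : ∀ ts p s v → p ∈ labelsF ts → InsertedF ts p s v
    insertF ((s′ , t) ∷ ts) p s v m = go (∈-++ (labels t) (labelsF ts) m)
      where
      Goal = InsertedF ((s′ , t) ∷ ts) p s v
      inside : Inserted t p s v → Goal
      inside record { t′ = t′ ; labels≈ = labels≈ ; top≡ = top≡ ; keeps = keeps ; adds = adds } = record
        { ts′ = (s′ , t′) ∷ ts
        ; labels≈ = λ q → ≤-antisym
            (lin (cnt q (labelsF ((s′ , t′) ∷ ts)) ∷ b2n (q v) ∷ cnt q (labelsF ((s′ , t) ∷ ts)) ∷ cnt q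
                (labels t′) ∷ cnt q (labels t) ∷ cnt q (labelsF ts) ∷ []) (x₃ ⊑ x₁ ⊕ x₄ ⊢ x₀ ⊑ x₃ ⊕ x₅ ⊢ x₄ ⊕ x₅ ⊑ x₂
                ⊢ ⊩ x₀ ⊑ x₁ ⊕ x₂) refl (≤-reflexive (labels≈ q)) (≤-reflexive (cnt-++ q (labels t′) (labelsF ts)))
                (≥-reflexive (cnt-++ q (labels t) (labelsF ts))))
            (lin (b2n (q v) ∷ cnt q (labelsF ((s′ , t) ∷ ts)) ∷ cnt q (labelsF ((s′ , t′) ∷ ts)) ∷ cnt q
                (labels t′) ∷ cnt q (labels t) ∷ cnt q (labelsF ts) ∷ []) (x₀ ⊕ x₄ ⊑ x₃ ⊢ x₃ ⊕ x₅ ⊑ x₂ ⊢ x₁ ⊑ x₄ ⊕ x₅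
                ⊢ ⊩ x₀ ⊕ x₁ ⊑ x₂) refl (≥-reflexive (labels≈ q)) (≥-reflexive (cnt-++ q (labels t′) (labelsF ts)))
                (≤-reflexive (cnt-++ q (labels t) (labelsF ts))))
        ; roots = λ { r y (inj₁ (e , k)) → inj₁ (e , trans k (sym top≡)) ; r y (inj₂ k) → inj₂ k }
        ; keeps = λ { x r y (inj₁ k) → inj₁ (keeps x r y k) ; x r y (inj₂ k) → inj₂ k }
        ; adds = inj₁ adds }
      later : InsertedF ts p s v → Goal
      later record { ts′ = ts′ ; labels≈ = labels≈ ; roots = roots ; keeps = keeps ; adds = adds } = record
        { ts′ = (s′ , t) ∷ ts′
        ; labels≈ = λ q → ≤-antisym
            (lin (cnt q (labelsF ((s′ , t) ∷ ts′)) ∷ b2n (q v) ∷ cnt q (labelsF ((s′ , t) ∷ ts)) ∷ cnt q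
                (labelsF ts′) ∷ cnt q (labelsF ts) ∷ cnt q (labels t) ∷ []) (x₃ ⊑ x₁ ⊕ x₄ ⊢ x₀ ⊑ x₅ ⊕ x₃
                ⊢ x₅ ⊕ x₄ ⊑ x₂ ⊢ ⊩ x₀ ⊑ x₁ ⊕ x₂)
                refl (≤-reflexive (labels≈ q)) (≤-reflexive (cnt-++ q (labels t) (labelsF ts′)))
                (≥-reflexive (cnt-++ q (labels t) (labelsF ts))))
            (lin (b2n (q v) ∷ cnt q (labelsF ((s′ , t) ∷ ts)) ∷ cnt q (labelsF ((s′ , t) ∷ ts′)) ∷ cnt q
                (labelsF ts′) ∷ cnt q (labelsF ts) ∷ cnt q (labels t) ∷ []) (x₀ ⊕ x₄ ⊑ x₃ ⊢ x₅ ⊕ x₃ ⊑ x₂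
                ⊢ x₁ ⊑ x₅ ⊕ x₄ ⊢ ⊩ x₀ ⊕ x₁ ⊑ x₂)
                refl (≥-reflexive (labels≈ q)) (≥-reflexive (cnt-++ q (labels t) (labelsF ts′)))
                (≤-reflexive (cnt-++ q (labels t) (labelsF ts))))
        ; roots = λ { r y (inj₁ k) → inj₁ k ; r y (inj₂ k) → inj₂ (roots r y k) }
        ; keeps = λ { x r y (inj₁ k) → inj₁ k ; x r y (inj₂ k) → inj₂ (keeps x r y k) }
        ; adds = inj₂ adds }
      go : (p ∈ labels t) ⊎ (p ∈ labelsF ts) → Goal
      go (inj₁ k) = inside (insert t p s v k)
      go (inj₂ k) = later (insertF ts p s v k)

  mutual
    find-parent : ∀ a ts c → c ∈ labelsF ts → Σ[ p ∈ A ] Σ[ s ∈ Bool ] Link (node a ts) p s c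
    find-parent a ((s , node b us) ∷ ts) c m = go (∈-++ (b ∷ labelsF us) (labelsF ts) m)
      where
      Goal = Σ[ p ∈ A ] Σ[ s′ ∈ Bool ] Link (node a ((s , node b us) ∷ ts)) p s′ c
      down : (Σ[ p ∈ A ] Σ[ s′ ∈ Bool ] Link (node b us) p s′ c) → Goal
      down (p , s′ , l) = p , s′ , inj₂ (inj₁ l)
      aside : (Σ[ p ∈ A ] Σ[ s′ ∈ Bool ] Link (node a ts) p s′ c) → Goal
      aside (p , s′ , inj₁ (e , r)) = p , s′ , inj₁ (e , inj₂ r)
      aside (p , s′ , inj₂ l) = p , s′ , inj₂ (inj₂ l)
      go : (c ∈ (b ∷ labelsF us)) ⊎ (c ∈ labelsF ts) → Goal
      go (inj₂ k) = aside (find-parent a ts c k)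
      go (inj₁ k) with ∈-uncons b (labelsF us) k
      ... | inj₁ e = a , s , inj₁ (refl , inj₁ (refl , e))
      ... | inj₂ k′ = down (find-parent b us c k′)

-- Counting in finite sets.

open import Data.Fin using (Fin; zero; suc; inject₁; fromℕ)
import Data.Fin.Properties as Fin
open import Data.List.Relation.Unary.Any using (here; there)
open import Data.List.Relation.Unary.All as All using ([]; _∷_)
open import Data.List.Relation.Unary.AllPairs using ([]; _∷_)
open import Data.List.Relation.Unary.Unique.Propositional using (Unique)
import Data.List.Membership.Propositional as Mem

module FinCounting {n : ℕ} where
  open Counting (Fin._≟_ {n})

  mem⇒ : ∀ {v} xs → v Mem.∈ xs → v ∈ xs
  mem⇒ (x ∷ xs) (here refl) = ∈-here x xs
  mem⇒ {v} (x ∷ xs) (there m) = ∈-there {v} x xs (mem⇒ xs m)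

  ⇒mem : ∀ {v} xs → v ∈ xs → v Mem.∈ xs
  ⇒mem {v} (x ∷ xs) m with ∈-uncons {v} x xs m
  ... | inj₁ e = here e
  ... | inj₂ k = there (⇒mem xs k)

  unique⇒ : ∀ xs → Unique xs → Uniq xs
  unique⇒ [] _ v = z≤n
  unique⇒ (x ∷ xs) (x∉ ∷ u) v = go (v Fin.≟ x)
    where
    go : Dec (v ≡ x) → # v (x ∷ xs) ≤ 1
    go (yes refl) = lin (b2n (x == x) ∷ # x xs ∷ []) (x₀ ⊑ con 1 ⊢ x₁ ⊑ con 0 ⊢ ⊩ x₀ ⊕ x₁ ⊑ con 1)
        refl (b2n≤1 (x == x)) (≤-reflexive (cnt-zero (x ==_) xs λ y m → ==-≢ (All.lookup x∉ (⇒mem xs m))))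
    go (no k) = lin (b2n (v == x) ∷ # v xs ∷ []) (x₀ ⊑ con 0 ⊢ x₁ ⊑ con 1 ⊢ ⊩ x₀ ⊕ x₁ ⊑ con 1)
        refl (≤-reflexive (≢⇒∉ k)) (unique⇒ xs u v)

  ⊆-length : ∀ xs ys → xs ⊆ ys → length xs ≤ length ys
  ⊆-length [] ys h = z≤n
  ⊆-length (x ∷ xs) ys h = go (remove ys (≤-trans (∈-here x xs) (h x)))
    where
    go : (Σ[ zs ∈ List (Fin n) ] (ys ≈ (x ∷ zs))) → suc (length xs) ≤ length ys
    go (zs , eq) = ≤-trans (s≤s (⊆-length xs zs λ v → lin (# v xs ∷ # v zs ∷ b2n (v == x) ∷ # v ys ∷ [])
        (x₂ ⊕ x₀ ⊑ x₃ ⊢ x₃ ⊑ x₂ ⊕ x₁ ⊢ ⊩ x₀ ⊑ x₁) refl (h v) (≤-reflexive (eq (v ==_)))))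
        (≤-reflexive (sym (≈-length ys (x ∷ zs) eq)))

  uniq-⊆ : ∀ xs ys → Uniq xs → (∀ v → v ∈ xs → v ∈ ys) → xs ⊆ ys
  uniq-⊆ xs ys u h v = go (1 ≤? # v xs)
    where
    go : Dec (1 ≤ # v xs) → # v xs ≤ # v ys
    go (yes m) = ≤-trans (u v) (h v m)
    go (no k) = ≤-trans (≤-pred (≰⇒> k)) z≤n

-- From an oriented tree as a digraph to a rooted labelled tree.

open import Data.List using (allFin; filter; lookup)
open import Data.List.Relation.Unary.All as All using (All; []; _∷_)
import Data.List.Relation.Unary.Unique.Propositional.Properties as Unique
open import Data.List.Membership.Propositional.Properties using (∈-filter⁺; ∈-filter⁻; ∈-allFin)
open import Relation.Binary.Construct.Closure.ReflexiveTransitive using (Star; ε; _◅_)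
open import Data.List.Properties using (length-tabulate)

module Digraphs {n : ℕ} (T : Digraph n) (orientedTree : IsOrientedTree T) (r : Fin n) where
  open Digraph T
  open IsOrientedTree orientedTree
  open IsTree isTree
  open Counting (Fin._≟_ {n})
  open FinCounting {n}
  open Labelled (Fin._≟_ {n})
  open Trees using (node)
  open Planting using (leaves)

  uniq-bound : ∀ xs → Uniq xs → length xs ≤ n
  uniq-bound xs u = ≤-trans (⊆-length xs (allFin n) (uniq-⊆ xs (allFin n) u λ v _ → mem⇒ (allFin n) (∈-allFin v)))
    (≤-reflexive (length-tabulate {n = n} λ i → i))

  Chain : Fin n → List (Fin n) → Fin n → Set
  Chain u [] v = u ≡ v
  Chain u (x ∷ xs) v = Adj u x × Chain x xs v

  chain-snoc : ∀ u xs v w → Chain u xs v → Adj v w → Chain u (xs ++ w ∷ []) w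
  chain-snoc u [] .u w refl a = a , refl
  chain-snoc u (x ∷ xs) v w (b , c) a = b , chain-snoc x xs v w c a

  ∈-lookup : ∀ xs (i : Fin (length xs)) → lookup xs i ∈ xs
  ∈-lookup (x ∷ xs) zero = ∈-here x xs
  ∈-lookup (x ∷ xs) (suc i) = ∈-there {lookup xs i} x xs (∈-lookup xs i)

  lookup-injective : ∀ xs → Uniq xs → ∀ i j → lookup xs i ≡ lookup xs j → i ≡ j
  lookup-injective (x ∷ xs) u zero zero e = refl
  lookup-injective (x ∷ xs) u zero (suc j) e = ⊥-elim (twice x xs u (subst (_∈ xs) (sym e) (∈-lookup xs j)))
  lookup-injective (x ∷ xs) u (suc i) zero e = ⊥-elim (twice x xs u (subst (_∈ xs) e (∈-lookup xs i)))
  lookup-injective (x ∷ xs) u (suc i) (suc j) e = cong suc (lookup-injective xs (Uniq-tail x xs u) i j e)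

  chain-step : ∀ x xs z → Chain x xs z → ∀ i → Adj (lookup (x ∷ xs) (inject₁ i)) (lookup (x ∷ xs) (suc i))
  chain-step x (y ∷ xs) z (a , c) zero = a
  chain-step x (y ∷ xs) z (a , c) (suc i) = chain-step y xs z c i

  chain-last : ∀ x xs z → Chain x xs z → lookup (x ∷ xs) (fromℕ (length xs)) ≡ z
  chain-last x [] z e = e
  chain-last x (y ∷ xs) z (a , c) = chain-last y xs z c

  no-cycle : ∀ x a b ys z → Chain x (a ∷ b ∷ ys) z → Adj z x → Uniq (x ∷ a ∷ b ∷ ys) → ⊥
  no-cycle x a b ys z ch back u = acyclic record
    { m = length ys ; c = lookup xs ; distinct = λ {i} {j} → lookup-injective xs u i j
    ; step = chain-step x (a ∷ b ∷ ys) z ch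
    ; close = subst (λ q → Adj q x) (sym (chain-last x (a ∷ b ∷ ys) z ch)) back }
    where xs = x ∷ a ∷ b ∷ ys

  adj-sym : ∀ {u v} → Adj u v → Adj v u
  adj-sym (inj₁ e) = inj₂ e
  adj-sym (inj₂ e) = inj₁ e

  -- Since inclusion respects multiplicities, such a chain within distinct labels is a simple path.
  SPath : List (Fin n) → Fin n → Fin n → Set
  SPath S u v = Σ[ ps ∈ List (Fin n) ] Chain u ps v × ((u ∷ ps) ⊆ S)

  -- A connected part of `T` that has already been rooted at `r`. `paths` is carried along because
  -- it supplies the cycle if a new vertex had two neighbours in this part.
  record Partial : Set where
    field
      t : LTree
      uniq : Uniq (labels t)
      root : r ∈ labels t
      top-r : top t ≡ r
      arcs : ∀ u v → u ∈ labels t → v ∈ labels t → Edge u v → Link t u true v ⊎ Link t v false u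
      paths : ∀ u v → u ∈ labels t → v ∈ labels t → SPath (labels t) u v

  crossing : ∀ S {u w} → Star Adj u w → u ∈ S → # w S ≡ 0 → Σ[ a ∈ Fin n ] Σ[ b ∈ Fin n ] (a ∈ S) × (# b S ≡ 0)
      × Adj a b
  crossing S ε m z = ⊥-elim (1≰0 (≤-trans m (≤-reflexive z)))
  crossing S {u} (_◅_ {j = j} a st) m z = go (1 ≤? # j S)
    where
    go : Dec (1 ≤ # j S) → Σ[ a ∈ Fin n ] Σ[ b ∈ Fin n ] (a ∈ S) × (# b S ≡ 0) × Adj a b
    go (yes k) = crossing S st k z
    go (no k) = u , j , m , n<1⇒n≡0 (≰⇒> k) , a

  sign : ∀ {u v} → Adj u v → Bool
  sign (inj₁ _) = true
  sign (inj₂ _) = false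

  -- A second neighbour `q` of `v` would close a cycle with the simple path from `p` to `q`. So the
  -- arc between `p` and `v` is the only new one.
  extend : (P : Partial) → ∀ p v → p ∈ labels (Partial.t P) → # v (labels (Partial.t P)) ≡ 0 → Adj p v →
    Σ[ Q ∈ Partial ] length (labels (Partial.t Q)) ≡ suc (length (labels (Partial.t P)))
  extend record { t = t ; uniq = uniq ; root = root ; top-r = top-r ; arcs = arcs ; paths = paths } p v mp v∉ pv = go
      (insert t p (sign pv) v mp)
    where
    S = labels t
    only : ∀ q → q ∈ S → Adj v q → q ≡ p
    only q mq a = decide (q Fin.≟ p)
      where
      contra : q ≢ p → SPath S p q → ⊥
      contra ne ([] , e , _) = ne (sym e)
      contra ne (b ∷ ys , ch , sb) = no-cycle v p b ys q (adj-sym pv , ch) (adj-sym a)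
        λ x → ≤-trans (cons-⊆ v (p ∷ b ∷ ys) (v ∷ S) (n≤0⇒n≡0 (≤-trans (sb v) (≤-reflexive v∉))) (∈-here v S)
            (λ y → ≤-trans (sb y) (m≤n+m _ (b2n (y == v)))) x) (uniq⁺ x)
        where
        uniq⁺ : Uniq (v ∷ S)
        uniq⁺ x = two (x Fin.≟ v)
          where
          two : Dec (x ≡ v) → # x (v ∷ S) ≤ 1
          two (yes refl) = lin (b2n (v == v) ∷ # v S ∷ []) (x₀ ⊑ con 1 ⊢ x₁ ⊑ con 0 ⊢ ⊩ x₀ ⊕ x₁ ⊑ con 1)
              refl (b2n≤1 (v == v)) (≤-reflexive v∉)
          two (no k) = lin (b2n (x == v) ∷ # x S ∷ []) (x₀ ⊑ con 0 ⊢ x₁ ⊑ con 1 ⊢ ⊩ x₀ ⊕ x₁ ⊑ con 1)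
              refl (≤-reflexive (≢⇒∉ k)) (uniq x)
      decide : Dec (q ≡ p) → q ≡ p
      decide (yes e) = e
      decide (no ne) = ⊥-elim (contra ne (paths p q mp mq))
    go : Inserted t p (sign pv) v → Σ[ Q ∈ Partial ] length (labels (Partial.t Q)) ≡ suc (length (labels t))
    go record { t′ = t′ ; labels≈ = labels≈ ; top≡ = top≡ ; keeps = keeps ; adds = adds } = record
      { t = t′ ; uniq = uniq′ ; top-r = trans top≡ top-r ; root = ≤-trans root (old⊆ r) ; arcs = λ u w mu mw e
          → arcs′ u w (split u mu) (split w mw) e
      ; paths = λ u w mu mw → paths′ u w (split u mu) (split w mw) } , ≈-length S′ (v ∷ S) labels≈
      where
      S′ = labels t′
      uniq′ : Uniq S′
      uniq′ x = two (x Fin.≟ v)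
        where
        two : Dec (x ≡ v) → # x S′ ≤ 1
        two (yes refl) = lin (# v S′ ∷ b2n ((v ==_) v) ∷ # v (labels t) ∷ []) (x₁ ⊑ con 1 ⊢ x₂ ⊑ con 0 ⊢ x₀ ⊑ x₁ ⊕ x₂
            ⊢ ⊩ x₀ ⊑ con 1) refl (b2n≤1 (v == v)) (≤-reflexive v∉) (≤-reflexive (labels≈ (v ==_)))
        two (no k) = lin (# x S′ ∷ b2n ((x ==_) v) ∷ # x (labels t) ∷ []) (x₁ ⊑ con 0 ⊢ x₂ ⊑ con 1 ⊢ x₀ ⊑ x₁ ⊕ x₂
            ⊢ ⊩ x₀ ⊑ con 1) refl (≤-reflexive (≢⇒∉ k)) (uniq x) (≤-reflexive (labels≈ (x ==_)))
      old⊆ : S ⊆ S′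
      old⊆ x = lin (# x S ∷ # x S′ ∷ b2n (x == v) ∷ []) (x₂ ⊕ x₀ ⊑ x₁ ⊢ ⊩ x₀ ⊑ x₁)
          refl (≥-reflexive (labels≈ (x ==_)))
      v∈ : v ∈ S′
      v∈ = ≤-trans (∈-here v S) (≤-reflexive (sym (labels≈ (v ==_))))
      split : ∀ u → u ∈ S′ → (u ≡ v) ⊎ (u ∈ S)
      split u m = ∈-uncons v S (≤-trans m (≤-reflexive (labels≈ (u ==_))))
      link : ∀ (a : Adj p v) → Link t′ p (sign a) v → Edge p v → Link t′ p true v ⊎ Link t′ v false p
      link (inj₁ _) l e = inj₁ l
      link (inj₂ e′) l e = ⊥-elim (atMostOneEdge e e′)
      link′ : ∀ (a : Adj p v) → Link t′ p (sign a) v → Edge v p → Link t′ v true p ⊎ Link t′ p false v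
      link′ (inj₂ _) l e = inj₂ l
      link′ (inj₁ e′) l e = ⊥-elim (atMostOneEdge e e′)
      arcs′ : ∀ u w → (u ≡ v) ⊎ (u ∈ S) → (w ≡ v) ⊎ (w ∈ S) → Edge u w → Link t′ u true w ⊎ Link t′ w false u
      arcs′ u w (inj₁ refl) (inj₁ refl) e = ⊥-elim (irrefl refl e)
      arcs′ u w (inj₁ refl) (inj₂ mw) e with only w mw (inj₁ e)
      ... | refl = link′ pv adds e
      arcs′ u w (inj₂ mu) (inj₁ refl) e with only u mu (inj₂ e)
      ... | refl = link pv adds e
      arcs′ u w (inj₂ mu) (inj₂ mw) e with arcs u w mu mw e
      ... | inj₁ l = inj₁ (keeps u true w l)
      ... | inj₂ l = inj₂ (keeps w false u l)
      fromV : ∀ w → SPath S p w → SPath S′ v w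
      fromV w (ps , ch , sb) = p ∷ ps , (adj-sym pv , ch) , cons-⊆ v (p ∷ ps) S′
          (n≤0⇒n≡0 (≤-trans (sb v) (≤-reflexive v∉))) v∈ λ y → ≤-trans (sb y) (old⊆ y)
      toV : ∀ u → SPath S u p → SPath S′ u v
      toV u (ps , ch , sb) = ps ++ v ∷ [] , chain-snoc u ps p v ch pv , λ y → ≤-trans
          (≤-reflexive (≈-shift v (u ∷ ps) [] (y ==_)))
        (≤-trans (≤-reflexive (cong (λ l → # y (v ∷ l)) (++-identityʳ (u ∷ ps))))
          (cons-⊆ v (u ∷ ps) S′ (n≤0⇒n≡0 (≤-trans (sb v) (≤-reflexive v∉))) v∈ (λ y → ≤-trans (sb y) (old⊆ y)) y))
      wider : ∀ u w → SPath S u w → SPath S′ u w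
      wider u w (ps , ch , sb) = ps , ch , λ y → ≤-trans (sb y) (old⊆ y)
      paths′ : ∀ u w → (u ≡ v) ⊎ (u ∈ S) → (w ≡ v) ⊎ (w ∈ S) → SPath S′ u w
      paths′ u w (inj₁ refl) (inj₁ refl) = [] , refl , single v S′ v∈
      paths′ u w (inj₁ refl) (inj₂ mw) = fromV w (paths p w mp mw)
      paths′ u w (inj₂ mu) (inj₁ refl) = toV u (paths u p mu mp)
      paths′ u w (inj₂ mu) (inj₂ mw) = wider u w (paths u w mu mw)

  Full : Set
  Full = Σ[ P ∈ Partial ] (∀ v → v ∈ labels (Partial.t P))

  -- While a vertex is missing, connectivity yields an arc that leaves the labels. Labels are
  -- distinct, so there are at most `n`, and `k` bounds the steps that remain.
  complete : ∀ k (P : Partial) → n ≤ length (labels (Partial.t P)) + k → Full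
  complete k P bound = go (Fin.any? λ w → # w (labels (Partial.t P)) ≤? 0)
    where
    open Partial P
    grow : ∀ k → n ≤ length (labels t) + k → Σ[ a ∈ Fin n ] Σ[ b ∈ Fin n ] (a ∈ labels t) × (# b (labels t) ≡ 0)
        × Adj a b → Full
    next : ∀ k → n ≤ length (labels t) + suc k → Σ[ Q ∈ Partial ] length (labels (Partial.t Q)) ≡ suc
        (length (labels t)) → Full
    grow zero b (p , v , mp , v∉ , a) = ⊥-elim
        (1+n≰n (≤-trans (uniq-bound (labels (Partial.t (proj₁ Q))) (Partial.uniq (proj₁ Q)))
        (≤-trans b (≤-reflexive (+-identityʳ _))) |> λ h → ≤-trans (≤-reflexive (sym (proj₂ Q))) h))
      where
      Q = extend P p v mp v∉ a
      _|>_ : ∀ {X Y : Set} → X → (X → Y) → Y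
      x |> f = f x
    grow (suc k) b (p , v , mp , v∉ , a) = next k b (extend P p v mp v∉ a)
    next k b (Q , eq) = complete k Q (≤-trans b (≤-reflexive (trans (+-suc _ k) (cong (_+ k) (sym eq)))))
    go : Dec (Σ[ w ∈ Fin n ] # w (labels t) ≤ 0) → Full
    go (no none) = P , λ v → ≰⇒> λ z → none (v , z)
    go (yes (w , z)) = grow k bound (crossing (labels t) (connected r w) root (n≤0⇒n≡0 z))

  full : Full
  full = complete n P₀ (m≤n+m n _)
    where
    P₀ : Partial
    P₀ = record { t = node r [] ; uniq = λ v → ≤-trans (≤-reflexive (+-identityʳ _)) (b2n≤1 (v == r))
        ; root = ∈-here r [] ; top-r = refl
      ; arcs = λ u v mu mv e → ⊥-elim (irrefl (trans (is u mu) (sym (is v mv))) e)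
      ; paths = λ u v mu mv → [] , trans (is u mu) (sym (is v mv)) , single u (r ∷ []) mu }
      where
      is : ∀ u → u ∈ (r ∷ []) → u ≡ r
      is u m with ∈-uncons r [] m
      ... | inj₁ e = e

  module _ (b : Bool × LTree) (ts : List (Bool × LTree)) (uniq : Uniq (labels (node r (b ∷ ts))))
    (every : ∀ v → v ∈ labels (node r (b ∷ ts)))
    (arcs : ∀ u v → Edge u v → Link (node r (b ∷ ts)) u true v ⊎ Link (node r (b ∷ ts)) v false u) where

    private
      t : LTree
      t = node r (b ∷ ts)

    -- Such a vertex has no child, so each of its neighbours is its unique parent. It does have one:
    -- it differs from the root, which has a child.
    ends-leaf : ∀ v → v ∈ ends t → Leaf v
    ends-leaf v mv = go (find-parent r (b ∷ ts) v below)
      where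
      below : v ∈ labelsF (b ∷ ts)
      below = ≤-trans mv (endsF⊆ (b ∷ ts) v)
      v≢r : v ≢ r
      v≢r e = twice r (labelsF (b ∷ ts)) uniq (subst (_∈ labelsF (b ∷ ts)) e below)
      nbr : Star Adj v r → Σ[ u ∈ Fin n ] Adj v u
      nbr ε = ⊥-elim (v≢r refl)
      nbr (a ◅ _) = _ , a
      fl : List (Fin n)
      fl = filter (adj? v) (allFin n)
      go : (Σ[ p ∈ Fin n ] Σ[ s ∈ Bool ] Link t p s v) → Leaf v
      go (p , s , l) = ≤-antisym (⊆-length fl (p ∷ [])
          (uniq-⊆ fl (p ∷ []) (unique⇒ fl (Unique.filter⁺ (adj? v) (Unique.allFin⁺ n))) inP))
          (some (nbr (connected v r)))
        where
        isP : ∀ u → Adj v u → u ≡ p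
        isP u (inj₁ e) with arcs v u e
        ... | inj₁ k = ⊥-elim (childless t uniq v true u mv k)
        ... | inj₂ k = one-parent t uniq u false p s v k l
        isP u (inj₂ e) with arcs u v e
        ... | inj₁ k = one-parent t uniq u true p s v k l
        ... | inj₂ k = ⊥-elim (childless t uniq v false u mv k)
        inP : ∀ u → u ∈ fl → u ∈ (p ∷ [])
        inP u m = subst (_∈ (p ∷ [])) (sym (isP u (proj₂ (∈-filter⁻ (adj? v) {xs = allFin n} (⇒mem fl m)))))
            (∈-here p [])
        some : (Σ[ u ∈ Fin n ] Adj v u) → 1 ≤ length fl
        some (u , a) = ≤-trans (mem⇒ fl (∈-filter⁺ (adj? v) (∈-allFin u) a)) (cnt≤length (u ==_) fl)

    -- Only an inequality, because the root may be a leaf of `T` and is not among the `ends`.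
    leaves≤ : leaves (shape t) ≤ numLeaves
    leaves≤ = ≤-trans (≤-reflexive (leaves-ends t)) (⊆-length (ends t) (filter leaf? (allFin n))
      (uniq-⊆ (ends t) (filter leaf? (allFin n)) (λ v → ≤-trans (ends⊆ t v) (uniq v)) λ v m →
        mem⇒ (filter leaf? (allFin n)) (∈-filter⁺ leaf? (∈-allFin v) (ends-leaf v m))))

-- From the copy of a rooted tree to the theorem.

open import Data.Nat using (NonZero)
open import Data.Fin using (Fin; zero; suc; inject≤)
open import Data.List using (allFin)
open import Data.List.Properties using (length-tabulate; map-++)
open import Data.List.Membership.Propositional.Properties using (∈-map⁻; ∈-++⁺ˡ; ∈-++⁺ʳ; ∈-allFin)
open Trees using (Tree; node; need; flat; Core)
open Planting using (size; leaves; 1≤leaves; module Decompose)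

module Copy {n N : ℕ} (e : Fin N → Fin N → Bool) (tot : ∀ u v → u ≢ v → e u v ≡ not (e v u)) where
  open MedianOrder (Fin._≟_ {N}) e tot using (E)
  open Copies (Fin._≟_ {N}) e tot using (Emb; EmbF; node; []; cons; verts; vertsF)
  open Labelled (Fin._≟_ {n})

  mutual
    -- The graph of the embedding: distinct labels make it a function, distinct vertices make that
    -- function injective.
    pairs : ∀ t {r} → Emb (shape t) r → List (Fin n × Fin N)
    pairs (node a ts) {r} (node f) = (a , r) ∷ pairsF ts f

    pairsF : ∀ ts {r} → EmbF r (shapes ts) → List (Fin n × Fin N)
    pairsF [] [] = []
    pairsF ((s , t) ∷ ts) (cons _ em f) = pairs t em ++ pairsF ts f

  mutual
    pairs-labels : ∀ t {r} (em : Emb (shape t) r) → map proj₁ (pairs t em) ≡ labels t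
    pairs-labels (node a ts) (node f) = cong (a ∷_) (pairsF-labels ts f)

    pairsF-labels : ∀ ts {r} (f : EmbF r (shapes ts)) → map proj₁ (pairsF ts f) ≡ labelsF ts
    pairsF-labels [] [] = refl
    pairsF-labels ((s , t) ∷ ts) (cons _ em f) = trans (map-++ proj₁ (pairs t em) _)
        (cong₂ _++_ (pairs-labels t em) (pairsF-labels ts f))

  mutual
    pairs-verts : ∀ t {r} (em : Emb (shape t) r) → map proj₂ (pairs t em) ≡ verts em
    pairs-verts (node a ts) (node f) = cong (_ ∷_) (pairsF-verts ts f)

    pairsF-verts : ∀ ts {r} (f : EmbF r (shapes ts)) → map proj₂ (pairsF ts f) ≡ vertsF f
    pairsF-verts [] [] = refl
    pairsF-verts ((s , t) ∷ ts) (cons _ em f) = trans (map-++ proj₂ (pairs t em) _)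
        (cong₂ _++_ (pairs-verts t em) (pairsF-verts ts f))

  top-pair : ∀ t {r} (em : Emb (shape t) r) → (top t , r) Mem.∈ pairs t em
  top-pair (node a ts) (node f) = here refl

  root-pair : ∀ ts {r} (f : EmbF r (shapes ts)) s c → Root ts s c → Σ[ y ∈ Fin N ] ((c , y) Mem.∈ pairsF ts f)
      × (E s r y ≡ true)
  root-pair ((_ , t) ∷ ts) (cons {r′ = y} q em f) s c (inj₁ (refl , refl)) = y , ∈-++⁺ˡ (top-pair t em) , q
  root-pair ((_ , t) ∷ ts) (cons q em f) s c (inj₂ k) with root-pair ts f s c k
  ... | y , m , q′ = y , ∈-++⁺ʳ (pairs t em) m , q′

  Linked : List (Fin n × Fin N) → Fin n → Bool → Fin n → Set
  Linked ps p s c = Σ[ x ∈ Fin N ] Σ[ y ∈ Fin N ] ((p , x) Mem.∈ ps) × ((c , y) Mem.∈ ps) × (E s x y ≡ true)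

  mutual
    linked : ∀ t {r} (em : Emb (shape t) r) p s c → Link t p s c → Linked (pairs t em) p s c
    linked (node a ts) {r} (node f) p s c (inj₁ (refl , k)) with root-pair ts f s c k
    ... | y , m , q = r , y , here refl , there m , q
    linked (node a ts) (node f) p s c (inj₂ k) with linkedF ts f p s c k
    ... | x , y , m , m′ , q = x , y , there m , there m′ , q

    linkedF : ∀ ts {r} (f : EmbF r (shapes ts)) p s c → LinkF ts p s c → Linked (pairsF ts f) p s c
    linkedF ((_ , t) ∷ ts) (cons _ em f) p s c (inj₁ k) with linked t em p s c k
    ... | x , y , m , m′ , q = x , y , ∈-++⁺ˡ m , ∈-++⁺ˡ m′ , q
    linkedF ((_ , t) ∷ ts) (cons _ em f) p s c (inj₂ k) with linkedF ts f p s c k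
    ... | x , y , m , m′ , q = x , y , ∈-++⁺ʳ (pairs t em) m , ∈-++⁺ʳ (pairs t em) m′ , q

module Keys {n : ℕ} {X : Set} (g : X → Fin n) where
  open Counting (Fin._≟_ {n})

  key∈ : ∀ {x} xs → x Mem.∈ xs → g x ∈ map g xs
  key∈ (x ∷ xs) (here refl) = ∈-here (g x) (map g xs)
  key∈ {y} (x ∷ xs) (there m) = ∈-there {g y} (g x) (map g xs) (key∈ xs m)

  key-injective : ∀ xs → Uniq (map g xs) → ∀ {x y} → x Mem.∈ xs → y Mem.∈ xs → g x ≡ g y → x ≡ y
  key-injective (x ∷ xs) u (here refl) (here refl) eq = refl
  key-injective (x ∷ xs) u {y = y} (here refl) (there m) eq =
    ⊥-elim (1≰0 (≤-trans (subst (_∈ map g xs) (sym eq) (key∈ xs m)) (≤-reflexive (Uniq-head (g x) (map g xs) u))))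
  key-injective (x ∷ xs) u (there m) (here refl) eq =
    ⊥-elim (1≰0 (≤-trans (subst (_∈ map g xs) eq (key∈ xs m)) (≤-reflexive (Uniq-head (g x) (map g xs) u))))
  key-injective (x ∷ xs) u (there m) (there m′) eq = key-injective xs (Uniq-tail (g x) (map g xs) u) m m′ eq

module Embed {N : ℕ} (e : Fin N → Fin N → Bool) (tot : ∀ u v → u ≢ v → e u v ≡ not (e v u)) where
  open Counting (Fin._≟_ {N})
  open FinCounting {N}
  open MedianOrder (Fin._≟_ {N}) e tot
  open Paths (Fin._≟_ {N}) e tot
  open Copies (Fin._≟_ {N}) e tot using (Emb; verts; Zoned; Candidate; med)
  open Embedding (Fin._≟_ {N}) e tot using (claim)
  open Decompose 1092 ≤-refl

  Found : Tree → Set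
  Found t = Σ[ r ∈ Fin N ] Σ[ em ∈ Emb t r ] Uniq (verts em)

  allUniq : Uniq (allFin N)
  allUniq = unique⇒ (allFin N) (Unique.allFin⁺ N)

  find : ∀ t → 137 + size t + 2 * (1092 * leaves t) ≤ N → Found t
  find t big = go (core-of t)
    where
    go : (Σ[ c ∈ Core ] (flat c ≡ t) × (need c ≤ 137 + size t + 2 * (1092 * leaves t))) → Found t
    go (c , refl , l) = go′ (median (allFin N) allUniq)
      where
      go′ : (Σ[ ys ∈ List (Fin N) ] (ys ≈ allFin N) × Half true ys × Half false (reverse ys)) → Found (flat c)
      go′ (ys , eq , h , h′) = choose (claim c true ys (λ _ → false) (med h h′) uy
          (room (≤-trans (≤-reflexive (trans (cong (λ k → need c + 10 * k) (cnt-zero (λ _ → false) ys λ _ _ → refl))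
              (+-identityʳ (need c))))
            (≤-trans l (≤-trans big (≤-reflexive
                (sym (trans (≈-length ys (allFin N) eq) (length-tabulate λ i → i)))))))))
        where
        uy : Uniq ys
        uy v = ≤-trans (≤-reflexive (eq (v ==_))) (allUniq v)
        choose : Zoned (flat c) ys (λ _ → false) → Found (flat c)
        choose ζ = pick (Zoned.zs ζ) (Zoned.big ζ) (λ z m → Zoned.cand ζ z m)
          where
          pick : ∀ zs → 7 ≤ length zs → (∀ z → z ∈ zs → Candidate (flat c) ys (λ _ → false) z) → Found (flat c)
          -- No path leads to the root of the whole tree, so any candidate will do and its list of
          -- vertices to avoid is empty.
          pick (z ∷ zs) _ cand = take (Candidate.embed (cand z (∈-here z zs)) [] z≤n λ u ())
            where
            take : (Σ[ em ∈ Emb (flat c) z ] ((∀ v → # v (verts em) ≤ # v ys)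
                × (∀ u → u ∈ verts em → (false ≡ false) × (# u [] ≡ 0)))) → Found (flat c)
            take (em , sb , _) = z , em , λ v → ≤-trans (sb v) (uy v)

module Main {n k N : ℕ} (enoughN : n + 2321 * k ≤ N) (G : Digraph N) (tour : IsTournament G) (T : Digraph n)
    (ot : IsOrientedTree T)
  (leaf : Digraph.numLeaves T ≡ k) (r : Fin n) where
  open Digraph

  e : Fin N → Fin N → Bool
  e u v = does (edge? G u v)

  e-sound : ∀ {u v} → e u v ≡ true → Edge G u v
  e-sound {u} {v} q with edge? G u v
  ... | yes p = p

  tot : ∀ u v → u ≢ v → e u v ≡ not (e v u)
  tot u v ne with edge? G u v | edge? G v u | IsTournament.exactlyOne tour u v ne
  ... | yes _ | no _ | _ = refl
  ... | no _ | yes _ | _ = refl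
  ... | yes p | yes q | inj₁ (_ , q′) = ⊥-elim (q′ q)
  ... | yes p | yes q | inj₂ (p′ , _) = ⊥-elim (p′ p)
  ... | no p | no q | inj₁ (p′ , _) = ⊥-elim (p p′)
  ... | no p | no q | inj₂ (_ , q′) = ⊥-elim (q q′)

  module TT = Digraphs T ot r
  open Labelled (Fin._≟_ {n})
  open Counting (Fin._≟_ {n}) using (Uniq; _∈_; ∈-uncons; #)
  open MedianOrder (Fin._≟_ {N}) e tot using (E)
  open Embed e tot using (Found; find)
  open Copy {n} e tot
  open Copies (Fin._≟_ {N}) e tot using (Emb; verts)

  n≤N : n ≤ N
  n≤N = ≤-trans (m≤m+n n (2321 * k)) enoughN

  -- A single vertex has degree zero and hence is no leaf, so the tournament may be just as small,
  -- and the general bound does not apply.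
  alone : (∀ v → v ∈ (r ∷ [])) → ContainsCopy G T
  alone every = (λ v → inject≤ v n≤N) , Fin.inject≤-injective n≤N n≤N _ _ , λ u v q
      → ⊥-elim (irrefl T (trans (is u) (sym (is v))) q)
    where
    is : ∀ v → v ≡ r
    is v with ∈-uncons {v} r [] (every v)
    ... | inj₁ q = q

  place : ∀ t → Uniq (labels t) → (∀ v → v ∈ labels t) → (∀ u v → Edge T u v → Link t u true v ⊎ Link t v false u) →
    Found (shape t) → ContainsCopy G T
  place t uq every arcs (z , em , uv) = f , injective , edges
    where
    ps = pairs t em
    module K₁ = Keys {n} {Fin n × Fin N} proj₁
    module K₂ = Keys {N} {Fin n × Fin N} proj₂
    at : ∀ v → Σ[ x ∈ Fin N ] ((v , x) Mem.∈ ps)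
    at v with ∈-map⁻ proj₁ (subst (v Mem.∈_) (sym (pairs-labels t em)) (FinCounting.⇒mem (labels t) (every v)))
    ... | (_ , x) , m , refl = x , m
    f : Fin n → Fin N
    f v = proj₁ (at v)
    injective : ∀ {u v} → f u ≡ f v → u ≡ v
    injective {u} {v} q = cong proj₁
        (K₂.key-injective ps (subst (λ l → Counting.Uniq (Fin._≟_ {N}) l) (sym (pairs-verts t em)) uv) (proj₂ (at u))
        (proj₂ (at v)) q)
    is : ∀ {v x} → (v , x) Mem.∈ ps → f v ≡ x
    is {v} m = cong proj₂ (K₁.key-injective ps (subst Uniq (sym (pairs-labels t em)) uq) (proj₂ (at v)) m refl)
    edges : ∀ u v → Edge T u v → Edge G (f u) (f v)
    edges u v q with arcs u v q
    ... | inj₁ l with linked t em u true v l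
    ...   | x , y , m , m′ , xy = subst₂ (Edge G) (sym (is m)) (sym (is m′)) (e-sound xy)
    edges u v q | inj₂ l with linked t em v false u l
    ...   | x , y , m , m′ , xy = subst₂ (Edge G) (sym (is m′)) (sym (is m)) (e-sound xy)

  copy : TT.Full → ContainsCopy G T
  copy (record { t = node a [] ; top-r = refl } , every) = alone every
  copy (record { t = t@(node a (b ∷ ts)) ; uniq = uq ; top-r = refl ; arcs = arcs } , every) = place t uq every arcs′
      (find (shape t) enough)
    where
    arcs′ : ∀ u v → Edge T u v → Link t u true v ⊎ Link t v false u
    arcs′ u v q = arcs u v (every u) (every v) q
    -- There is at least one leaf, to which the fixed `137` is charged.
    bound : ∀ m l → m ≤ n → 1 ≤ l → l ≤ k → 137 + m + 2 * (1092 * l) ≤ N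
    bound m l p q h = lin (m ∷ l ∷ N ∷ n ∷ k ∷ []) (x₀ ⊑ x₃ ⊢ con 137 ⊑ x₁ ⊕ 136 ⊛ x₁
        ⊢ x₁ ⊕ 2320 ⊛ x₁ ⊑ x₄ ⊕ 2320 ⊛ x₄ ⊢ x₃ ⊕ 2321 ⊛ x₄ ⊑ x₂ ⊢ ⊩ con 137 ⊕ x₀ ⊕ 2 ⊛ (1092 ⊛ x₁) ⊑ x₂)
        refl p (*-monoʳ-≤ 137 q) (*-monoʳ-≤ 2321 h) enoughN
    enough : 137 + size (shape t) + 2 * (1092 * leaves (shape t)) ≤ N
    enough = bound (size (shape t)) (leaves (shape t))
        (≤-trans (≤-reflexive (size-labels t)) (TT.uniq-bound (labels t) uq)) (1≤leaves (shape t))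
      (≤-trans (TT.leaves≤ b ts uq every arcs′) (≤-reflexive leaf))

theorem1p1 : Σ[ C ∈ ℕ ] (0 < C ×
    (∀ (n k : ℕ) (G : Digraph (n + C * k)) → IsTournament G →
    ∀ (T : Digraph n) → IsOrientedTree T → Digraph.numLeaves T ≡ k →
    ContainsCopy G T))
theorem1p1 = 2321 , s≤s z≤n , go
  where
  go : ∀ (n k : ℕ) (G : Digraph (n + 2321 * k)) → IsTournament G →
    ∀ (T : Digraph n) → IsOrientedTree T → Digraph.numLeaves T ≡ k → ContainsCopy G T
  go zero k G tour T ot leaf = ⊥-elim (NonZero.nonZero (IsTree.nonEmpty (IsOrientedTree.isTree ot)))
  go (suc n) k G tour T ot leaf = Main.copy ≤-refl G tour T ot leaf zero (Digraphs.full T ot zero)
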